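{- For every honeycomb toroidal graph $\mathrm{HTG}(m,n,\ell)$ and every integer $L$ with $L\equiv 2\pmod 4$ and $6\le L\le mn$, the graph $\mathrm{HTG}(m,n,\ell)$ contains a cycle of length $L$.
   Context: Honeycomb toroidal graph: let $m\ge 1$ be an integer, $n\ge 4$ an even integer, and $\ell$ an integer with $\ell\equiv m \pmod 2$. The graph $\mathrm{HTG}(m,n,\ell)$ has vertex set $\{u_{i,j}: 0\le i\le m-1,\ j\in\mathbb{Z}_n\}$ (second subscripts are taken modulo $n$; the vertices $u_{i,0},\dots,u_{i,n-1}$ form column $i$) and the following edges: vertical edges $u_{i,j}u_{i,j+1}$ for all $0\le i\le m-1$ and all $j$; flat edges $u_{i,j}u_{i+1,j}$ for $0\le i\le m-2$ and all $j$ with $i+j$ odd; jump edges $u_{m-1,j}u_{0,j+\ell}$ for all $j$ with $j\equiv m\pmod 2$. Only parameters for which this is a simple 3-regular graph are allowed (in particular, when $m=1$ one requires $\ell\not\equiv\pm1\pmod n$). -}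

module Defs where

open import Level using (0ℓ)
open import Data.Fin.Base using (Fin; toℕ)
open import Data.Integer.Base as ℤ using (ℤ; +_; _-_)
open import Data.Integer.Divisibility using (_∣_)
open import Data.List.Base using (List; _∷_; _∷ʳ_; length)
open import Data.List.Membership.Propositional using (_∈_)
open import Data.List.Relation.Unary.Linked using (Linked)
open import Data.List.Relation.Unary.Unique.Propositional using (Unique)
open import Data.Nat.Base using (ℕ; suc; _≤_)
open import Data.Product.Base using (_×_; _,_; ∃-syntax)
open import Function.Bundles using (_⇔_)
open import Relation.Binary.Core using (Rel)
open import Relation.Binary.Construct.Closure.Symmetric using (SymClosure)
open import Relation.Binary.PropositionalEquality.Core using (_≡_; _≢_)

infix 4 _≡_[mod_]

_≡_[mod_] : ℤ → ℤ → ℕ → Set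
a ≡ b [mod k ] = + k ∣ (a - b)

module _ {V : Set} (_~_ : Rel V 0ℓ) where

  -- Distinct neighbours are counted, so parallel edges count once.
  Regular : ℕ → Set
  Regular d = ∀ v → ∃[ ns ] length ns ≡ d × Unique ns × (∀ w → v ~ w ⇔ w ∈ ns)

  -- The vertices of the cycle, in cyclic order, are v ∷ vs.
  HasCycle : ℕ → Set
  HasCycle L = 3 ≤ L × (∃[ v ] ∃[ vs ]
    length (v ∷ vs) ≡ L × Unique (v ∷ vs) × Linked _~_ (v ∷ (vs ∷ʳ v)))

Vertex : ℕ → ℕ → Set
Vertex m n = Fin m × Fin n

⟦_⟧ : ∀ {k} → Fin k → ℤ
⟦ i ⟧ = + toℕ i

-- (i , j) is u_{i,j}; the element j of ℤ_n is given by its representative in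
-- {0, …, n-1}, whose parity is that of the residue class because n is even.
data Edge (m n : ℕ) (ℓ : ℤ) : Vertex m n → Vertex m n → Set where
  vertical : ∀ {i j j′} →
             ⟦ j′ ⟧ ≡ ⟦ j ⟧ ℤ.+ + 1 [mod n ] →
             Edge m n ℓ (i , j) (i , j′)
  flat     : ∀ {i i′ j} →
             toℕ i′ ≡ suc (toℕ i) →
             ⟦ i ⟧ ℤ.+ ⟦ j ⟧ ≡ + 1 [mod 2 ] →
             Edge m n ℓ (i , j) (i′ , j)
  jump     : ∀ {i i′ j j′} →
             suc (toℕ i) ≡ m → toℕ i′ ≡ 0 →
             ⟦ j ⟧ ≡ + m [mod 2 ] →
             ⟦ j′ ⟧ ≡ ⟦ j ⟧ ℤ.+ ℓ [mod n ] →
             Edge m n ℓ (i , j) (i′ , j′)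

HTG : (m n : ℕ) (ℓ : ℤ) → Rel (Vertex m n) 0ℓ
HTG m n ℓ = SymClosure (Edge m n ℓ)

-- Every vertex of HTG m n ℓ is incident with two vertical edges and one flat or
-- jump edge, so three distinct neighbours exclude parallel edges.  For m ≡ 1
-- this amounts to ℓ not being congruent to 1 or -1 modulo n.
record SimpleCubic {V : Set} (_~_ : Rel V 0ℓ) : Set where
  field
    loopless  : ∀ {v w} → v ~ w → v ≢ w
    3-regular : Regular _~_ 3

{-# OPTIONS --safe #-}
module Submission where

-- The honeycomb toroidal graph is the brick wall, with vertices (i , j) and faces
-- hexagons, modulo the translations (0 , n) and (m , -ℓ).  Gluing a hexagon along a
-- single edge lengthens a cycle by 4, so a snake of k hexagons, each glued to the
-- previous one, is bounded by a cycle of length 4k + 2.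
--
-- For m even, a snake that fills the strips between the columns 0 and 1, 2 and 3, …
-- in turn, passing from one strip to the next through a hexagon at the row 0, reaches
-- length mn - 2, and 4 divides mn.  For m odd the snake lives in m - 1 columns, and
-- for the remaining lengths it is merged with column 0, which is itself a cycle of
-- length n.  This leaves only the Hamiltonian cycles with m ≥ 3 odd and n ≡ 2 mod 4.
--
-- For m = 1 we may take 3 ≤ ℓ ≤ n/2 by reflection.  A snake winding up the helix
-- serves as long as it fits below the row n; otherwise n - L is small, and the
-- column itself, cut and reglued along one or two bands of hexagons, has length L.
--
-- For the Hamiltonian cycles, view HTG(1, n, ℓ) as a cubic multigraph.  By
-- Thomason's lollipop argument the Hamiltonian cycles through a given edge come in
-- pairs, so besides the column there is one using a jump.  Each of its jumps, at the
-- row j say, is replaced by a path that sweeps, in the columns 1, …, m - 1, all rows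
-- from j up to the next jump; m - 1 being even, it ends at the row j again.

open import Data.Empty using (⊥)
open import Data.Fin.Base using (Fin; zero; suc; toℕ; fromℕ<; combine)
open import Data.Fin.Properties using (toℕ-fromℕ<; toℕ-injective; toℕ<n) renaming (_≟_ to _≟ᶠ_)
import Data.Fin.Properties as Finₚ
open import Data.Integer.Base as ℤ using (ℤ; +_; -_; _-_; ∣_∣)
open import Data.Integer.DivMod using (_/ℕ_; n%ℕd<d; a≡a%ℕn+[a/ℕn]*n)
open import Data.Integer.Divisibility.Signed using (divides; ∣ᵤ⇒∣; ∣⇒∣ᵤ)
import Data.Integer.Properties as ℤₚ
open import Data.Integer.Tactic.RingSolver using () renaming (solve-∀ to ℤ-solve-∀)
open import Data.List.Base using (List; []; _∷_; _++_; _∷ʳ_; length; map; reverse; [_]; allFin; cartesianProduct)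
import Data.List.Membership.DecPropositional as DecMembership
open import Data.List.Membership.Propositional using (_∈_; _∉_)
open import Data.List.Membership.Propositional.Properties
  using (∈-++⁺ˡ; ∈-++⁺ʳ; ∈-++⁻; ∈-allFin; ∈-cartesianProduct⁺; ∈-map⁺; ∈-map⁻)
open import Data.List.Membership.Propositional.Properties.WithK using (unique∧set⇒bag)
open import Data.List.Properties
  using (unfold-reverse; reverse-involutive; length-reverse; length-++; length-map; length-tabulate; map-++;
         ≡-dec; ∷-injectiveˡ; ∷-injectiveʳ)
open import Data.List.Relation.Binary.BagAndSetEquality using (∼bag⇒↭)
open import Data.List.Relation.Binary.Permutation.Propositional
  using (_↭_; ↭-sym; ↭-trans; ↭-reflexive; ↭⇒↭ₛ)
open import Data.List.Relation.Binary.Permutation.Propositional.Properties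
  using (↭-reverse; ↭-length; ∈-resp-↭; shifts; ++⁺ˡ)
import Data.List.Relation.Binary.Permutation.Setoid.Properties as ↭ₛ
open import Data.List.Relation.Unary.All as All using (All; []; _∷_; all?)
open import Data.List.Relation.Unary.All.Properties using (¬Any⇒All¬; All¬⇒¬Any)
import Data.List.Relation.Unary.All.Properties as Allₚ
open import Data.List.Relation.Unary.AllPairs using ([]; _∷_)
open import Data.List.Relation.Unary.Any using (here; there; any?)
open import Data.List.Relation.Unary.Linked using (Linked; [-]; _∷_)
open import Data.List.Relation.Unary.Unique.Propositional using (Unique)
import Data.List.Relation.Unary.Unique.Propositional.Properties as Uniqueₚ
open import Data.Nat.Base hiding (∣_-_∣)
open import Data.Nat.Divisibility.Core using (_∣_)
import Data.Nat.Divisibility as ℕ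
open import Data.Nat.DivMod using (m<n⇒m%n≡m; m%n<n; m≡m%n+[m/n]*n)
open import Data.Nat.Induction using (<-wellFounded; Acc; acc)
open import Data.Nat.Properties
open import Data.Nat.Tactic.RingSolver using (solve-∀)
open import Data.Parity.Base using (Parity; 0ℙ; 1ℙ; _⁻¹)
open import Data.Product.Base as Product using (_×_; _,_; proj₁; proj₂; ∃-syntax)
import Data.Product.Properties as Productₚ
open import Data.Sum.Base using (_⊎_; inj₁; inj₂; [_,_]′; map₁)
open import Function.Base using (_∘_)
open import Function.Bundles using (Equivalence; mk⇔)
open import Level using (0ℓ)
open import Relation.Binary.Construct.Closure.Symmetric using (fwd; bwd; symmetric)
open import Relation.Binary.Core using (Rel)
open import Relation.Binary.Definitions using (DecidableEquality; Symmetric; tri<; tri≈; tri>)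
open import Relation.Binary.PropositionalEquality hiding ([_])
open import Relation.Nullary using (¬_; contradiction)
open import Relation.Nullary.Decidable using (Dec; yes; no; map′; ¬?; _×-dec_; _⊎-dec_; _→-dec_; from-yes)
open import Relation.Unary using (Decidable)
open import Data.List.Relation.Unary.Unique.DecPropositional (Productₚ.≡-dec _≟_ _≟_) using (unique?)
open import Defs

-- Closed walks

-- The snakes use no jump, so for m ≥ 2 the value of ℓ does not enter them. A Hamiltonian cycle with
-- m ≥ 2 cannot do without jumps: otherwise the vertices of column 0 at even rows keep only their
-- two vertical edges, these force every edge of the column, and the column closes up by itself. For
-- the same reason a seed that merges column 0 with a tooth has to drop a vertex at an even row.
-- Which jumps a Hamiltonian cycle should use depends on n and ℓ in no evident way, hence a parity
-- argument in place of a construction. It must supply at least one jump, since the sweeps run from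
-- one jump to the next. For m ≥ 3 nothing excludes ℓ ≡ ±1 modulo n, so in HTG(1, n, ℓ) a jump may
-- be parallel to a vertical edge. Cycles there are therefore recorded as words of edge colours, not
-- as lists of vertices.

Unique-↭ : ∀ {A : Set} {xs ys : List A} → xs ↭ ys → Unique xs → Unique ys
Unique-↭ {A} p = ↭ₛ.Unique-resp-↭ (setoid A) (↭⇒↭ₛ p)

infixr 5 _∷!_
_∷!_ : ∀ {A : Set} {x : A} {xs} → x ∉ xs → Unique xs → Unique (x ∷ xs)
x∉ ∷! xs! = ¬Any⇒All¬ _ x∉ ∷ xs!

∷ʳ-unique : ∀ {A : Set} {x : A} {xs} → x ∉ xs → Unique xs → Unique (xs ∷ʳ x)
∷ʳ-unique x∉ xs! = Uniqueₚ.++⁺ xs! ([] ∷ []) λ { (y∈ , here refl) → x∉ y∈ }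

∈-∷ʳ⁻ : ∀ {A : Set} {x y : A} xs → y ∈ xs ∷ʳ x → y ∈ xs ⊎ y ≡ x
∈-∷ʳ⁻ xs y∈ with ∈-++⁻ xs y∈
... | inj₁ p = inj₁ p
... | inj₂ (here p) = inj₂ p

module _ {V : Set} (_~_ : Rel V 0ℓ) where

  data Walk : V → V → List V → Set where
    [-] : ∀ {u} → Walk u u [ u ]
    _∷_ : ∀ {u v w xs} → u ~ v → Walk v w xs → Walk u w (u ∷ xs)

  joinWalk : ∀ {u v w z xs ys} → Walk u v xs → v ~ w → Walk w z ys → Walk u z (xs ++ ys)
  joinWalk [-] e q = e ∷ q
  joinWalk (e′ ∷ p) e q = e′ ∷ joinWalk p e q

  snocWalk : ∀ {u v w xs} → Walk u v xs → v ~ w → Walk u w (xs ∷ʳ w)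
  snocWalk p e = joinWalk p e [-]

  reverseWalk : Symmetric _~_ → ∀ {u v xs} → Walk u v xs → Walk v u (reverse xs)
  reverseWalk s [-] = [-]
  reverseWalk s (_∷_ {u} {xs = xs} e p) =
    subst (Walk _ u) (sym (unfold-reverse u xs)) (snocWalk (reverseWalk s p) (s e))

  linked-closed : ∀ {u v w xs} → Walk u v xs → v ~ w → Linked _~_ (xs ∷ʳ w)
  linked-closed [-] e = e ∷ [-]
  linked-closed (e′ ∷ [-]) e = e′ ∷ e ∷ [-]
  linked-closed (e′ ∷ (e″ ∷ p)) e = e′ ∷ linked-closed (e″ ∷ p) e

  cycle : ∀ {u v xs} → Walk u v xs → v ~ u → Unique xs → 3 ≤ length xs → HasCycle _~_ (length xs)
  cycle p@[-] e xs! l = l , _ , _ , refl , xs! , linked-closed p e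
  cycle p@(_ ∷ _) e xs! l = l , _ , _ , refl , xs! , linked-closed p e

length-∷ʳ : ∀ {A : Set} {x : A} xs → length (xs ∷ʳ x) ≡ ℕ.suc (length xs)
length-∷ʳ [] = refl
length-∷ʳ (x ∷ xs) = cong ℕ.suc (length-∷ʳ xs)

∉-∷ : ∀ {A : Set} {x y : A} {xs} → y ≢ x → y ∉ xs → y ∉ x ∷ xs
∉-∷ y≢x y∉ (here p) = y≢x p
∉-∷ y≢x y∉ (there p) = y∉ p

∉-∷ʳ : ∀ {A : Set} {x y : A} {xs} → y ∉ xs → y ≢ x → y ∉ xs ∷ʳ x
∉-∷ʳ {xs = xs} y∉ y≢x p = [ y∉ , y≢x ]′ (∈-∷ʳ⁻ xs p)

∉-reverse : ∀ {A : Set} {y : A} {xs} → y ∉ xs → y ∉ reverse xs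
∉-reverse {xs = xs} y∉ p = y∉ (∈-resp-↭ (↭-reverse xs) p)

reverse-unique : ∀ {A : Set} {xs : List A} → Unique xs → Unique (reverse xs)
reverse-unique {xs = xs} = Unique-↭ (↭-sym (↭-reverse xs))

∈-++-middle⁻ : ∀ {A : Set} (xs ys : List A) {zs x} → x ∈ xs ++ ys ++ zs → x ∈ xs ++ zs ⊎ x ∈ ys
∈-++-middle⁻ xs ys x∈ with ∈-++⁻ xs x∈
... | inj₁ p = inj₁ (∈-++⁺ˡ p)
... | inj₂ p with ∈-++⁻ ys p
... | inj₁ q = inj₂ q
... | inj₂ q = inj₁ (∈-++⁺ʳ xs q)

-- A single edge qualifies, as a closed walk of length 2, so that a snake can start from it. The
-- bound `3 ≤ L` returns only in `closedWalk⇒cycle`.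
record ClosedWalk {V : Set} (_~_ : Rel V 0ℓ) (L : ℕ) : Set where
  constructor closedWalk
  field
    {start end} : V
    {vertices}  : List V
    walk        : Walk _~_ start end vertices
    closing     : end ~ start
    distinct    : Unique vertices
    size        : length vertices ≡ L

closedWalk⇒cycle : ∀ {V : Set} {_~_ : Rel V 0ℓ} {L} → ClosedWalk _~_ L → 3 ≤ L → HasCycle _~_ L
closedWalk⇒cycle (closedWalk p e xs! refl) = cycle _ p e xs!

Unique-∷⇒∷ʳ : ∀ {A : Set} {x : A} {xs} → Unique (x ∷ xs) → Unique (xs ∷ʳ x)
Unique-∷⇒∷ʳ (x∉ ∷ xs!) = ∷ʳ-unique (All¬⇒¬Any x∉) xs!

ascent : ∀ {V : Set} → (ℕ → V) → ℕ → ℕ → List V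
ascent f s ℕ.zero = [ f s ]
ascent f s (ℕ.suc k) = f s ∷ ascent f (ℕ.suc s) k

length-ascent : ∀ {V : Set} (f : ℕ → V) s k → length (ascent f s k) ≡ ℕ.suc k
length-ascent f s ℕ.zero = refl
length-ascent f s (ℕ.suc k) = cong ℕ.suc (length-ascent f (ℕ.suc s) k)

∈-ascent⁻ : ∀ {V : Set} (f : ℕ → V) s k {x} → x ∈ ascent f s k → ∃[ t ] s ≤ t × t ≤ s + k × x ≡ f t
∈-ascent⁻ f s ℕ.zero (here refl) = s , ≤-refl , m≤m+n s 0 , refl
∈-ascent⁻ f s (ℕ.suc k) (here refl) = s , ≤-refl , m≤m+n s (ℕ.suc k) , refl
∈-ascent⁻ f s (ℕ.suc k) (there x∈) with ∈-ascent⁻ f (ℕ.suc s) k x∈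
... | t , p , q , e = t , <⇒≤ p , subst (t ≤_) (sym (+-suc s k)) q , e

ascent-unique : ∀ {V : Set} (f : ℕ → V) s k →
  (∀ {t t′} → s ≤ t → t < t′ → t′ ≤ s + k → f t ≢ f t′) → Unique (ascent f s k)
ascent-unique f s ℕ.zero _ = [] ∷ []
ascent-unique f s (ℕ.suc k) inj = first ∷! ascent-unique f (ℕ.suc s) k
    λ {t} {t′} p q r → inj (<⇒≤ p) q (subst (t′ ≤_) (sym (+-suc s k)) r)
  where
  first : f s ∉ ascent f (ℕ.suc s) k
  first x∈ with ∈-ascent⁻ f (ℕ.suc s) k x∈
  ... | t , p , q , e = inj ≤-refl p (subst (t ≤_) (sym (+-suc s k)) q) e

ascent-walk : ∀ {V : Set} {_~_ : Rel V 0ℓ} (f : ℕ → V) → (∀ t → f t ~ f (ℕ.suc t)) →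
  ∀ s k → Walk _~_ (f s) (f (s + k)) (ascent f s k)
ascent-walk {_~_ = _~_} f e s ℕ.zero = subst (λ t → Walk _~_ (f s) (f t) [ f s ]) (sym (+-identityʳ s)) [-]
ascent-walk {_~_ = _~_} f e s (ℕ.suc k) =
  subst (λ t → Walk _~_ (f s) (f t) (f s ∷ ascent f (ℕ.suc s) k)) (sym (+-suc s k))
      (e s ∷ ascent-walk f e (ℕ.suc s) k)

surround-unique : ∀ {A : Set} (xs {ys} zs : List A) → Unique ys → Unique (xs ++ zs) →
                  (∀ {y} → y ∈ ys → y ∉ xs ++ zs) → Unique (xs ++ ys ++ zs)
surround-unique xs {ys} zs ys! xszs! dis = Unique-↭ (shifts ys xs) (Uniqueₚ.++⁺ ys! xszs! λ (p , q) → dis p q)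

mapWalk : ∀ {A B : Set} {_~_ : Rel B 0ℓ} (f : A → B) {u v xs} →
          Walk (λ s t → f s ~ f t) u v xs → Walk _~_ (f u) (f v) (map f xs)
mapWalk f [-] = [-]
mapWalk f (e ∷ p) = e ∷ mapWalk f p

map-unique : ∀ {A B : Set} (f : A → B) {xs} → (∀ {x y} → x ∈ xs → y ∈ xs → x ≢ y → f x ≢ f y) →
             Unique xs → Unique (map f xs)
map-unique f inj [] = []
map-unique f {x ∷ xs} inj (x∉ ∷ xs!) = new ∷! map-unique f (λ p q → inj (there p) (there q)) xs!
  where
  new : f x ∉ map f xs
  new fx∈ with ∈-map⁻ f fx∈
  ... | y , y∈ , e = inj (here refl) (there y∈) (All.lookup x∉ y∈) e

-- Snakes of hexagons

double : ℕ → ℕ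
double zero = zero
double (suc a) = suc (suc (double a))

double≡+ : ∀ a → double a ≡ a + a
double≡+ zero = refl
double≡+ (suc a) = cong suc (trans (cong suc (double≡+ a)) (sym (+-suc a a)))

parity-double : ∀ a → parity (double a) ≡ 0ℙ
parity-double zero = refl
parity-double (suc a) = parity-double a

parity-suc-double : ∀ a → parity (suc (double a)) ≡ 1ℙ
parity-suc-double zero = refl
parity-suc-double (suc a) = parity-suc-double a

double-mono-≤ : ∀ {a b} → a ≤ b → double a ≤ double b
double-mono-≤ z≤n = z≤n
double-mono-≤ (s≤s p) = s≤s (s≤s (double-mono-≤ p))

module Snake {V : Set} {_~_ : Rel V 0ℓ} (~-sym : Symmetric _~_) (g₁ : ℕ) where

  g n : ℕ
  g = suc g₁
  n = double (suc g)

  -- A cylinder cut from the brick wall, without jumps. Rows are numbers, and `wrap` is kept apart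
  -- from `up`, because only the turns of the snake pass the seam between the rows `n - 1` and 0.
  record Grid (M : ℕ) (φ : ℕ → ℕ → V) : Set where
    field
      up     : ∀ {c t} → c < M → suc t < n → φ c t ~ φ c (suc t)
      wrap   : ∀ {c} → c < M → φ c (suc (double g)) ~ φ c 0
      across : ∀ {c t} → suc c < M → t < n → parity (c + t) ≡ 1ℙ → φ c t ~ φ (suc c) t
      inj    : ∀ {c c′ t t′} → c < M → c′ < M → t < n → t′ < n →
               φ c t ≡ φ c′ t′ → c ≡ c′ × t ≡ t′

  -- Negation modulo `n`. It fixes the row 0, where the snake turns, and preserves parity because
  -- `n` is even.
  flip : ℕ → ℕ
  flip zero = zero
  flip (suc t) = n ∸ suc t

  flip-< : ∀ t → flip t < n
  flip-< zero = s≤s z≤n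
  flip-< (suc t) = s≤s (m∸n≤m (suc (double g)) t)

  flip-injective : ∀ {t t′} → t < n → t′ < n → flip t ≡ flip t′ → t ≡ t′
  flip-injective {zero} {zero} _ _ _ = refl
  flip-injective {zero} {suc t′} _ q e = contradiction (sym e) (m<n⇒n∸m≢0 q)
    where
    m<n⇒n∸m≢0 : ∀ {m n} → m < n → n ∸ m ≢ 0
    m<n⇒n∸m≢0 {m} {n} m<n e = <-irrefl refl (<-≤-trans m<n (m∸n≡0⇒m≤n e))
  flip-injective {suc t} {zero} p _ e = contradiction (m∸n≡0⇒m≤n e) (<⇒≱ p)
  flip-injective {suc t} {suc t′} p q e = ∸-cancelˡ-≡ (<⇒≤ p) (<⇒≤ q) e

  parity-∸-double : ∀ a t → t ≤ double a → parity (double a ∸ t) ≡ parity t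
  parity-∸-double a zero _ = parity-double a
  parity-∸-double (suc a) (suc zero) _ = parity-suc-double a
  parity-∸-double (suc a) (suc (suc t)) (s≤s (s≤s p)) = parity-∸-double a t p

  parity-+ʳ : ∀ c {s t} → parity s ≡ parity t → parity (c + s) ≡ parity (c + t)
  parity-+ʳ zero e = e
  parity-+ʳ (suc zero) {s} {t} e = parity-suc s t e
    where
    parity-suc : ∀ s t → parity s ≡ parity t → parity (suc s) ≡ parity (suc t)
    parity-suc zero zero _ = refl
    parity-suc zero (suc (suc t)) e = parity-suc zero t e
    parity-suc (suc zero) (suc zero) _ = refl
    parity-suc (suc zero) (suc (suc t)) e = parity-suc (suc zero) t e
    parity-suc (suc (suc s)) t e = parity-suc s t e
  parity-+ʳ (suc (suc c)) e = parity-+ʳ c e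

  parity-flip : ∀ t → t < n → parity (flip t) ≡ parity t
  parity-flip zero _ = refl
  parity-flip (suc t) p = parity-∸-double (suc g) (suc t) (<⇒≤ p)

  -- The rows are reversed because every other tooth of the snake is descended.
  next : (ℕ → ℕ → V) → ℕ → ℕ → V
  next φ c t = φ (suc (suc c)) (flip t)

  next-grid : ∀ {M φ} → Grid (suc (suc M)) φ → Grid M (next φ)
  next-grid {M} {φ} G = record { up = up′ ; wrap = wrap′ ; across = across′ ; inj = inj′ }
    where
    open Grid G
    up′ : ∀ {c t} → c < M → suc t < n → next φ c t ~ next φ c (suc t)
    up′ {c} {zero} p q = ~-sym (wrap (s≤s (s≤s p)))
    up′ {c} {suc t} p (s≤s (s≤s q)) = ~-sym
      (subst (λ z → φ (suc (suc c)) (double g ∸ t) ~ φ (suc (suc c)) z)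
        (sym (∸-suc (<⇒≤ q)))
        (up (s≤s (s≤s p)) (s≤s (s≤s (m∸n≤m (double g) t)))))
      where
      ∸-suc : ∀ {m n} → m ≤ n → suc n ∸ m ≡ suc (n ∸ m)
      ∸-suc z≤n = refl
      ∸-suc (s≤s p) = ∸-suc p
    wrap′ : ∀ {c} → c < M → next φ c (suc (double g)) ~ next φ c 0
    wrap′ {c} p = subst (λ z → φ (suc (suc c)) z ~ φ (suc (suc c)) 0)
      (sym (m+n∸n≡m 1 (double g))) (~-sym (up (s≤s (s≤s p)) (s≤s (s≤s z≤n))))
    across′ : ∀ {c t} → suc c < M → t < n → parity (c + t) ≡ 1ℙ → next φ c t ~ next φ (suc c) t
    across′ {c} {t} p q r = across (s≤s (s≤s p)) (flip-< t)
      (trans (parity-+ʳ c (parity-flip t q)) r)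
    inj′ : ∀ {c c′ t t′} → c < M → c′ < M → t < n → t′ < n →
           next φ c t ≡ next φ c′ t′ → c ≡ c′ × t ≡ t′
    inj′ {t = t} {t′} p p′ q q′ e
      with inj (s≤s (s≤s p)) (s≤s (s≤s p′)) (flip-< t) (flip-< t′) e
    ... | refl , f = refl , flip-injective q q′ f

  data Later (a : ℕ) : ℕ → ℕ → Set where
    left   : ∀ {t} → suc (double a) < t → Later a 0 t
    right  : ∀ {t} → suc (double a) < t → Later a 1 t
    corner : Later a 1 0
    beyond : ∀ {c t} → Later a (suc (suc c)) t

  -- A cycle with the edge φ 0 t ~ φ 1 t for t = 2a+1, on which the next hexagon
  -- is glued.
  record Tooth (M : ℕ) (φ : ℕ → ℕ → V) (a s : ℕ) : Set where
    field
      {last}   : V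
      {rest}   : List V
      walk     : Walk _~_ (φ 0 (suc (double a))) last rest
      closing  : last ~ φ 1 (suc (double a))
      -- A turn is glued along the vertical edge from `φ 1 (double a)` to `φ 1 (suc (double a))`.
      -- Only the one-edge seed lacks it, and there no turn is due because `g` is positive.
      turning  : a ≡ 0 ⊎ last ≡ φ 1 (double a)
      distinct : Unique (φ 1 (suc (double a)) ∷ rest)
      size     : suc (length rest) ≡ s
      fresh    : ∀ {c t} → c < M → t < n → Later a c t → φ c t ∉ rest

  module _ {M φ} (G : Grid M φ) where
    open Grid G

    apart : ∀ {c c′ t t′} → c < M → c′ < M → t < n → t′ < n →
            c ≢ c′ ⊎ t ≢ t′ → φ c t ≢ φ c′ t′
    apart p p′ q q′ (inj₁ c≢) e = c≢ (proj₁ (inj p p′ q q′ e))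
    apart p p′ q q′ (inj₂ t≢) e = t≢ (proj₂ (inj p p′ q q′ e))

    module _ (M≥2 : 2 ≤ M) where
      private
        0<M : 0 < M
        0<M = <⇒≤ M≥2
        1<M : 1 < M
        1<M = M≥2

      toClosed : ∀ {a s} → a ≤ g → Tooth M φ a s → ClosedWalk _~_ s
      toClosed {a} a≤g T = closedWalk (~-sym (across 1<M t<n (parity-suc-double a)) ∷ walk) closing distinct
          size
        where
        open Tooth T
        t<n = s≤s (s≤s (double-mono-≤ a≤g))

      -- The flat edge at the row `suc (double a)` is traded for the other five edges of the hexagon
      -- above it, which brings four new vertices.
      stack : ∀ {a s} → suc a ≤ g → Tooth M φ a s → Tooth M φ (suc a) (4 + s)
      stack {a} {s} a<g T = record
        { walk = ~-sym (up 0<M t₂<n) ∷ ~-sym (up 0<M t₁<n) ∷ snocWalk _~_ (snocWalk _~_ walk closing)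
            (up 1<M t₁<n)
        ; closing = up 1<M t₂<n
        ; turning = inj₂ refl
        ; distinct =
            ∉-∷ (apart 1<M 0<M t₂<n t₂<n (inj₁ λ ()))
              (∉-∷ (apart 1<M 0<M t₂<n t₁<n (inj₁ λ ()))
                (∉-∷ʳ (∉-∷ʳ (fresh 1<M t₂<n (right (s≤s (n≤1+n _))))
                    (apart 1<M 1<M t₂<n t₀<n (inj₂ (≢-sym (<⇒≢ (n≤1+n _))))))
                  (apart 1<M 1<M t₂<n t₁<n (inj₂ (≢-sym (<⇒≢ ≤-refl))))))
            ∷! ∉-∷ (apart 0<M 0<M t₂<n t₁<n (inj₂ (≢-sym (<⇒≢ ≤-refl))))
                (∉-∷ʳ (∉-∷ʳ (fresh 0<M t₂<n (left (s≤s (n≤1+n _)))) (apart 0<M 1<M t₂<n t₀<n (inj₁ λ ())))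
                  (apart 0<M 1<M t₂<n t₁<n (inj₁ λ ())))
            ∷! ∉-∷ʳ (∉-∷ʳ (fresh 0<M t₁<n (left ≤-refl)) (apart 0<M 1<M t₁<n t₀<n (inj₁ λ ())))
                  (apart 0<M 1<M t₁<n t₁<n (inj₁ λ ()))
            ∷! ∷ʳ-unique (∉-∷ʳ (fresh 1<M t₁<n (right ≤-refl))
                (apart 1<M 1<M t₁<n t₀<n (inj₂ (≢-sym (<⇒≢ ≤-refl)))))
                (Unique-∷⇒∷ʳ distinct)
        ; size = cong (λ z → 3 + z) (trans (length-∷ʳ (rest ∷ʳ _)) (cong suc (trans (length-∷ʳ rest) size)))
        ; fresh = λ p q l → ∉-∷ (fresh-≢ p q l 0<M t₂<n
            λ { (left r) → inj₂ (≢-sym (<⇒≢ r)) ; (right _) → inj₁ (λ ()) ; corner → inj₁ λ () ; beyond →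
                inj₁ λ () })
            (∉-∷ (fresh-≢ p q l 0<M t₁<n
                λ { (left r) → inj₂ (≢-sym (<⇒≢ (<⇒≤ r))) ; (right _) → inj₁ (λ ()) ; corner → inj₁ λ () ;
                    beyond → inj₁ λ () })
            (∉-∷ʳ (∉-∷ʳ (fresh p q (weaken l))
              (fresh-≢ p q l 1<M t₀<n λ { (left r) → inj₁ λ () ; (right r) → inj₂
                  (≢-sym (<⇒≢ (<⇒≤ (<⇒≤ r)))) ; corner → inj₂ λ () ; beyond → inj₁ λ () }))
              (fresh-≢ p q l 1<M t₁<n λ { (left r) → inj₁ λ () ; (right r) → inj₂ (≢-sym (<⇒≢ (<⇒≤ r))) ;
                  corner → inj₂ λ () ; beyond → inj₁ λ () })))
        }
        where
        open Tooth T
        t₂<n : suc (suc (suc (double a))) < n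
        t₂<n = s≤s (s≤s (double-mono-≤ a<g))
        t₁<n : suc (suc (double a)) < n
        t₁<n = <⇒≤ t₂<n
        t₀<n : suc (double a) < n
        t₀<n = <⇒≤ t₁<n
        weaken : ∀ {c t} → Later (suc a) c t → Later a c t
        weaken (left r) = left (<⇒≤ (<⇒≤ r))
        weaken (right r) = right (<⇒≤ (<⇒≤ r))
        weaken corner = corner
        weaken beyond = beyond
        fresh-≢ : ∀ {c t c′ t′} → c < M → t < n → Later (suc a) c t → c′ < M → t′ < n →
                  (Later (suc a) c t → c ≢ c′ ⊎ t ≢ t′) → φ c t ≢ φ c′ t′
        fresh-≢ p q l p′ q′ f = apart p p′ q q′ (f l)

  module _ {M φ} (G : Grid (4 + M) φ) where
    open Grid G
    private
      ψ = next φ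
      G′ : Grid (2 + M) ψ
      G′ = next-grid G
      module G′ = Grid G′
      2<n : 2 < n
      2<n = s≤s (s≤s (s≤s z≤n))

    -- The hexagon between φ 1 and φ 2 through the row 0.
    module Turn {s} (T : Tooth (4 + M) φ g s) where
      open Tooth T
      last≡ : last ≡ φ 1 (double g)
      last≡ with turning
      ... | inj₂ e = e

      turned : List V
      turned = ψ 0 1 ∷ ψ 0 0 ∷ φ 1 0 ∷ φ 1 (suc (double g)) ∷ rest ∷ʳ ψ 0 2

      turned-walk : Walk _~_ (ψ 0 1) (ψ 0 2) turned
      turned-walk =
        ~-sym (G′.up (s≤s z≤n) (s≤s (s≤s z≤n))) ∷
        ~-sym (across (s≤s (s≤s (s≤s z≤n))) (s≤s z≤n) refl) ∷
        ~-sym (wrap (s≤s (s≤s z≤n))) ∷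
        ~-sym (across (s≤s (s≤s z≤n)) ≤-refl (parity-suc-double g)) ∷
        snocWalk _~_ walk (subst (_~ ψ 0 2) (sym last≡)
          (across (s≤s (s≤s (s≤s z≤n))) (≤-trans (n≤1+n _) ≤-refl) (parity-suc-double g)))

      new : ∀ c t → c < 2 + M → t < n → ψ c t ∉ rest
      new c t p q = fresh (s≤s (s≤s p)) (flip-< t) beyond

      new-≢ : ∀ c t {c′ t′} → c < 2 + M → c′ < 2 → t′ < n → ψ c t ≢ φ c′ t′
      new-≢ c t p p′ q′ e with inj (s≤s (s≤s p)) (≤-trans p′ (s≤s (s≤s z≤n))) (flip-< t) q′ e
      new-≢ c t p (s≤s (s≤s ())) q′ e | refl , _

      new-∉ : ∀ c t → c < 2 + M → t < n → c ≢ 0 ⊎ t ≢ 0 × t ≢ 1 × t ≢ 2 → ψ c t ∉ turned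
      new-∉ c t p q f = ∉-∷ (apart G′ p (s≤s z≤n) q (<⇒≤ 2<n) (case f (proj₁ ∘ proj₂)))
        (∉-∷ (apart G′ p (s≤s z≤n) q (s≤s z≤n) (case f proj₁))
        (∉-∷ (new-≢ c t p ≤-refl (s≤s z≤n))
        (∉-∷ (new-≢ c t p ≤-refl ≤-refl)
        (∉-∷ʳ (new c t p q) (apart G′ p (s≤s z≤n) q 2<n (case f (proj₂ ∘ proj₂)))))))
        where
        case : ∀ {A B C : Set} → A ⊎ B → (B → C) → A ⊎ C
        case (inj₁ a) _ = inj₁ a
        case (inj₂ b) f = inj₂ (f b)

      turned-unique : Unique turned
      turned-unique =
        ∉-∷ (apart G′ (s≤s z≤n) (s≤s z≤n) (<⇒≤ 2<n) (s≤s z≤n) (inj₂ λ ()))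
          (∉-∷ (new-≢ 0 1 (s≤s z≤n) ≤-refl (s≤s z≤n)) (∉-∷ (new-≢ 0 1 (s≤s z≤n) ≤-refl ≤-refl)
          (∉-∷ʳ (new 0 1 (s≤s z≤n) (<⇒≤ 2<n)) (apart G′ (s≤s z≤n) (s≤s z≤n) (<⇒≤ 2<n) 2<n (inj₂ λ ())))))
        ∷! ∉-∷ (new-≢ 0 0 (s≤s z≤n) ≤-refl (s≤s z≤n)) (∉-∷ (new-≢ 0 0 (s≤s z≤n) ≤-refl ≤-refl)
          (∉-∷ʳ (new 0 0 (s≤s z≤n) (s≤s z≤n)) (apart G′ (s≤s z≤n) (s≤s z≤n) (s≤s z≤n) 2<n (inj₂ λ ()))))
        ∷! ∉-∷ (apart G (s≤s (s≤s z≤n)) (s≤s (s≤s z≤n)) (s≤s z≤n) ≤-refl (inj₂ λ ()))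
          (∉-∷ʳ (fresh (s≤s (s≤s z≤n)) (s≤s z≤n) corner) (≢-sym (new-≢ 0 2 (s≤s z≤n) ≤-refl (s≤s z≤n))))
        ∷! ∷ʳ-unique (∉-∷ (new-≢ 0 2 (s≤s z≤n) ≤-refl ≤-refl) (new 0 2 (s≤s z≤n) 2<n)) distinct

      turned-length : length turned ≡ 4 + s
      turned-length = cong (λ z → 4 + z) (trans (length-∷ʳ rest) size)

      turned-closed : ClosedWalk _~_ (4 + s)
      turned-closed = closedWalk turned-walk (~-sym (G′.up (s≤s z≤n) 2<n)) turned-unique turned-length

      -- The turn leaves the vertical edge between `ψ 0 1` and `ψ 0 2` on the cycle. The first
      -- hexagon of the new strip is glued there, so two hexagons are added at once.
      nextTooth : Tooth (2 + M) ψ 1 (8 + s)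
      nextTooth = record
        { walk = reverseWalk _~_ ~-sym rail
        ; closing = G′.up (s≤s (s≤s z≤n)) 3<n
        ; turning = inj₂ refl
        ; distinct =
            ∉-reverse (∉-∷ (apart G′ 1<M 1<M 3<n 2<n (inj₂ λ ()))
                (∉-∷ (apart G′ 1<M 1<M 3<n (<⇒≤ 2<n) (inj₂ λ ()))
              (∉-∷ʳ (new-∉ 1 3 1<M 3<n (inj₁ λ ())) (apart G′ 1<M 0<M 3<n 3<n (inj₁ λ ())))))
            ∷! reverse-unique
              (∉-∷ (apart G′ 1<M 1<M 2<n (<⇒≤ 2<n) (inj₂ λ ()))
                (∉-∷ʳ (new-∉ 1 2 1<M 2<n (inj₁ λ ())) (apart G′ 1<M 0<M 2<n 3<n (inj₁ λ ())))
              ∷! ∉-∷ʳ (new-∉ 1 1 1<M (<⇒≤ 2<n) (inj₁ λ ())) (apart G′ 1<M 0<M (<⇒≤ 2<n) 3<n (inj₁ λ ()))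
              ∷! ∷ʳ-unique (new-∉ 0 3 0<M 3<n (inj₂ ((λ ()) , (λ ()) , λ ()))) turned-unique)
        ; size = cong suc (trans (length-reverse railList)
            (cong (λ z → 2 + z) (trans (length-∷ʳ turned) (cong suc turned-length))))
        ; fresh = λ p q l → ∉-reverse
            (∉-∷ (apart G′ p 1<M q 2<n (f₂ l)) (∉-∷ (apart G′ p 1<M q (<⇒≤ 2<n) (f₁ l))
              (∉-∷ʳ (new-∉ _ _ p q (f l)) (apart G′ p 0<M q 3<n (f₃ l)))))
        }
        where
        0<M : 0 < 2 + M
        0<M = s≤s z≤n
        1<M : 1 < 2 + M
        1<M = s≤s (s≤s z≤n)
        3<n : 3 < n
        3<n = s≤s (s≤s (s≤s (s≤s z≤n)))
        railList : List V
        railList = ψ 1 2 ∷ ψ 1 1 ∷ turned ∷ʳ ψ 0 3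
        rail : Walk _~_ (ψ 1 2) (ψ 0 3) railList
        rail = ~-sym (G′.up 1<M 2<n) ∷ ~-sym (G′.across 1<M (<⇒≤ 2<n) refl) ∷
          snocWalk _~_ turned-walk (G′.up 0<M 3<n)
        f₂ : ∀ {c t} → Later 1 c t → c ≢ 1 ⊎ t ≢ 2
        f₂ (left r) = inj₁ λ ()
        f₂ (right r) = inj₂ (≢-sym (<⇒≢ (<⇒≤ r)))
        f₂ corner = inj₂ λ ()
        f₂ beyond = inj₁ λ ()
        f₁ : ∀ {c t} → Later 1 c t → c ≢ 1 ⊎ t ≢ 1
        f₁ (left r) = inj₁ λ ()
        f₁ (right r) = inj₂ (≢-sym (<⇒≢ (<⇒≤ (<⇒≤ r))))
        f₁ corner = inj₂ λ ()
        f₁ beyond = inj₁ λ ()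
        f₃ : ∀ {c t} → Later 1 c t → c ≢ 0 ⊎ t ≢ 3
        f₃ (left r) = inj₂ (≢-sym (<⇒≢ r))
        f₃ (right r) = inj₁ λ ()
        f₃ corner = inj₁ λ ()
        f₃ beyond = inj₁ λ ()
        f : ∀ {c t} → Later 1 c t → c ≢ 0 ⊎ t ≢ 0 × t ≢ 1 × t ≢ 2
        f (left (s≤s (s≤s (s≤s (s≤s r))))) = inj₂ ((λ ()) , (λ ()) , λ ())
        f (right r) = inj₁ λ ()
        f corner = inj₁ λ ()
        f beyond = inj₁ λ ()

  -- There is room for `d` hexagons in the present strip and `suc g` for each of the `q` further
  -- ones, namely a turn and `g` stacked hexagons. Started from one edge, the full snake misses only
  -- the row 0 of the first and the last column.
  snake : ∀ q {φ} → Grid (double (suc q)) φ → ∀ {a s} d → a + d ≡ g →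
          Tooth (double (suc q)) φ a s → ∀ k → k ≤ d + q * suc g → ClosedWalk _~_ (s + 4 * k)
  snake q G {a} {s} d a+d T zero _ =
    subst (ClosedWalk _~_) (sym (+-identityʳ s)) (toClosed G (s≤s (s≤s z≤n)) (m+n≤o⇒m≤o a (≤-reflexive a+d)) T)
  snake q G {a} {s} (suc d) a+d T (suc k) (s≤s k≤) =
    subst (ClosedWalk _~_) (shift s k)
        (snake q G d a+d′ (stack G (s≤s (s≤s z≤n)) (m+n≤o⇒m≤o (suc a) (≤-reflexive a+d′)) T) k k≤)
    where
    a+d′ : suc a + d ≡ g
    a+d′ = trans (sym (+-suc a d)) a+d
    shift : ∀ s k → (4 + s) + 4 * k ≡ s + 4 * suc k
    shift = solve-∀
  snake (suc q) G {a} {s} zero a+0 T (suc zero) _ with refl ← trans (sym (+-identityʳ a)) a+0 =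
    subst (ClosedWalk _~_) (+-comm 4 s) (Turn.turned-closed G T)
  snake (suc q) G {a} {s} zero a+0 T (suc (suc k)) (s≤s (s≤s k≤)) with refl ← trans (sym (+-identityʳ a)) a+0 =
    subst (ClosedWalk _~_) (shift s k) (snake q (next-grid G) g₁ refl (Turn.nextTooth G T) k k≤)
    where
    shift : ∀ s k → (8 + s) + 4 * k ≡ s + 4 * suc (suc k)
    shift = solve-∀

  later-apart : ∀ {a c t c′ t′} → Later a c t → c′ ≡ 0 ⊎ 0 < t′ → c′ ≤ 1 → t′ ≤ suc (double a) → c ≢ c′ ⊎ t ≢ t′
  later-apart (left r) _ _ q = inj₂ (≢-sym (<⇒≢ (≤-<-trans q r)))
  later-apart (right r) _ _ q = inj₂ (≢-sym (<⇒≢ (≤-<-trans q r)))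
  later-apart corner (inj₁ refl) _ _ = inj₁ λ ()
  later-apart corner (inj₂ 0<t) _ _ = inj₂ (<⇒≢ 0<t)
  later-apart beyond _ c≤1 _ = inj₁ (≢-sym (<⇒≢ (≤-<-trans c≤1 (s≤s (s≤s z≤n)))))

-- Congruences and the edges of the torus

infix 4 _≋_[_]
-- With the quotient as data, the rules for congruences become ring identities. As a record it also
-- lets `a` and `b` be inferred, which divisibility of absolute values does not.
record _≋_[_] (a b : ℤ) (k : ℕ) : Set where
  constructor multiple
  field
    quot : ℤ
    eq   : a ≡ b ℤ.+ quot ℤ.* + k

≋⇒≡[mod] : ∀ {a b k} → a ≋ b [ k ] → a ≡ b [mod k ]
≋⇒≡[mod] {b = b} {k} (multiple q refl) = ∣⇒∣ᵤ (divides q (cancel b (q ℤ.* + k)))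
  where
  cancel : ∀ b x → (b ℤ.+ x) - b ≡ x
  cancel = ℤ-solve-∀

≡[mod]⇒≋ : ∀ {a b k} → a ≡ b [mod k ] → a ≋ b [ k ]
≡[mod]⇒≋ {a} {b} d with ∣ᵤ⇒∣ d
... | divides q e = multiple q (trans (split a b) (cong (λ x → b ℤ.+ x) e))
  where
  split : ∀ a b → a ≡ b ℤ.+ (a - b)
  split = ℤ-solve-∀

≋-refl : ∀ {a k} → a ≋ a [ k ]
≋-refl {a} {k} = multiple (+ 0) (zero-multiple a (+ k))
  where
  zero-multiple : ∀ a k → a ≡ a ℤ.+ + 0 ℤ.* k
  zero-multiple = ℤ-solve-∀

≋-reflexive : ∀ {a b k} → a ≡ b → a ≋ b [ k ]
≋-reflexive refl = ≋-refl

≋-sym : ∀ {a b k} → a ≋ b [ k ] → b ≋ a [ k ]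
≋-sym {b = b} {k} (multiple q refl) = multiple (- q) (lem b q (+ k))
  where
  lem : ∀ b q k → b ≡ (b ℤ.+ q ℤ.* k) ℤ.+ (- q) ℤ.* k
  lem = ℤ-solve-∀

≋-trans : ∀ {a b c k} → a ≋ b [ k ] → b ≋ c [ k ] → a ≋ c [ k ]
≋-trans {c = c} {k} (multiple q refl) (multiple r refl) = multiple (r ℤ.+ q) (lem c q r (+ k))
  where
  lem : ∀ c q r k → (c ℤ.+ r ℤ.* k) ℤ.+ q ℤ.* k ≡ c ℤ.+ (r ℤ.+ q) ℤ.* k
  lem = ℤ-solve-∀

≋-+ : ∀ {a b c d k} → a ≋ b [ k ] → c ≋ d [ k ] → a ℤ.+ c ≋ b ℤ.+ d [ k ]
≋-+ {b = b} {d = d} {k} (multiple q refl) (multiple r refl) = multiple (q ℤ.+ r) (lem b d q r (+ k))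
  where
  lem : ∀ b d q r k → (b ℤ.+ q ℤ.* k) ℤ.+ (d ℤ.+ r ℤ.* k) ≡ (b ℤ.+ d) ℤ.+ (q ℤ.+ r) ℤ.* k
  lem = ℤ-solve-∀

≋-neg : ∀ {a b k} → a ≋ b [ k ] → - a ≋ - b [ k ]
≋-neg {b = b} {k} (multiple q refl) = multiple (- q) (lem b q (+ k))
  where
  lem : ∀ b q k → - (b ℤ.+ q ℤ.* k) ≡ - b ℤ.+ (- q) ℤ.* k
  lem = ℤ-solve-∀

≋-weaken : ∀ {a b k l} → l ℕ.∣ k → a ≋ b [ k ] → a ≋ b [ l ]
≋-weaken {b = b} {l = l} (ℕ.divides r refl) (multiple q refl) =
  multiple (q ℤ.* + r) (cong (λ x → b ℤ.+ x)
      (trans (cong (q ℤ.*_) (ℤₚ.pos-* r l)) (sym (ℤₚ.*-assoc q (+ r) (+ l)))))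

residue-unique : ∀ {a b k} → a < k → b < k → + a ≋ + b [ k ] → a ≡ b
residue-unique {a} {b} {k} a<k b<k p = +-∣-unique (≤-total a b)
  where
  dist : ∀ {a b} → b < k → a ≤ b → k ℕ.∣ ∣ + b - + a ∣ → a ≡ b
  dist {a} {b} b<k a≤b d = ≤-antisym a≤b (m∸n≡0⇒m≤n (small (b ∸ a)
    (≤-<-trans (m∸n≤m b a) b<k)
    (subst (k ℕ.∣_) (cong ∣_∣ (trans (ℤₚ.m-n≡m⊖n b a) (ℤₚ.⊖-≥ a≤b))) d)))
    where
    small : ∀ x → x < k → k ℕ.∣ x → x ≡ 0
    small zero _ _ = refl
    small (suc x) x<k d = contradiction (ℕ.∣⇒≤ d) (<⇒≱ x<k)
  +-∣-unique : a ≤ b ⊎ b ≤ a → a ≡ b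
  +-∣-unique (inj₁ a≤b) = dist b<k a≤b (≋⇒≡[mod] (≋-sym p))
  +-∣-unique (inj₂ b≤a) = sym (dist a<k b≤a (≋⇒≡[mod] p))

odd⇒≋1 : ∀ x → parity x ≡ 1ℙ → + x ≋ + 1 [ 2 ]
odd⇒≋1 1 _ = ≋-refl
odd⇒≋1 (suc (suc x)) e = ≋-trans (multiple (+ 1) (+-comm′ x)) (odd⇒≋1 x e)
  where
  +-comm′ : ∀ x → + (2 + x) ≡ + x ℤ.+ + 1 ℤ.* + 2
  +-comm′ x = cong +_ (+-comm 2 x)

even⇒≋0 : ∀ x → parity x ≡ 0ℙ → + x ≋ + 0 [ 2 ]
even⇒≋0 0 _ = ≋-refl
even⇒≋0 (suc (suc x)) e = ≋-trans (multiple (+ 1) (cong +_ (+-comm 2 x))) (even⇒≋0 x e)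

module Residues (n : ℕ) .{{_ : NonZero n}} where

  abstract
    ν : ℤ → Fin n
    ν z = fromℕ< (n%ℕd<d z n)

    ⟦ν⟧ : ∀ z → ⟦ ν z ⟧ ≋ z [ n ]
    ⟦ν⟧ z = ≋-sym (multiple (z /ℕ n) (trans (a≡a%ℕn+[a/ℕn]*n z n)
      (cong (λ r → + r ℤ.+ (z /ℕ n) ℤ.* + n) (sym (toℕ-fromℕ< (n%ℕd<d z n))))))

  ⟦⟧-injective : ∀ {i j : Fin n} → ⟦ i ⟧ ≋ ⟦ j ⟧ [ n ] → i ≡ j
  ⟦⟧-injective {i} {j} p = toℕ-injective (residue-unique (toℕ<n i) (toℕ<n j) p)

  ν-cong : ∀ {z z′} → z ≋ z′ [ n ] → ν z ≡ ν z′
  ν-cong {z} {z′} p = ⟦⟧-injective (≋-trans (⟦ν⟧ z) (≋-trans p (≋-sym (⟦ν⟧ z′))))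

  ν-injective : ∀ {z z′} → ν z ≡ ν z′ → z ≋ z′ [ n ]
  ν-injective {z} {z′} e = ≋-trans (≋-sym (⟦ν⟧ z)) (subst (λ i → ⟦ i ⟧ ≋ z′ [ n ]) (sym e) (⟦ν⟧ z′))

  ν-⟦⟧ : ∀ i → ν ⟦ i ⟧ ≡ i
  ν-⟦⟧ i = ⟦⟧-injective (⟦ν⟧ ⟦ i ⟧)

  ν-periodic : ∀ z → ν (z ℤ.+ + n) ≡ ν z
  ν-periodic z = ν-cong {z′ = z} (multiple (+ 1) (cong (λ x → z ℤ.+ x) (sym (ℤₚ.*-identityˡ (+ n)))))

  ν-window : ∀ {s t} → s < t → t < s + n → ν (+ s) ≢ ν (+ t)
  ν-window {s} {t} s<t t<s+n e with m≤n⇒∃[o]m+o≡n (<⇒≤ s<t)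
  ... | d , refl = <⇒≢ s<t (trans (sym (+-identityʳ s)) (cong (λ x → s + x) 0≡d))
    where
    d≋0 : + 0 ≋ + d [ n ]
    d≋0 = subst₂ (_≋_[ n ]) (cancel (+ s) (+ 0)) (cancel (+ s) (+ d))
      (≋-+ (≋-trans (≋-reflexive (cong +_ (+-identityʳ s))) (ν-injective {z′ = + (s + d)} e)) (≋-refl { - + s}))
      where
      cancel : ∀ s x → (s ℤ.+ x) ℤ.+ - s ≡ x
      cancel = ℤ-solve-∀
    0≡d : 0 ≡ d
    0≡d = residue-unique (>-nonZero⁻¹ n) (+-cancelˡ-< s d n t<s+n) d≋0

module Torus (m n : ℕ) (ℓ : ℤ) .{{_ : NonZero m}} .{{_ : NonZero n}} (2∣n : 2 ℕ.∣ n) where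

  open Residues n public

  infix 4 _~_
  _~_ = HTG m n ℓ

  ~-sym : Symmetric _~_
  ~-sym = symmetric _

  abstract
    col : ℕ → Fin m
    col c = fromℕ< (m%n<n c m)

    toℕ-col : ∀ {c} → c < m → toℕ (col c) ≡ c
    toℕ-col {c} p = trans (toℕ-fromℕ< (m%n<n c m)) (m<n⇒m%n≡m p)

  vertical-edge : ∀ {i} z → (i , ν z) ~ (i , ν (z ℤ.+ + 1))
  vertical-edge z = fwd (vertical (≋⇒≡[mod] (≋-trans (⟦ν⟧ _) (≋-+ (≋-sym (⟦ν⟧ z)) (≋-refl {+ 1})))))

  row-edge : ∀ {i} t → (i , ν (+ t)) ~ (i , ν (+ suc t))
  row-edge {i} t = subst (λ x → (i , ν (+ t)) ~ (i , ν (+ x))) (+-comm t 1) (vertical-edge (+ t))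

  -- Since 2 divides `n`, parity may be tested on any integer `z` representing the row.
  flat-edge : ∀ {c} z → suc c < m → + c ℤ.+ z ≋ + 1 [ 2 ] → (col c , ν z) ~ (col (suc c) , ν z)
  flat-edge {c} z p q = fwd (flat (trans (toℕ-col p) (cong suc (sym (toℕ-col c<m))))
    (≋⇒≡[mod] (≋-trans (≋-+ (≋-reflexive (cong +_ (toℕ-col c<m))) (≋-weaken 2∣n (⟦ν⟧ z))) q)))
    where c<m = <⇒≤ p

  jump-edge : ∀ {c} z → suc c ≡ m → z ≋ + m [ 2 ] → (col c , ν z) ~ (col 0 , ν (z ℤ.+ ℓ))
  jump-edge {c} z refl q = fwd (jump (cong suc (toℕ-col ≤-refl)) (toℕ-col (s≤s z≤n))
    (≋⇒≡[mod] (≋-trans (≋-weaken 2∣n (⟦ν⟧ z)) q))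
    (≋⇒≡[mod] (≋-trans (⟦ν⟧ _) (≋-+ (≋-sym (⟦ν⟧ z)) (≋-refl {ℓ})))))

  toℕ-col-injective : ∀ {c c′} → c < m → c′ < m → col c ≡ col c′ → c ≡ c′
  toℕ-col-injective p p′ e = trans (sym (toℕ-col p)) (trans (cong toℕ e) (toℕ-col p′))

-- Arithmetic of the cycle lengths

halve : ∀ x → ∃[ y ] (x ≡ double y ⊎ x ≡ suc (double y))
halve zero = 0 , inj₁ refl
halve (suc x) with halve x
... | y , inj₁ refl = y , inj₂ refl
... | y , inj₂ refl = suc y , inj₁ refl

2+4k≤4x⇒k<x : ∀ {k x} → 2 + 4 * k ≤ 4 * x → k < x
2+4k≤4x⇒k<x {k} {x} p = *-cancelˡ-< 4 k x (≤-trans (n≤1+n _) p)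

1+2r≤1+2x⇒r≤x : ∀ {r x} → suc (double r) ≤ suc (double x) → r ≤ x
1+2r≤1+2x⇒r≤x {zero} _ = z≤n
1+2r≤1+2x⇒r≤x {suc r} {suc x} (s≤s (s≤s (s≤s p))) = s≤s (1+2r≤1+2x⇒r≤x (s≤s p))

1+2r≤2+2x⇒r≤x : ∀ {r x} → suc (double r) ≤ suc (suc (double x)) → r ≤ x
1+2r≤2+2x⇒r≤x {zero} _ = z≤n
1+2r≤2+2x⇒r≤x {suc r} {zero} (s≤s (s≤s ()))
1+2r≤2+2x⇒r≤x {suc r} {suc x} (s≤s (s≤s p)) = s≤s (1+2r≤2+2x⇒r≤x p)

evenArea : ∀ q h → double (suc q) * double h ≡ 4 * (suc q * h)
evenArea q h = trans (cong₂ _*_ (double≡+ (suc q)) (double≡+ h)) (lem (suc q) h)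
  where
  lem : ∀ a b → (a + a) * (b + b) ≡ 4 * (a * b)
  lem = solve-∀

oddArea : ∀ q h → suc (double (suc q)) * double h ≡ 4 * (suc q * h) + 2 * h
oddArea q h = trans (cong₂ (λ x y → suc x * y) (double≡+ (suc q)) (double≡+ h)) (lem (suc q) h)
  where
  lem : ∀ a b → suc (a + a) * (b + b) ≡ 4 * (a * b) + 2 * b
  lem = solve-∀

-- `N` is the number of rows. For `g` even it is divisible by 4, so the seed of length `N + 6` has
-- the residue 2; for `g` odd, in `size₂`, the seed of length `N + 8` has it.
size₁ : ∀ q h r {N g} → N ≡ (2 + g) + (2 + g) → g ≡ h + h →
        N + 6 + 4 * (h + q * (2 + g) + r) ≡ 2 + 4 * (suc q * (2 + g) + r)
size₁ q h r refl refl = lem q h r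
  where
  lem : ∀ q h r → ((2 + (h + h)) + (2 + (h + h))) + 6 + 4 * (h + q * (2 + (h + h)) + r) ≡ 2 + 4 *
      (suc q * (2 + (h + h)) + r)
  lem = solve-∀

size₂ : ∀ q h r {N g} → N ≡ (2 + g) + (2 + g) → g ≡ suc (h + h) →
        N + 8 + 4 * (h + q * (2 + g) + r) ≡ 2 + 4 * (suc q * (2 + g) + r)
size₂ q h r refl refl = lem q h r
  where
  lem : ∀ q h r → ((2 + suc (h + h)) + (2 + suc (h + h))) + 8 + 4 * (h + q * (2 + suc (h + h)) + r) ≡ 2 + 4
      * (suc q * (2 + suc (h + h)) + r)
  lem = solve-∀

fullSize : ∀ x h {g} → g ≡ suc (h + h) → 2 + 4 * (x + suc h) ≡ 4 * x + 2 * (2 + g)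
fullSize x h refl = lem x h
  where
  lem : ∀ x h → 2 + 4 * (x + suc h) ≡ 4 * x + 2 * (2 + suc (h + h))
  lem = solve-∀

inside : ∀ h x {r} → r ≤ h → h + x + r ≤ double h + x
inside h x {r} r≤h = ≤-trans (+-monoʳ-≤ (h + x) r≤h)
    (≤-reflexive (trans (lem h x) (cong (_+ x) (sym (double≡+ h)))))
  where
  lem : ∀ h x → h + x + h ≡ h + h + x
  lem = solve-∀

-- `4 * x` is the number of vertices in m - 1 columns and `2 * h` that in one more, so `r` measures
-- how far the length protrudes beyond the even part.
overhang : ∀ x h r → 2 + 4 * (x + r) ≤ 4 * x + 2 * h → suc (double r) ≤ h
overhang x h r p = subst (λ d → suc d ≤ h) (sym (double≡+ r))
  (*-cancelˡ-≤ 2 (+-cancelˡ-≤ (4 * x) _ _ (≤-trans (≤-reflexive (lem x r)) p)))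
  where
  lem : ∀ x r → 4 * x + 2 * suc (r + r) ≡ 2 + 4 * (x + r)
  lem = solve-∀

-- For `g₁ ≡ double h` the bound on the length gives `r ≤ h`, which the first seed reaches. For
-- `g₁ ≡ suc (double h)` it gives `r ≤ suc h`, but the second seed stops at `h`; the exceptional
-- value is the Hamiltonian length.
oddLengths : (P : ℕ → Set) (q g₁ κ : ℕ) →
  (κ < suc q * (2 + g₁) → P (2 + 4 * κ)) →
  (∀ k → k ≤ g₁ + q * (2 + g₁) → P (double (2 + g₁) + 6 + 4 * k)) →
  (∀ g₂ → g₁ ≡ suc g₂ → ∀ k → k ≤ g₂ + q * (2 + g₁) → P (double (2 + g₁) + 8 + 4 * k)) →
  2 + 4 * κ ≤ 4 * (suc q * (2 + g₁)) + 2 * (2 + g₁) →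
  2 + 4 * κ ≡ 4 * (suc q * (2 + g₁)) + 2 * (2 + g₁) ⊎ P (2 + 4 * κ)
oddLengths P q g₁ κ p₀ p₁ p₂ κ≤ with κ <? suc q * (2 + g₁)
... | yes κ< = inj₂ (p₀ κ<)
... | no κ≮ = beyond _ (proj₂ (m≤n⇒∃[o]m+o≡n (≮⇒≥ κ≮))) (halve g₁)
  where
  x = suc q * (2 + g₁)
  Goal : Set
  Goal = 2 + 4 * κ ≡ 4 * x + 2 * (2 + g₁) ⊎ P (2 + 4 * κ)
  even : ∀ r → x + r ≡ κ → suc (double r) ≤ 2 + g₁ → ∀ h → g₁ ≡ double h → Goal
  even r x+r o h e = inj₂ (subst P
    (trans (size₁ q h r {double (2 + g₁)} {g₁} (double≡+ (2 + g₁)) (trans e (double≡+ h)))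
        (cong (λ z → 2 + 4 * z) x+r))
    (p₁ (h + q * (2 + g₁) + r)
      (subst (λ z → h + q * (2 + g₁) + r ≤ z + q * (2 + g₁)) (sym e)
        (inside h (q * (2 + g₁)) (1+2r≤2+2x⇒r≤x (subst (λ z → suc (double r) ≤ 2 + z) e o))))))
  odd : ∀ r → x + r ≡ κ → suc (double r) ≤ 2 + g₁ → ∀ h → g₁ ≡ suc (double h) → Dec (r ≤ h) → Goal
  odd r x+r o h e (yes r≤h) = inj₂ (subst P
    (trans (size₂ q h r {double (2 + g₁)} {g₁} (double≡+ (2 + g₁)) (trans e (cong suc (double≡+ h))))
        (cong (λ z → 2 + 4 * z) x+r))
    (p₂ (double h) e (h + q * (2 + g₁) + r) (inside h (q * (2 + g₁)) r≤h)))
  odd r x+r o h e (no r≰h) = inj₁ (trans (cong (λ z → 2 + 4 * z) (trans (sym x+r) (cong (λ z → x + z) r≡1+h)))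
    (fullSize x h {g₁} (trans e (cong suc (double≡+ h)))))
    where
    r≡1+h : r ≡ suc h
    r≡1+h = ≤-antisym (1+2r≤1+2x⇒r≤x (subst (λ z → suc (double r) ≤ 2 + z) e o)) (≰⇒> r≰h)
  beyond : ∀ r → x + r ≡ κ → ∃[ h ] (g₁ ≡ double h ⊎ g₁ ≡ suc (double h)) → Goal
  beyond r x+r (h , p) = [ even r x+r o h , (λ e → odd r x+r o h e (r ≤? h)) ]′ p
    where
    o : suc (double r) ≤ 2 + g₁
    o = overhang x (2 + g₁) r (subst (λ z → 2 + 4 * z ≤ 4 * x + 2 * (2 + g₁)) (sym x+r) κ≤)

-- Several columns

2∣double : ∀ a → 2 ℕ.∣ double a
2∣double a = ℕ.divides a (trans (double≡+ a) (trans (cong (λ x → a + x) (sym (+-identityʳ a))) (*-comm 2 a)))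

module Columns (m : ℕ) .{{_ : NonZero m}} (ℓ : ℤ) (g₁ : ℕ) where

  open Torus m (double (2 + g₁)) ℓ (2∣double (2 + g₁))
  open Snake {_~_ = _~_} ~-sym g₁

  -- Shifting rows and columns by the same `e` preserves the parity of column plus row, and with it
  -- the pattern of flat edges. The offset 1 sets column 0 aside.
  φ : ℕ → ℕ → ℕ → Vertex m n
  φ e c t = col (e + c) , ν (+ (e + t))

  grid : ∀ e M → e + M ≤ m → Grid M (φ e)
  grid e M e+M≤m = record
    { up = λ {c} {t} _ _ → subst (λ x → φ e c t ~ (col (e + c) , ν (+ x))) (sym (+-suc e t)) (row-edge (e + t))
    ; wrap = λ {c} _ → subst (λ x → φ e c (suc (double g)) ~ (col (e + c) , x)) around
        (row-edge (e + suc (double g)))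
    ; across = λ {c} {t} p _ q → subst (λ x → φ e c t ~ (col x , ν (+ (e + t)))) (sym (+-suc e c))
        (flat-edge (+ (e + t)) (subst (_< m) (+-suc e c) (in-range p))
          (≋-trans (multiple (+ e) (trans (cong +_ (shift e c t))
              (cong (λ x → + (c + t) ℤ.+ x) (ℤₚ.pos-* e 2)))) (odd⇒≋1 (c + t) q)))
    ; inj = λ {c} {c′} {t} {t′} p p′ q q′ eq →
        +-cancelˡ-≡ e _ _ (toℕ-col-injective (in-range p) (in-range p′) (cong proj₁ eq)) ,
        residue-unique q q′ (subst₂ (_≋_[ n ]) (cancel (+ e) (+ t)) (cancel (+ e) (+ t′))
          (≋-+ (ν-injective (cong proj₂ eq)) (≋-refl { - + e})))
    }
    where
    in-range : ∀ {c} → c < M → e + c < m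
    in-range p = <-≤-trans (+-monoʳ-< e p) e+M≤m
    around : ν (+ suc (e + suc (double g))) ≡ ν (+ (e + 0))
    around = ν-cong (multiple (+ 1)
        (trans (cong +_ (lem e (double g))) (cong (λ x → + (e + 0) ℤ.+ x) (sym (ℤₚ.*-identityˡ (+ n))))))
      where
      lem : ∀ e d → suc (e + suc d) ≡ (e + 0) + suc (suc d)
      lem = solve-∀
    shift : ∀ e c t → (e + c) + (e + t) ≡ (c + t) + e * 2
    shift = solve-∀
    cancel : ∀ e x → (e ℤ.+ x) ℤ.+ - e ≡ x
    cancel = ℤ-solve-∀

  edgeTooth : ∀ {M} → 2 ≤ M → M ≤ m → Tooth M (φ 0) 0 2
  edgeTooth {M} M≥2 M≤m = record
    { walk = [-]
    ; closing = across M≥2 1<n refl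
    ; turning = inj₁ refl
    ; distinct = ∉-∷ (apart G M≥2 (<⇒≤ M≥2) 1<n 1<n (inj₁ λ ())) (λ ()) ∷! ((λ ()) ∷! [])
    ; size = refl
    ; fresh = λ p q l → ∉-∷ (apart G p (<⇒≤ M≥2) q 1<n (later-apart l (inj₁ refl) z≤n ≤-refl)) λ ()
    }
    where
    G = grid 0 M M≤m
    open Grid G
    1<n : 1 < n
    1<n = s≤s (s≤s z≤n)

  -- The position of ω matches the rows of φ 1, which are shifted by one.
  ω : ℕ → Vertex m n
  ω t = col 0 , ν (+ suc t)

  ω-flat : ∀ {t} → 1 < m → parity t ≡ 0ℙ → ω t ~ φ 1 0 t
  ω-flat {t} 1<m q = flat-edge (+ suc t) 1<m (≋-trans (≋-reflexive refl) (≋-+ (≋-refl {+ 1}) (even⇒≋0 t q)))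

  ω≢φ : ∀ {c t t′} → suc c < m → ω t ≢ φ 1 c t′
  ω≢φ p e with toℕ-col-injective (≤-<-trans z≤n p) p (cong proj₁ e)
  ... | ()

  -- All of column 0 but the row below ω s.
  loop : ℕ → List (Vertex m n)
  loop s = ascent ω s (double g)

  loop-walk : ∀ s → Walk _~_ (ω s) (ω (s + double g)) (loop s)
  loop-walk s = ascent-walk ω (λ t → row-edge (suc t)) s (double g)

  loop-unique : ∀ s → Unique (loop s)
  loop-unique s = ascent-unique ω s (double g) λ {t} {t′} p q r e →
    ν-window (s≤s q) (s≤s (≤-<-trans (≤-trans r (+-monoˡ-≤ (double g) p)) (+-monoʳ-< t (n≤1+n _))))
        (cong proj₂ e)

  φ∉loop : ∀ {c t} s → suc c < m → φ 1 c t ∉ loop s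
  φ∉loop s p x∈ with ∈-ascent⁻ ω s (double g) x∈
  ... | _ , _ , _ , e = ω≢φ p (sym e)

  φ-periodic : ∀ {c} t → φ 1 c (n + t) ≡ φ 1 c t
  φ-periodic {c} t = cong (col (1 + c) ,_) (ν-cong (multiple (+ 1)
    (trans (cong (λ x → + suc x) (+-comm n t)) (cong (λ x → + suc t ℤ.+ x) (sym (ℤₚ.*-identityˡ (+ n)))))))

  -- The index on the left is `n + s`: a loop started at `ω (suc (suc s))` ends at `ω s` and skips
  -- only the vertex between them, which has no flat edge.
  loop-exit : ∀ s → 1 < m → parity s ≡ 0ℙ → ω (suc (suc s) + double g) ~ φ 1 0 s
  loop-exit s 1<m q = subst₂ (λ x y → ω x ~ y) (lem s (double g)) (φ-periodic s)
      (ω-flat {n + s} 1<m (trans (parity-+ʳ′ (suc g) s) q))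
    where
    lem : ∀ s d → suc (suc d) + s ≡ suc (suc s) + d
    lem = solve-∀
    parity-+ʳ′ : ∀ a s → parity (double a + s) ≡ parity s
    parity-+ʳ′ zero s = refl
    parity-+ʳ′ (suc a) s = parity-+ʳ′ a s

  module _ {M : ℕ} (M≥2 : 2 ≤ M) (M<m : M < m) where

    private
      G : Grid M (φ 1)
      G = grid 1 M M<m
      open Grid G
      0<M : 0 < M
      0<M = <⇒≤ M≥2
      1<M : 1 < M
      1<M = M≥2
      1<m : 1 < m
      1<m = ≤-<-trans 0<M M<m

      1<n : 1 < n
      1<n = s≤s (s≤s z≤n)
      2<n : 2 < n
      2<n = s≤s (s≤s (s≤s z≤n))
      3<n : 3 < n
      3<n = s≤s (s≤s (s≤s (s≤s z≤n)))

      φ∉ : ∀ {c t} s → c < M → φ 1 c t ∉ loop s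
      φ∉ s p = φ∉loop s (≤-<-trans p M<m)

      im : ℕ × ℕ → Vertex m n
      im (c , t) = φ 1 c t

      -- The positions that no `Later a` can claim. Seeds are listed by numerical coordinates, so
      -- that their distinctness and fit are settled by evaluation.
      record Fits (a : ℕ) (p : ℕ × ℕ) : Set where
        constructor fits
        field
          notCorner : proj₁ p ≡ 0 ⊎ 0 < proj₂ p
          colBound  : proj₁ p ≤ 1
          rowBound  : proj₂ p ≤ suc (double a)

      fits? : ∀ a → Decidable (Fits a)
      fits? a p = map′ (λ (x , y , z) → fits x y z) (λ (fits x y z) → x , y , z)
        ((proj₁ p ≟ 0 ⊎-dec 0 <? proj₂ p) ×-dec (proj₁ p ≤? 1 ×-dec proj₂ p ≤? suc (double a)))

      im-∉ : ∀ {c t cs} → c < M → t < n → All (λ q → c ≢ proj₁ q ⊎ t ≢ proj₂ q) cs →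
             All (λ q → proj₁ q ≤ 1 × proj₂ q < n) cs → φ 1 c t ∉ map im cs
      im-∉ p q [] [] ()
      im-∉ p q (d ∷ ds) ((r , r′) ∷ rs) = ∉-∷ (apart G p (≤-<-trans r M≥2) q r′ d) (im-∉ p q ds rs)

      im-unique : ∀ {cs} → Unique cs → All (λ q → proj₁ q ≤ 1 × proj₂ q < n) cs → Unique (map im cs)
      im-unique [] [] = []
      im-unique (d ∷ ds) ((r , r′) ∷ rs) =
        im-∉ (≤-<-trans r M≥2) r′ (All.map differ d) rs ∷! im-unique ds rs
        where
        differ : ∀ {p q : ℕ × ℕ} → p ≢ q → proj₁ p ≢ proj₁ q ⊎ proj₂ p ≢ proj₂ q
        differ {c , t} {c′ , t′} p≢q with c ≟ c′
        ... | no c≢ = inj₁ c≢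
        ... | yes refl = inj₂ λ t≡ → p≢q (cong (c ,_) t≡)

    -- `A` and `B` are the parts of the seed before and after its way round column 0. The loop has
    -- `n - 1` vertices, and the end of the closing edge makes them `n`.
    loopTooth : ∀ a s A B → suc (double a) < n →
                Unique ((1 , suc (double a)) ∷ A ++ B) → All (Fits a) (A ++ B) →
                Walk _~_ (φ 1 0 (suc (double a))) (φ 1 1 (double a)) (map im A ++ loop s ++ map im B) →
                Tooth M (φ 1) a (n + (length A + length B))
    loopTooth a s A B t<n AB! AB-fits w = record
      { walk = w
      ; closing = up 1<M t<n
      ; turning = inj₂ refl
      ; distinct = Unique-↭ (shifts (loop s) (map im ((1 , suc (double a)) ∷ A)))
          (Uniqueₚ.++⁺ (loop-unique s)
            (subst Unique (map-++ im ((1 , suc (double a)) ∷ A) B) (im-unique AB! ((≤-refl , t<n) ∷ bounds)))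
            λ { {v} (p , q) → avoids ((≤-refl , t<n) ∷ bounds)
                (subst (v ∈_) (sym (map-++ im ((1 , suc (double a)) ∷ A) B)) q) p })
      ; size = begin
          suc (length (map im A ++ loop s ++ map im B))
            ≡⟨ cong suc (trans (length-++ (map im A)) (cong₂ _+_ (length-map im A) (trans (length-++ (loop s))
                 (cong₂ _+_ (length-ascent ω s (double g)) (length-map im B))))) ⟩
          suc (length A + (suc (double g) + length B))
            ≡⟨ lem (length A) (double g) (length B) ⟩
          n + (length A + length B) ∎
      ; fresh = λ p q l x∈ → [ (λ y∈ → im-∉ p q (All.map (λ (fits x y z) → later-apart l x y z) AB-fits) bounds
                                  (subst (_ ∈_) (sym (map-++ im A B)) y∈)) , φ∉ s p ]′
          (∈-++-middle⁻ (map im A) (loop s) x∈)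
      }
      where
      open ≡-Reasoning
      lem : ∀ a d b → suc (a + (suc d + b)) ≡ suc (suc d) + (a + b)
      lem = solve-∀
      bounds : All (λ q → proj₁ q ≤ 1 × proj₂ q < n) (A ++ B)
      bounds = All.map (λ (fits _ y z) → y , ≤-<-trans z t<n) AB-fits
      avoids : ∀ {cs x} → All (λ q → proj₁ q ≤ 1 × proj₂ q < n) cs → x ∈ map im cs → x ∉ loop s
      avoids ((r , _) ∷ _) (here refl) = φ∉ s (≤-<-trans r M≥2)
      avoids (_ ∷ rs) (there x∈) = avoids rs x∈
    -- The seeds for an odd number of columns merge column 0 with the first tooth:
    -- at one edge if 4 divides n, along two edges (which loses two vertices) if
    -- n is 2 modulo 4.
    loopTooth₁ : Tooth M (φ 1) 1 (n + 6)
    loopTooth₁ = loopTooth 1 2 A B 3<n (from-yes (unique? ((1 , 3) ∷ A ++ B)))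
        (from-yes (all? (fits? 1) (A ++ B)))
      -- The hexagon linking column 0 to the six-cycle has the rows 0 to 2 of `φ 1`. It opens the
      -- edge between `φ 1 0 1` and `φ 1 0 2`, drops `ω 1` and gains `φ 1 0 0`, so the length is n +
      -- 6.
      (~-sym (up 0<M 3<n) ∷ joinWalk _~_ [-] (~-sym (ω-flat 1<m refl))
        (joinWalk _~_ (loop-walk 2) (loop-exit 0 1<m refl)
          (up 0<M 1<n ∷ across M≥2 1<n refl ∷ up 1<M 2<n ∷ [-])))
      where
      A = (0 , 3) ∷ (0 , 2) ∷ []
      B = (0 , 0) ∷ (0 , 1) ∷ (1 , 1) ∷ (1 , 2) ∷ []

    loopTooth₂ : 5 < n → Tooth M (φ 1) 2 (n + 8)
    loopTooth₂ 5<n = loopTooth 2 4 A B 5<n (from-yes (unique? ((1 , 5) ∷ A ++ B)))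
        (from-yes (all? (fits? 2) (A ++ B)))
      -- Now the linking hexagon has the rows 2 to 4 and meets the cycle of length 10 in two edges.
      -- Both `ω 3` and `φ 1 0 3` are dropped, so the length is n + 10 - 2.
      (~-sym (up 0<M 5<n) ∷ joinWalk _~_ [-] (~-sym (ω-flat 1<m refl))
        (joinWalk _~_ (loop-walk 4) (loop-exit 2 1<m refl)
          (~-sym (up 0<M 2<n) ∷ across M≥2 1<n refl ∷ up 1<M 2<n ∷ up 1<M 3<n ∷ up 1<M 4<n ∷ [-])))
      where
      4<n : 4 < n
      4<n = <⇒≤ 5<n
      A = (0 , 5) ∷ (0 , 4) ∷ []
      B = (0 , 2) ∷ (0 , 1) ∷ (1 , 1) ∷ (1 , 2) ∷ (1 , 3) ∷ (1 , 4) ∷ []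

  fromColumns : ∀ q → double (suc q) ≤ m → ∀ κ → κ < suc q * suc g → ClosedWalk _~_ (2 + 4 * κ)
  fromColumns q M≤m κ κ< = snake q (grid 0 _ M≤m) g refl (edgeTooth (s≤s (s≤s z≤n)) M≤m) κ (s≤s⁻¹ κ<)

  fromLoop₁ : ∀ q → double (suc q) < m → ∀ k → k ≤ g₁ + q * suc g → ClosedWalk _~_ (n + 6 + 4 * k)
  fromLoop₁ q M<m = snake q (grid 1 _ M<m) g₁ refl (loopTooth₁ (s≤s (s≤s z≤n)) M<m)

  fromLoop₂ : ∀ q → double (suc q) < m → ∀ g₂ → g₁ ≡ suc g₂ → ∀ k → k ≤ g₂ + q * suc g → ClosedWalk _~_
      (n + 8 + 4 * k)
  fromLoop₂ q M<m g₂ e = snake q (grid 1 _ M<m) g₂ (cong suc (sym e))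
    (loopTooth₂ (s≤s (s≤s z≤n)) M<m
        (subst (λ x → 5 < double (2 + x)) (sym e) (s≤s (s≤s (s≤s (s≤s (s≤s (s≤s z≤n))))))))

evenlyManyColumns : ∀ q g₁ ℓ κ → 2 + 4 * κ ≤ double (suc q) * double (2 + g₁) →
                    ClosedWalk (HTG (double (suc q)) (double (2 + g₁)) ℓ) (2 + 4 * κ)
evenlyManyColumns q g₁ ℓ κ p = Columns.fromColumns (double (suc q)) ℓ g₁ q ≤-refl κ
  (2+4k≤4x⇒k<x (subst (2 + 4 * κ ≤_) (evenArea q (2 + g₁)) p))

oddlyManyColumns : ∀ q g₁ ℓ κ → 2 + 4 * κ ≤ suc (double (suc q)) * double (2 + g₁) →
  2 + 4 * κ ≡ suc (double (suc q)) * double (2 + g₁) ⊎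
  ClosedWalk (HTG (suc (double (suc q))) (double (2 + g₁)) ℓ) (2 + 4 * κ)
oddlyManyColumns q g₁ ℓ κ p = map₁ (λ e → trans e (sym (oddArea q (2 + g₁))))
  (oddLengths (ClosedWalk (HTG (suc (double (suc q))) (double (2 + g₁)) ℓ)) q g₁ κ
      (C.fromColumns q (n≤1+n _) κ) (C.fromLoop₁ q ≤-refl) (C.fromLoop₂ q ≤-refl)
    (subst (2 + 4 * κ ≤_) (oddArea q (2 + g₁)) p))
  where
  module C = Columns (suc (double (suc q))) ℓ g₁

-- One column

-- The column is unrolled to a line of numbered rows, and cycles are sought on the line within a
-- window of `n` rows, where `ψ` is injective.
module Chordal {V : Set} {_~_ : Rel V 0ℓ} (~-sym : Symmetric _~_) (ψ : ℕ → V) (n λ₁ : ℕ)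
  (step     : ∀ t → ψ t ~ ψ (suc t))
  (chord    : ∀ t → parity t ≡ 1ℙ → ψ t ~ ψ (t + suc (double (suc λ₁))))
  (window   : ∀ {s t} → s < t → t < s + n → ψ s ≢ ψ t)
  where

  ℓ : ℕ
  ℓ = suc (double (suc λ₁))

  _≈_ : Rel ℕ 0ℓ
  s ≈ t = ψ s ~ ψ t

  close : ∀ {u v xs} lo → Walk _≈_ u v xs → v ≈ u → Unique xs → All (λ r → lo ≤ r × r < lo + n) xs →
          ClosedWalk _~_ (length xs)
  close {xs = xs} lo p e xs! bounds = closedWalk (mapWalk ψ p) e (map-unique ψ inj xs!) (length-map ψ xs)
    where
    inj : ∀ {s t} → s ∈ xs → t ∈ xs → s ≢ t → ψ s ≢ ψ t
    inj {s} {t} s∈ t∈ s≢t with <-cmp s t | All.lookup bounds s∈ | All.lookup bounds t∈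
    ... | tri< s<t _ _ | lo≤s , _ | _ , t< = window s<t (<-≤-trans t< (+-monoˡ-≤ n lo≤s))
    ... | tri≈ _ s≡t _ | _ | _ = contradiction s≡t s≢t
    ... | tri> _ _ t<s | _ , s< | lo≤t , _ = ≢-sym (window t<s (<-≤-trans s< (+-monoˡ-≤ n lo≤t)))

  data Used (x w r : ℕ) : Set where
    low  : 0 < r → r ≤ x → Used x w r
    high : x + double w < r → r ≤ x + ℓ → Used x w r

  above : ∀ {x w r} → x + ℓ < r → ¬ Used x w r
  above {x} x+ℓ<r (low _ r≤x) = <⇒≱ x+ℓ<r (≤-trans r≤x (m≤m+n x ℓ))
  above x+ℓ<r (high _ r≤) = <⇒≱ x+ℓ<r r≤

  between : ∀ {x w r} → x < r → r ≤ x + double w → ¬ Used x w r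
  between x<r _ (low _ r≤x) = <⇒≱ x<r r≤x
  between _ r≤ (high <r _) = <⇒≱ <r r≤

  -- A cycle through the rows 1, …, x and x + 2w + 1, …, x + ℓ with the chord
  -- x ~ x + ℓ as an edge.  It winds up the helix, ℓ - 1 rows further every turn.
  record Spiral (x w s : ℕ) : Set where
    field
      {last}   : ℕ
      {rest}   : List ℕ
      odd      : parity x ≡ 1ℙ
      walk     : Walk _≈_ x last rest
      closing  : last ≈ (x + ℓ)
      turning  : 0 < w ⊎ suc last ≡ x + ℓ
      distinct : Unique (x + ℓ ∷ rest)
      used     : All (Used x w) (x + ℓ ∷ rest)
      size     : suc (length rest) ≡ s
      -- All rows from 1 to the top `x + ℓ` are used, except for the gap of `double w` rows.
      height   : x + ℓ ≡ s + double w
      w-bound  : w ≤ suc λ₁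

  start : Spiral 1 (suc λ₁) 2
  start = record
    { odd = refl ; walk = [-] ; closing = chord 1 refl ; turning = inj₁ (s≤s z≤n)
    ; distinct = ∉-∷ (λ ()) (λ ()) ∷! ((λ ()) ∷! [])
    ; used = high ≤-refl ≤-refl ∷ low (s≤s z≤n) ≤-refl ∷ []
    ; size = refl ; height = refl ; w-bound = ≤-refl }

  -- The hexagon between the chords at `x` and `2 + x` fills two rows of the gap and adds two rows
  -- above the top.
  climb : ∀ {x w s} → Spiral x (suc w) s → Spiral (2 + x) w (4 + s)
  climb {x} {w} {s} S = record
    { odd = odd
    ; walk = ~-sym (step (1 + x)) ∷ ~-sym (step x) ∷ joinWalk _≈_ (snocWalk _≈_ walk closing) (step y) [-]
    ; closing = step (1 + y)
    ; turning = inj₂ refl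
    ; distinct = surround-unique (2 + y ∷ 2 + x ∷ 1 + x ∷ []) (1 + y ∷ []) core! new!
        λ r∈ → ∉-∷ (old r∈ (above (n≤1+n _)))
            (∉-∷ (old r∈ (between (n≤1+n _) x₂≤)) (∉-∷ (old r∈ (between ≤-refl (<⇒≤ x₂≤)))
          (∉-∷ (old r∈ (above ≤-refl)) λ ())))
    ; used = high (<-trans x₂w<y (n≤1+n _)) ≤-refl ∷ low (s≤s z≤n) ≤-refl ∷ low (s≤s z≤n) (n≤1+n _) ∷
        Allₚ.++⁺ (All.map weaken core-used) (high (≤-trans x₂w<y (n≤1+n _)) (n≤1+n _) ∷ [])
    ; size = cong (λ z → 3 + z)
        (trans (length-++ (rest ∷ʳ y)) (trans (+-comm _ 1) (cong suc (trans (length-∷ʳ rest) size))))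
    ; height = trans (cong (λ z → 2 + z) height) (lem s (double w))
    ; w-bound = <⇒≤ w-bound
    }
    where
    open Spiral S
    y = x + ℓ
    lem : ∀ s d → 2 + (s + (2 + d)) ≡ (4 + s) + d
    lem = solve-∀
    lem′ : ∀ x d → x + (2 + d) ≡ 2 + (x + d)
    lem′ = solve-∀
    core! : Unique (rest ∷ʳ y)
    core! = Unique-∷⇒∷ʳ distinct
    core-used : All (Used x (suc w)) (rest ∷ʳ y)
    core-used = Allₚ.++⁺ (All.tail used) (All.head used ∷ [])
    old : ∀ {r z} → r ∈ rest ∷ʳ y → ¬ Used x (suc w) z → r ≢ z
    old r∈ z∉ refl = z∉ (All.lookup core-used r∈)
    x₂≤ : 2 + x ≤ x + double (suc w)
    x₂≤ = subst (2 + x ≤_) (sym (lem′ x (double w))) (+-monoʳ-≤ 2 (m≤m+n x (double w)))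
    x₂w<y : 2 + x + double w < y
    x₂w<y = subst (_< y) (lem′ x (double w)) (+-monoʳ-< x (s≤s (double-mono-≤ w-bound)))
    x₂<y : 2 + x < y
    x₂<y = ≤-<-trans (m≤m+n (2 + x) (double w)) x₂w<y
    new! : Unique (2 + y ∷ 2 + x ∷ 1 + x ∷ 1 + y ∷ [])
    new! = ∉-∷ (>⇒≢ (≤-trans x₂<y (≤-trans (n≤1+n _) (n≤1+n _))))
        (∉-∷ (>⇒≢ (<-trans (<-trans (n<1+n _) x₂<y) (s≤s (n≤1+n _))))
             (∉-∷ (>⇒≢ ≤-refl) λ ()))
      ∷! ∉-∷ (>⇒≢ ≤-refl) (∉-∷ (<⇒≢ (<-trans x₂<y ≤-refl)) λ ())
      ∷! ∉-∷ (<⇒≢ (<-trans (<-trans ≤-refl x₂<y) ≤-refl)) (λ ())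
      ∷! ((λ ()) ∷! [])
    weaken : ∀ {r} → Used x (suc w) r → Used (2 + x) w r
    weaken (low 0<r r≤x) = low 0<r (≤-trans r≤x (≤-trans (n≤1+n _) (n≤1+n _)))
    weaken {r} (high <r r≤) = high (subst (_< r) (lem′ x (double w)) <r)
        (≤-trans r≤ (≤-trans (n≤1+n _) (n≤1+n _)))

  -- Once the gap is filled, a hexagon is glued to the topmost vertical edge; its chords start at
  -- the rows `x + ℓ - 1` and `x + ℓ + 1`. Its three far rows end a stretch of `ℓ` rows above the
  -- new `x`, which leaves a gap of `ℓ - 3`, that is `double λ₁`.
  turn : ∀ {x s} → Spiral x 0 s → Spiral (suc (x + ℓ)) λ₁ (4 + s)
  turn {suc x} {s} S = record
    { odd = odd′
    ; walk = ~-sym (step y) ∷ ~-sym (chord _ odd) ∷ joinWalk _≈_ walk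
        (subst (_≈ p) (sym last≡) (chord (x + ℓ) parity-last)) (step p ∷ [-])
    ; closing = step (1 + p)
    ; turning = inj₂ refl
    ; distinct = surround-unique (2 + p ∷ 1 + y ∷ []) (p ∷ 1 + p ∷ []) distinct new!
        λ r∈ → ∉-∷ (old r∈ (above (≤-trans y<p (≤-trans (n≤1+n _) (n≤1+n _)))))
            (∉-∷ (old r∈ (above ≤-refl)) (∉-∷ (old r∈ (above y<p))
          (∉-∷ (old r∈ (above (≤-trans y<p (n≤1+n _)))) λ ())))
    ; used = high (<-trans <p (n≤1+n _)) ≤-refl ∷ low (s≤s z≤n) ≤-refl ∷
        Allₚ.++⁺ (All.map weaken used)
            (high <p (≤-trans (n≤1+n _) (n≤1+n _)) ∷ high (≤-trans <p (n≤1+n _)) (n≤1+n _) ∷ [])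
    ; size = cong suc (cong suc (trans (length-++ (y ∷ rest)) (trans (+-comm _ 2) (cong (λ z → 2 + z) size))))
    ; height = trans (cong (λ z → suc z + ℓ) height) (lem s (double λ₁))
    ; w-bound = n≤1+n _
    }
    where
    open Spiral S
    y = suc x + ℓ
    p = x + ℓ + ℓ
    lem : ∀ s d → suc (s + 0) + suc (2 + d) ≡ (4 + s) + d
    lem = solve-∀
    last≡ : last ≡ x + ℓ
    last≡ with turning
    ... | inj₂ e = suc-injective e
    odd+odd : ∀ x → parity (suc x) ≡ 1ℙ → parity (x + ℓ) ≡ 1ℙ
    odd+odd zero _ = parity-suc-double λ₁
    odd+odd (suc (suc x)) e = odd+odd x e
    parity-last : parity (x + ℓ) ≡ 1ℙ
    parity-last = odd+odd x odd
    odd′ : parity (suc y) ≡ 1ℙ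
    odd′ = parity-last
    <p : suc y + double λ₁ < p
    <p = ≤-reflexive (sym (lem′ (x + ℓ) (double λ₁)))
      where
      lem′ : ∀ z d → z + (3 + d) ≡ 3 + (z + d)
      lem′ = solve-∀
    1+y<p : suc y < p
    1+y<p = ≤-<-trans (m≤m+n (suc y) (double λ₁)) <p
    y<p : y < p
    y<p = <⇒≤ 1+y<p
    old : ∀ {r z} → r ∈ y ∷ rest → ¬ Used (suc x) 0 z → r ≢ z
    old r∈ z∉ refl = z∉ (All.lookup used r∈)
    new! : Unique (2 + p ∷ 1 + y ∷ p ∷ 1 + p ∷ [])
    new! = ∉-∷ (>⇒≢ (≤-trans 1+y<p (≤-trans (n≤1+n _) (n≤1+n _)))) (∉-∷ (>⇒≢ (n≤1+n _)) (∉-∷ (>⇒≢ ≤-refl) λ ()))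
      ∷! ∉-∷ (<⇒≢ 1+y<p) (∉-∷ (<⇒≢ (<-trans 1+y<p ≤-refl)) λ ())
      ∷! ∉-∷ (<⇒≢ ≤-refl) (λ ())
      ∷! ((λ ()) ∷! [])
    weaken : ∀ {r} → Used (suc x) 0 r → Used (suc y) λ₁ r
    weaken (low 0<r r≤x) = low 0<r (≤-trans r≤x (≤-trans (m≤m+n (suc x) ℓ) (n≤1+n _)))
    weaken (high <r r≤) = low (≤-<-trans z≤n <r) (≤-trans r≤ (n≤1+n _))

  -- This bounds the top row. On the first winding it is at most `ℓ + ℓ`. Afterwards the gap is at
  -- most `double λ₁`, so the top is at most `s + double λ₁`, and the length already exceeds
  -- `ℓ + ℓ`.
  data Phase (x w s : ℕ) : Set where
    first : x + double w ≡ ℓ → Phase x w s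
    later : w ≤ λ₁ → ℓ + ℓ < s → Phase x w s

  spiral : ∀ k → ∃[ x ] ∃[ w ] (Spiral x w (4 * k + 2) × Phase x w (4 * k + 2))
  spiral zero = 1 , suc λ₁ , start , first refl
  spiral (suc k) = subst (λ s → ∃[ x ] ∃[ w ] (Spiral x w s × Phase x w s)) (lem k) (extend (spiral k))
    where
    lem : ∀ k → 4 + (4 * k + 2) ≡ 4 * suc k + 2
    lem = solve-∀
    extend : ∀ {s} → ∃[ x ] ∃[ w ] (Spiral x w s × Phase x w s) →
             ∃[ x ] ∃[ w ] (Spiral x w (4 + s) × Phase x w (4 + s))
    extend (x , suc w , S , first e) = _ , _ , climb S , first (trans (lem′ x (double w)) e)
      where
      lem′ : ∀ x d → 2 + x + d ≡ x + (2 + d)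
      lem′ = solve-∀
    extend (x , suc w , S , later p q) = _ , _ , climb S , later (<⇒≤ p) (≤-trans q (m≤n+m _ 4))
    extend (x , zero , S , first e) = _ , _ , turn S , later ≤-refl
        (s≤s (≤-trans (≤-reflexive sizeℓ) (m≤n+m _ 3)))
      where
      sizeℓ : ℓ + ℓ ≡ _
      sizeℓ = trans (cong (_+ ℓ) (trans (sym e) (+-identityʳ x))) (trans (Spiral.height S) (+-identityʳ _))
    extend (x , zero , S , later p q) = _ , _ , turn S , later ≤-refl (≤-trans q (m≤n+m _ 4))

  spiral-closed : ∀ k → ℓ + ℓ ≤ n → 4 * k + 2 ≤ ℓ + ℓ ⊎ 4 * k + 2 + double λ₁ ≤ n → ClosedWalk _~_ (4 * k + 2)
  spiral-closed k 2ℓ≤n small with spiral k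
  ... | x , w , S , phase = subst (ClosedWalk _~_) size
      (close 1 (~-sym (chord x odd) ∷ walk) closing distinct (All.map bounded used))
    where
    open Spiral S
    top : Phase x w (4 * k + 2) → x + ℓ ≤ n
    top (first e) = ≤-trans (+-monoˡ-≤ ℓ (≤-trans (m≤m+n x (double w)) (≤-reflexive e))) 2ℓ≤n
    top (later w≤ <s) = [ (λ s≤ → contradiction s≤ (<⇒≱ <s)) , ≤-trans
        (≤-trans (≤-reflexive height) (+-monoʳ-≤ (4 * k + 2) (double-mono-≤ w≤))) ]′ small
    bounded : ∀ {r} → Used x w r → 1 ≤ r × r < 1 + n
    bounded (low 0<r r≤x) = 0<r , s≤s (≤-trans r≤x (≤-trans (m≤m+n x ℓ) (top phase)))
    bounded (high <r r≤) = ≤-<-trans z≤n <r , s≤s (≤-trans r≤ (top phase))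

  -- Regluing the column along bands of hexagons

  Within : ℕ → ℕ → List ℕ → Set
  Within lo hi = All (λ r → lo ≤ r × r ≤ hi)

  rows : ℕ → ℕ → List ℕ
  rows = ascent (λ t → t)

  rows-walk : ∀ s k → Walk _≈_ s (s + k) (rows s k)
  rows-walk = ascent-walk (λ t → t) step

  rows-within : ∀ s k → Within s (s + k) (rows s k)
  rows-within s k = All.tabulate λ r∈ → go (∈-ascent⁻ (λ t → t) s k r∈)
    where
    go : ∀ {r} → ∃[ t ] (s ≤ t × t ≤ s + k × r ≡ t) → s ≤ r × r ≤ s + k
    go (_ , p , q , refl) = p , q

  rows-unique : ∀ s k → Unique (rows s k)
  rows-unique s k = ascent-unique (λ t → t) s k λ _ p _ → <⇒≢ p

  reverse-within : ∀ {lo hi} xs → Within lo hi xs → Within lo hi (reverse xs)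
  reverse-within xs p = All.tabulate λ r∈ → All.lookup p (∈-resp-↭ (↭-reverse xs) r∈)

  widen : ∀ {lo hi lo′ hi′ xs} → lo′ ≤ lo → hi ≤ hi′ → Within lo hi xs → Within lo′ hi′ xs
  widen p q = All.map λ (p′ , q′) → ≤-trans p p′ , ≤-trans q′ q

  within-++-unique : ∀ {a b c d xs ys} → Within a b xs → Within c d ys → b < c ⊎ d < a →
                     Unique xs → Unique ys → Unique (xs ++ ys)
  within-++-unique p q (inj₁ b<c) xs! ys! = Uniqueₚ.++⁺ xs! ys!
    λ (r∈ , r∈′) → <⇒≱ b<c (≤-trans (proj₁ (All.lookup q r∈′)) (proj₂ (All.lookup p r∈)))
  within-++-unique p q (inj₂ d<a) xs! ys! = Uniqueₚ.++⁺ xs! ys!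
    λ (r∈ , r∈′) → <⇒≱ d<a (≤-trans (proj₁ (All.lookup p r∈)) (proj₂ (All.lookup q r∈′)))

  odd+double : ∀ x b → parity x ≡ 1ℙ → parity (x + double b) ≡ 1ℙ
  odd+double x zero e = trans (cong parity (+-identityʳ x)) e
  odd+double x (suc b) e = trans (cong parity (lem x (double b))) (odd+double x b e)
    where
    lem : ∀ x d → x + (2 + d) ≡ 2 + (x + d)
    lem = solve-∀

  module Noncontractible (periodic : ψ (1 + n) ≡ ψ 1) (2≤n : 2 ≤ n) where

    column : ClosedWalk _~_ n
    column = subst (ClosedWalk _~_) (trans (length-ascent (λ t → t) 1 k) 1+k≡n)
      (close 1 (rows-walk 1 k) (subst (_~ ψ 1) (cong ψ (sym 1+k≡n)) (subst (ψ n ~_) periodic (step n)))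
        (rows-unique 1 k) (All.map (λ (p , q) → p , s≤s (≤-trans q (≤-reflexive 1+k≡n))) (rows-within 1 k)))
      where
      k = n ∸ 1
      1+k≡n : 1 + k ≡ n
      1+k≡n = m+[n∸m]≡n (<⇒≤ 2≤n)

    -- The chord at the row 1, read as the row `1 + n`: the reglued columns live in the window of
    -- rows 2 to `1 + n`.
    wrap-chord : (1 + ℓ) ≈ (1 + n)
    wrap-chord = subst (ψ (1 + ℓ) ~_) (sym periodic) (~-sym (chord 1 refl))

    -- The rows 2, …, 2t and ℓ + 2, …, ℓ + 2t of the column are left out.
    oneBand : ∀ t {e f} → 0 < t → double t + e ≡ ℓ → ℓ + double t + f ≡ n → ClosedWalk _~_ (2 + (e + f))
    oneBand t {e} {f} 0<t 2t+e ℓ+2t+f = subst (ClosedWalk _~_) size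
      (close 2 (joinWalk _≈_ (rows-walk b e) link (reverseWalk _≈_ ~-sym (rows-walk (b + ℓ) f)))
        (~-sym (chord b (odd+double 1 t refl)))
        (within-++-unique A B (inj₁ (subst (_< b + ℓ) (sym b+e) (+-monoˡ-≤ ℓ 2≤b))) (rows-unique b e)
            (reverse-unique (rows-unique (b + ℓ) f)))
        (All.map (λ (p , q) → p , s≤s q)
            (Allₚ.++⁺ (widen 2≤b (≤-trans (≤-reflexive b+e)
                (≤-trans (+-monoˡ-≤ ℓ (s≤s z≤n)) (≤-trans (m≤m+n (b + ℓ) f) (≤-reflexive end)))) A)
          (widen (≤-trans 2≤b (m≤m+n b ℓ)) (≤-reflexive end) B))))
      where
      b = 1 + double t
      2≤b : 2 ≤ b
      2≤b = s≤s (≤-trans (s≤s z≤n) (double-mono-≤ 0<t))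
      b+e : b + e ≡ 1 + ℓ
      b+e = cong suc 2t+e
      end : b + ℓ + f ≡ 1 + n
      end = trans (lem (double t) ℓ f) (cong suc ℓ+2t+f)
        where
        lem : ∀ d l f → 1 + d + l + f ≡ 1 + (l + d + f)
        lem = solve-∀
      link : (b + e) ≈ (b + ℓ + f)
      link = subst₂ _≈_ (sym b+e) (sym end) wrap-chord
      A = rows-within b e
      B = reverse-within _ (rows-within (b + ℓ) f)
      size : length (rows b e ++ reverse (rows (b + ℓ) f)) ≡ 2 + (e + f)
      size = trans (length-++ (rows b e)) (trans (cong₂ _+_ (length-ascent _ b e)
        (trans (length-reverse (rows (b + ℓ) f)) (length-ascent _ (b + ℓ) f))) (lem e f))
        where
        lem : ∀ e f → suc e + suc f ≡ 2 + (e + f)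
        lem = solve-∀

    -- Besides 2 and ℓ + 2, the rows of the band at ℓ + 4 are left out.
    twoBands : ∀ t {e f} → 0 < t → double t + e ≡ ℓ → 3 + ℓ + double t + ℓ + f ≡ n → ClosedWalk _~_
        (3 + ℓ + (e + f))
    twoBands t {e} {f} 0<t 2t+e total = subst (ClosedWalk _~_) size
      -- Both cuts of the second band lie on the arc above the row `3 + ℓ` left by the first one,
      -- and the arc runs through them in the same direction. Exchanging chords there thus leaves
      -- one cycle again.
      (close 2 (joinWalk _≈_ (rows-walk 3 c) link₁
          (joinWalk _≈_ (reverseWalk _≈_ ~-sym (rows-walk (b + ℓ) f)) link₂
          (joinWalk _≈_ (rows-walk b e) link₃ (~-sym (step (3 + ℓ)) ∷ [-]))))
        (~-sym (chord 3 refl))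
        (within-++-unique A (Allₚ.++⁺ (widen 3+ℓ≤b+ℓ (≤-reflexive end) B)
            (Allₚ.++⁺ (widen (≤-trans (n≤1+n _) 4+ℓ≤b) (≤-trans (≤-trans (≤-reflexive b+e) j+ℓ≤b+ℓ) b+ℓ≤1+n) C)
              (widen ≤-refl (≤-trans 4+ℓ≤b (≤-trans (m≤m+n b ℓ) b+ℓ≤1+n)) D)))
            (inj₁ ≤-refl) (rows-unique 3 c)
          (within-++-unique B (Allₚ.++⁺ (widen (≤-trans (n≤1+n _) 4+ℓ≤b) (≤-reflexive b+e) C)
              (widen ≤-refl (m≤m+n j ℓ) D)) (inj₂ (+-monoˡ-≤ ℓ j<b)) (reverse-unique (rows-unique (b + ℓ) f))
            (within-++-unique C D (inj₂ j<b) (rows-unique b e) (∉-∷ (>⇒≢ ≤-refl) (λ ()) ∷! ((λ ()) ∷! [])))))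
        (All.map (λ (p , q) → p , s≤s q)
          (Allₚ.++⁺ (widen (s≤s (s≤s z≤n)) (≤-trans (n≤1+n _) (≤-trans 3+ℓ≤b+ℓ b+ℓ≤1+n)) A)
          (Allₚ.++⁺ (widen (≤-trans (s≤s (s≤s z≤n)) 3+ℓ≤b+ℓ) (≤-reflexive end) B)
          (Allₚ.++⁺ (widen (≤-trans (s≤s (s≤s z≤n)) 4+ℓ≤b)
              (≤-trans (≤-trans (≤-reflexive b+e) j+ℓ≤b+ℓ) b+ℓ≤1+n) C)
            (widen (s≤s (s≤s z≤n)) (≤-trans 4+ℓ≤b (≤-trans (m≤m+n b ℓ) b+ℓ≤1+n)) D))))))
      where
      c = suc (double λ₁)
      -- The first odd row clear of the band at the row 1.
      j = 4 + ℓ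
      b = j + double t
      b+e : b + e ≡ j + ℓ
      b+e = trans (+-assoc j (double t) e) (cong (λ z → j + z) 2t+e)
      end : b + ℓ + f ≡ 1 + n
      end = cong suc total
      j<b : j < b
      j<b = ≤-trans (≤-reflexive (+-comm 1 j)) (+-monoʳ-≤ j (≤-trans (s≤s z≤n) (double-mono-≤ 0<t)))
      4+ℓ≤b : 4 + ℓ ≤ b
      4+ℓ≤b = <⇒≤ j<b
      3+ℓ≤b+ℓ : 3 + ℓ ≤ b + ℓ
      3+ℓ≤b+ℓ = ≤-trans (n≤1+n _) (≤-trans 4+ℓ≤b (m≤m+n b ℓ))
      j+ℓ≤b+ℓ : j + ℓ ≤ b + ℓ
      j+ℓ≤b+ℓ = +-monoˡ-≤ ℓ 4+ℓ≤b
      b+ℓ≤1+n : b + ℓ ≤ 1 + n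
      b+ℓ≤1+n = ≤-trans (m≤m+n (b + ℓ) f) (≤-reflexive end)
      link₁ : (3 + c) ≈ (b + ℓ + f)
      link₁ = subst ((1 + ℓ) ≈_) (sym end) wrap-chord
      link₂ : (b + ℓ) ≈ b
      link₂ = ~-sym (chord b (odd+double j t (parity-suc-double (suc λ₁))))
      link₃ : (b + e) ≈ j
      link₃ = subst (_≈ j) (sym b+e) (~-sym (chord j (parity-suc-double (suc λ₁))))
      A : Within 3 (2 + ℓ) (rows 3 c)
      A = widen ≤-refl (n≤1+n _) (rows-within 3 c)
      B = reverse-within _ (rows-within (b + ℓ) f)
      C = rows-within b e
      D : Within (3 + ℓ) j (j ∷ 3 + ℓ ∷ [])
      D = (n≤1+n _ , ≤-refl) ∷ (≤-refl , n≤1+n _) ∷ []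
      size : length (rows 3 c ++ reverse (rows (b + ℓ) f) ++ rows b e ++ j ∷ 3 + ℓ ∷ []) ≡ 3 + ℓ + (e + f)
      size = trans (length-++ (rows 3 c)) (trans (cong₂ _+_ (length-ascent _ 3 c)
        (trans (length-++ (reverse (rows (b + ℓ) f)))
            (cong₂ _+_ (trans (length-reverse (rows (b + ℓ) f)) (length-ascent _ (b + ℓ) f))
          (trans (length-++ (rows b e)) (cong (_+ 2) (length-ascent _ b e)))))) (lem (double λ₁) e f))
        where
        lem : ∀ d e f → suc (suc d) + (suc f + (suc e + 2)) ≡ 3 + suc (2 + d) + (e + f)
        lem = solve-∀

    -- If the spiral does not fit, then `r < λ₁`. A band of `t` hexagons loses 4t - 2 rows, so one
    -- band serves odd `r`. For even `r` a further band of one hexagon loses the two rows still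
    -- missing, 4t in all.
    allLengths : ∀ κ r → ℓ + ℓ ≤ n → 4 * κ + 2 + double r ≡ n → ClosedWalk _~_ (4 * κ + 2)
    allLengths κ r 2ℓ≤n total with 4 * κ + 2 ≤? ℓ + ℓ | 4 * κ + 2 + double λ₁ ≤? n
    ... | yes p | _ = spiral-closed κ 2ℓ≤n (inj₁ p)
    ... | no _ | yes p = spiral-closed κ 2ℓ≤n (inj₂ p)
    ... | no long | no tight = bands r (halve r) total
      (double-cancel-< (+-cancelˡ-< (4 * κ + 2) _ _ (≤-<-trans (≤-reflexive total) (≰⇒> tight))))
      where
      L = 4 * κ + 2
      double-cancel-< : ∀ {a b} → double a < double b → a < b
      double-cancel-< {a} {b} p = ≰⇒> λ b≤a → <⇒≱ p (double-mono-≤ b≤a)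
      λ₁≤ℓ : λ₁ ≤ ℓ
      λ₁≤ℓ = ≤-trans (≤-trans (m≤m+n λ₁ λ₁) (≤-reflexive (sym (double≡+ λ₁)))) (m≤n+m (double λ₁) 3)
      bands : ∀ r → ∃[ t ] (r ≡ double t ⊎ r ≡ suc (double t)) → L + double r ≡ n → r < λ₁ → ClosedWalk _~_ L
      bands r (zero , inj₁ refl) total _ = subst (ClosedWalk _~_) (sym (trans (sym (+-identityʳ L)) total))
          column
      bands r (suc t , inj₁ e) total r<λ₁ = subst (ClosedWalk _~_) size
          (twoBands (suc t) (s≤s z≤n) (proj₂ E) (proj₂ F))
        where
        d = double (suc t)
        d≤ℓ : d ≤ ℓ
        d≤ℓ = ≤-trans (≤-reflexive (sym e)) (≤-trans (<⇒≤ r<λ₁) λ₁≤ℓ)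
        E : ∃[ x ] d + x ≡ ℓ
        E = m≤n⇒∃[o]m+o≡n d≤ℓ
        total′ : L + (d + d) ≡ n
        total′ = trans (cong (λ z → L + z) (trans (sym (double≡+ d)) (cong double (sym e)))) total
        room : 3 + ℓ + d + ℓ ≤ n
        room = ≤-trans (≤-reflexive (lem ℓ d))
            (≤-trans (+-mono-≤ (≰⇒> long) (+-monoʳ-≤ d (s≤s (s≤s z≤n)))) (≤-reflexive total′))
          where
          lem : ∀ l d → 3 + l + d + l ≡ suc (l + l) + (d + 2)
          lem = solve-∀
        F : ∃[ x ] 3 + ℓ + d + ℓ + x ≡ n
        F = m≤n⇒∃[o]m+o≡n room
        size : 3 + ℓ + (proj₁ E + proj₁ F) ≡ L
        size = +-cancelʳ-≡ (d + d) _ _ (trans (lem ℓ d (proj₁ E) (proj₁ F))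
          (trans (cong (λ z → 3 + ℓ + d + z + proj₁ F) (proj₂ E)) (trans (proj₂ F) (sym total′))))
          where
          lem : ∀ l d e f → 3 + l + (e + f) + (d + d) ≡ 3 + l + d + (d + e) + f
          lem = solve-∀
      bands r (t , inj₂ e) total r<λ₁ = subst (ClosedWalk _~_) size
          (oneBand (suc t) (s≤s z≤n) (proj₂ E) (proj₂ F))
        where
        d = double (suc t)
        d≤ℓ : d ≤ ℓ
        d≤ℓ = ≤-trans (≤-reflexive (cong suc (sym e))) (≤-trans r<λ₁ λ₁≤ℓ)
        E : ∃[ x ] d + x ≡ ℓ
        E = m≤n⇒∃[o]m+o≡n d≤ℓ
        total′ : L + (d + d) ≡ 2 + n
        total′ = trans (lem L (double t))
            (cong (λ z → 2 + z) (trans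
                (cong (λ z → L + z) (trans (sym (double≡+ (suc (double t)))) (cong double (sym e)))) total))
          where
          lem : ∀ L t → L + (2 + t + (2 + t)) ≡ 2 + (L + (suc t + suc t))
          lem = solve-∀
        F : ∃[ x ] ℓ + d + x ≡ n
        F = m≤n⇒∃[o]m+o≡n (≤-trans (+-monoʳ-≤ ℓ d≤ℓ) 2ℓ≤n)
        size : 2 + (proj₁ E + proj₁ F) ≡ L
        size = +-cancelʳ-≡ (d + d) _ _ (trans (lem d (proj₁ E) (proj₁ F))
          (trans (cong (λ z → 2 + (z + d + proj₁ F)) (proj₂ E))
              (trans (cong (λ z → 2 + z) (proj₂ F)) (sym total′))))
          where
          lem : ∀ d e f → 2 + (e + f) + (d + d) ≡ 2 + (d + e + d + f)
          lem = solve-∀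

-- Reducing one column to chords of length between 3 and half the column

≋-shift : ∀ {a b c k} → a ≋ b ℤ.+ c [ k ] → b ≋ a ℤ.+ - c [ k ]
≋-shift {a} {b} {c} {k} p = subst (_≋ a ℤ.+ - c [ k ]) (lem b c) (≋-+ (≋-sym p) (≋-refl { - c}))
  where
  lem : ∀ b c → b ℤ.+ c ℤ.+ - c ≡ b
  lem = ℤ-solve-∀

Fin1-unique : ∀ (i j : Fin 1) → i ≡ j
Fin1-unique zero zero = refl

≋1⇒odd : ∀ k → + k ≋ + 1 [ 2 ] → parity k ≡ 1ℙ
≋1⇒odd k p with halve k
... | y , inj₂ refl = parity-suc-double y
... | y , inj₁ refl with residue-unique (s≤s z≤n) (s≤s (s≤s z≤n))
    (≋-trans (≋-sym (even⇒≋0 (double y) (parity-double y))) p)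
... | ()

module OneColumn (n : ℕ) .{{_ : NonZero n}} (ℓ : ℤ) (2∣n : 2 ℕ.∣ n) where

  open Torus 1 n ℓ 2∣n

  ±1-neighbours : ∀ {s v w} → s ≡ + 1 ⊎ s ≡ - + 1 → ℓ ≋ s [ n ] → v ~ w →
    ⟦ proj₂ w ⟧ ≋ ⟦ proj₂ v ⟧ ℤ.+ + 1 [ n ] ⊎ ⟦ proj₂ w ⟧ ≋ ⟦ proj₂ v ⟧ ℤ.+ - + 1 [ n ]
  ±1-neighbours {v = v} {w} _ _ (fwd (vertical p)) = inj₁ (≡[mod]⇒≋ {⟦ proj₂ w ⟧} {⟦ proj₂ v ⟧ ℤ.+ + 1} p)
  ±1-neighbours {v = v} {w} _ _ (bwd (vertical p)) = inj₂
      (≋-shift {⟦ proj₂ v ⟧} {⟦ proj₂ w ⟧} {+ 1} (≡[mod]⇒≋ {⟦ proj₂ v ⟧} {⟦ proj₂ w ⟧ ℤ.+ + 1} p))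
  ±1-neighbours _ _ (fwd (flat {i′ = zero} () _))
  ±1-neighbours _ _ (bwd (flat {i′ = zero} () _))
  ±1-neighbours {s} {v} {w} s≡ q (fwd (jump _ _ _ p)) = result s≡
    where
    p′ : ⟦ proj₂ w ⟧ ≋ ⟦ proj₂ v ⟧ ℤ.+ s [ n ]
    p′ = ≋-trans (≡[mod]⇒≋ {⟦ proj₂ w ⟧} {⟦ proj₂ v ⟧ ℤ.+ ℓ} p) (≋-+ (≋-refl {⟦ proj₂ v ⟧}) q)
    result : s ≡ + 1 ⊎ s ≡ - + 1 → _
    result (inj₁ refl) = inj₁ p′
    result (inj₂ refl) = inj₂ p′
  ±1-neighbours {s} {v} {w} s≡ q (bwd (jump _ _ _ p)) = result s≡
    where
    p′ : ⟦ proj₂ w ⟧ ≋ ⟦ proj₂ v ⟧ ℤ.+ - s [ n ]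
    p′ = ≋-shift {⟦ proj₂ v ⟧} {⟦ proj₂ w ⟧} {s}
      (≋-trans (≡[mod]⇒≋ {⟦ proj₂ v ⟧} {⟦ proj₂ w ⟧ ℤ.+ ℓ} p) (≋-+ (≋-refl {⟦ proj₂ w ⟧}) q))
    result : s ≡ + 1 ⊎ s ≡ - + 1 → _
    result (inj₁ refl) = inj₂ p′
    result (inj₂ refl) = inj₁ p′

  -- A jump would be parallel to a vertical edge, and three distinct neighbours would share the two
  -- rows next to `ν (+ 0)`.
  ¬ℓ≋±1 : SimpleCubic _~_ → ∀ {s} → s ≡ + 1 ⊎ s ≡ - + 1 → ¬ ℓ ≋ s [ n ]
  ¬ℓ≋±1 cubic s≡ q with SimpleCubic.3-regular cubic (zero , ν (+ 0))
  ... | a ∷ b ∷ c ∷ [] , refl , (a≢b ∷ a≢c ∷ []) ∷ (b≢c ∷ []) ∷ _ , nbr =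
    three (side (here refl)) (side (there (here refl))) (side (there (there (here refl))))
    where
    Side : Vertex 1 n → Set
    Side w = ⟦ proj₂ w ⟧ ≋ ⟦ ν (+ 0) ⟧ ℤ.+ + 1 [ n ] ⊎ ⟦ proj₂ w ⟧ ≋ ⟦ ν (+ 0) ⟧ ℤ.+ - + 1 [ n ]
    side : ∀ {w} → w ∈ a ∷ b ∷ c ∷ [] → Side w
    side {w} w∈ = ±1-neighbours s≡ q (Equivalence.from (nbr w) w∈)
    same : ∀ {v w : Vertex 1 n} {z} → ⟦ proj₂ v ⟧ ≋ z [ n ] → ⟦ proj₂ w ⟧ ≋ z [ n ] → v ≡ w
    same p q = cong₂ _,_ (Fin1-unique _ _) (⟦⟧-injective (≋-trans p (≋-sym q)))
    three : Side a → Side b → Side c → ⊥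
    three (inj₁ p) (inj₁ q) _ = a≢b (same p q)
    three (inj₁ p) _ (inj₁ r) = a≢c (same p r)
    three _ (inj₁ q) (inj₁ r) = b≢c (same q r)
    three (inj₂ p) (inj₂ q) _ = a≢b (same p q)
    three (inj₂ p) _ (inj₂ r) = a≢c (same p r)
    three _ (inj₂ q) (inj₂ r) = b≢c (same q r)

  half : ∀ {L r} (ψ : ℕ → Vertex 1 n) →
    (∀ t → ψ t ~ ψ (suc t)) → (∀ t → parity t ≡ 1ℙ → ψ t ~ ψ (t + r)) → ψ (1 + n) ≡ ψ 1 →
    (∀ {s t} → s < t → t < s + n → ψ s ≢ ψ t) → 2 ≤ n →
    parity r ≡ 1ℙ → r ≢ 1 → r + r ≤ n → ∀ κ x → 4 * κ + 2 ≡ L → L + double x ≡ n → ClosedWalk _~_ L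
  half {r = r} ψ step chord periodic window 2≤n odd r≢1 2r≤n κ x refl total with halve r
  ... | y , inj₁ refl = contradiction (trans (sym (parity-double y)) odd) λ ()
  ... | zero , inj₂ refl = contradiction refl r≢1
  ... | suc y , inj₂ refl = N.allLengths κ x 2r≤n total
    where
    module C = Chordal {_~_ = _~_} ~-sym ψ n y step chord window
    module N = C.Noncontractible periodic 2≤n

  oneColumn : SimpleCubic _~_ → 2 ≤ n → ℓ ≋ + 1 [ 2 ] → ∀ κ x → 4 * κ + 2 + double x ≡ n →
              ClosedWalk _~_ (4 * κ + 2)
  oneColumn cubic 2≤n odd κ x total = result (k + k ≤? n)
    where
    k = toℕ (ν ℓ)
    k≋ℓ : + k ≋ ℓ [ n ]
    k≋ℓ = ⟦ν⟧ ℓ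
    r = n ∸ k
    k+r : k + r ≡ n
    k+r = m+[n∸m]≡n (<⇒≤ (toℕ<n (ν ℓ)))
    -r≋ℓ : - + r ≋ ℓ [ n ]
    -r≋ℓ = ≋-trans (multiple (- + 1) (trans (lem (+ k) (+ r)) (cong (λ z → + k ℤ.+ - + 1 ℤ.* + z) k+r))) k≋ℓ
      where
      lem : ∀ k r → - r ≡ k ℤ.+ - + 1 ℤ.* (k ℤ.+ r)
      lem = ℤ-solve-∀
    -1≋1 : - + 1 ≋ + 1 [ 2 ]
    -1≋1 = multiple (- + 1) refl
    r-odd : parity r ≡ 1ℙ
    r-odd = ≋1⇒odd r (≋-trans (subst (_≋ - + 1 [ 2 ]) (ℤₚ.neg-involutive (+ r))
      (≋-neg (≋-trans (≋-weaken 2∣n -r≋ℓ) odd))) -1≋1)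
    result : Dec (k + k ≤ n) → ClosedWalk _~_ (4 * κ + 2)
    result (yes 2k≤n) = half ψ row-edge chord (cong (col 0 ,_) (ν-periodic (+ 1)))
        (λ p q e → ν-window p q (cong proj₂ e)) 2≤n (≋1⇒odd k (≋-trans (≋-weaken 2∣n k≋ℓ) odd)) k≢1 2k≤n κ x
            refl total
      where
      ψ : ℕ → Vertex 1 n
      ψ t = col 0 , ν (+ t)
      k≢1 : k ≢ 1
      k≢1 e = ¬ℓ≋±1 cubic (inj₁ refl) (≋-sym (subst (λ z → + z ≋ ℓ [ n ]) e k≋ℓ))
      chord : ∀ t → parity t ≡ 1ℙ → ψ t ~ ψ (t + k)
      chord t e = subst (λ z → ψ t ~ (col 0 , z)) (ν-cong (≋-+ (≋-refl {+ t}) (≋-sym k≋ℓ)))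
          (jump-edge (+ t) refl (odd⇒≋1 t e))
    result (no 2k≰n) = half ψ step chord (cong (col 0 ,_) (ν-cong (multiple (- + 1) (wrap (+ n)))))
        (λ {s} {t} p q e → ν-window p q
            (ν-cong (subst₂ (_≋_[ n ]) (ℤₚ.neg-involutive (+ s)) (ℤₚ.neg-involutive (+ t))
          (≋-neg (ν-injective {z = - + s} {z′ = - + t} (cong proj₂ e))))))
        2≤n r-odd r≢1 2r≤n κ x refl total
      where
      ψ : ℕ → Vertex 1 n
      -- Read downwards, the column has chords of length `r`, and they still start at odd rows since
      -- negation preserves parity.
      ψ t = col 0 , ν (- + t)
      wrap : ∀ n → - (+ 1 ℤ.+ n) ≡ - + 1 ℤ.+ - + 1 ℤ.* n
      wrap = ℤ-solve-∀
      r≢1 : r ≢ 1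
      r≢1 e = ¬ℓ≋±1 cubic (inj₂ refl) (≋-sym (subst (λ z → - + z ≋ ℓ [ n ]) e -r≋ℓ))
      2r≤n : r + r ≤ n
      2r≤n = ≤-trans (+-monoˡ-≤ r (<⇒≤ (+-cancelˡ-< k r k (≤-<-trans (≤-reflexive k+r) (≰⇒> 2k≰n)))))
          (≤-reflexive k+r)
      step : ∀ t → ψ t ~ ψ (suc t)
      step t = ~-sym (subst (λ z → ψ (suc t) ~ (col 0 , ν z)) (lem (+ t)) (vertical-edge (- + suc t)))
        where
        lem : ∀ t → - (+ 1 ℤ.+ t) ℤ.+ + 1 ≡ - t
        lem = ℤ-solve-∀
      chord : ∀ t → parity t ≡ 1ℙ → ψ t ~ ψ (t + r)
      chord t e = subst (λ z → ψ t ~ (col 0 , z))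
        (ν-cong (≋-trans (≋-+ (≋-refl { - + t}) (≋-sym -r≋ℓ))
            (≋-reflexive (sym (ℤₚ.neg-distrib-+ (+ t) (+ r))))))
        (jump-edge (- + t) refl (≋-trans (≋-neg (odd⇒≋1 t e)) -1≋1))

-- Second Hamiltonian cycles

-- An orbit of the dihedral group generated by two involutions is a path or a
-- cycle, so the ends of a path come in pairs.
module _ {S : Set} (P : S → Set) (α β : S → S)
  (α-P : ∀ {s} → P s → P (α s)) (β-P : ∀ {s} → P s → P (β s))
  (α-involutive : ∀ {s} → P s → α (α s) ≡ s) (β-involutive : ∀ {s} → P s → β (β s) ≡ s)
  (β-fixes-none : ∀ {s} → P s → β s ≢ s)
  (_≟_ : DecidableEquality S)
  {N : ℕ} (code : S → Fin N) (code-injective : ∀ {s t} → P s → P t → code s ≡ code t → s ≡ t)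
  where

  module _ (s₀ : S) (P₀ : P s₀) (fixed₀ : α s₀ ≡ s₀) where

    private
      orbit : ℕ → S
      orbit zero = s₀
      orbit (suc k) = α (β (orbit k))

      orbit-P : ∀ k → P (orbit k)
      orbit-P zero = P₀
      orbit-P (suc k) = α-P (β-P (orbit-P k))

      α-orbit : ∀ k → α (orbit (suc k)) ≡ β (orbit k)
      α-orbit k = α-involutive (β-P (orbit-P k))

      step-injective : ∀ {s t} → P s → P t → α (β s) ≡ α (β t) → s ≡ t
      step-injective Ps Pt e = trans (sym (β-involutive Ps)) (trans (cong β
        (trans (sym (α-involutive (β-P Ps))) (trans (cong α e) (α-involutive (β-P Pt))))) (β-involutive Pt))

      rewind : ∀ i k → orbit i ≡ orbit (i + k) → s₀ ≡ orbit k
      rewind zero k e = e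
      rewind (suc i) k e = rewind i k (step-injective (orbit-P i) (orbit-P (i + k)) e)

      period : ∃[ p ] orbit (suc p) ≡ s₀
      period with Finₚ.pigeonhole (n<1+n N) (λ i → code (orbit (toℕ i)))
      ... | i , j , i<j , e with m≤n⇒∃[o]m+o≡n i<j
      ... | p , e′ = p , sym (rewind (toℕ i) (suc p)
          (trans (code-injective (orbit-P (toℕ i)) (orbit-P (toℕ j)) e)
              (cong orbit (trans (sym e′) (sym (+-suc (toℕ i) p))))))

      -- Both involutions reverse the cyclic orbit. That `α` fixes `s₀` pins down the reflection by
      -- `β` at one point, hence everywhere.
      mirror : ∀ k l {p} → k + l ≡ p → orbit (suc p) ≡ s₀ → β (orbit l) ≡ orbit k
      mirror zero l refl e = trans (sym (α-orbit l)) (trans (cong α e) fixed₀)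
      mirror (suc k) l {p} k+l e = trans (sym (α-orbit l)) (cong α
        (trans (sym (β-involutive (orbit-P (suc l)))) (cong β (mirror k (suc l) (trans (+-suc k l) k+l) e))))

      -- The other end of the axis of reflection lies opposite to `s₀`. For an odd period `suc p` it
      -- would be fixed by `β`; for an even one it is fixed by `α`. If it is `s₀` again, half the
      -- period is a period too.
      search : ∀ p → Acc _<_ p → orbit (suc p) ≡ s₀ → ∃[ s ] (P s × α s ≡ s × s ≢ s₀)
      search p (acc smaller) e with halve p
      ... | q , inj₁ refl = contradiction (mirror q q (sym (double≡+ q)) e) (β-fixes-none (orbit-P q))
      ... | q , inj₂ refl with orbit (suc q) ≟ s₀
      ... | yes e′ = search q (smaller (s≤s (subst (q ≤_) (sym (double≡+ q)) (m≤m+n q q)))) e′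
      ... | no ≢s₀ = orbit (suc q) , orbit-P (suc q) , fixed , ≢s₀
        where
        fixed : α (orbit (suc q)) ≡ orbit (suc q)
        fixed = trans (α-orbit q) (trans
            (cong β (sym (mirror q (suc q) (trans (+-suc q q) (cong suc (sym (double≡+ q)))) e)))
          (β-involutive (orbit-P (suc q))))

    anotherFixedPoint : ∃[ s ] (P s × α s ≡ s × s ≢ s₀)
    anotherFixedPoint = search (proj₁ period) (<-wellFounded _) (proj₂ period)

-- The lollipop argument in edge-coloured cubic multigraphs

Colour : Set
Colour = Fin 3

-- On the diagonal the values are fillers.
third : Colour → Colour → Colour
third zero zero = zero
third zero (suc zero) = suc (suc zero)
third zero (suc (suc zero)) = suc zero
third (suc zero) zero = suc (suc zero)
third (suc zero) (suc zero) = zero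
third (suc zero) (suc (suc zero)) = zero
third (suc (suc zero)) zero = suc zero
third (suc (suc zero)) (suc zero) = zero
third (suc (suc zero)) (suc (suc zero)) = zero

third-≢ˡ : ∀ a b → a ≢ b → a ≢ third a b
third-≢ˡ = from-yes (Finₚ.all? λ a → Finₚ.all? λ b → ¬? (a Finₚ.≟ b) →-dec ¬? (a Finₚ.≟ third a b))

third-≢ʳ : ∀ a b → a ≢ b → third a b ≢ b
third-≢ʳ = from-yes (Finₚ.all? λ a → Finₚ.all? λ b → ¬? (a Finₚ.≟ b) →-dec ¬? (third a b Finₚ.≟ b))

third-involutive : ∀ a b → a ≢ b → third a (third a b) ≡ b
third-involutive = from-yes
    (Finₚ.all? λ a → Finₚ.all? λ b → ¬? (a Finₚ.≟ b) →-dec (third a (third a b) Finₚ.≟ b))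

lastColour : Colour → List Colour → Colour
lastColour c [] = c
lastColour _ (c ∷ w) = lastColour c w

lastColour-++ : ∀ c u x w → lastColour c (u ++ x ∷ w) ≡ lastColour x w
lastColour-++ c [] x w = refl
lastColour-++ c (d ∷ u) x w = lastColour-++ d u x w

-- Each colour is a perfect matching, given as an involution. A word of colours determines a walk
-- even where edges are parallel.
module Lollipop {V : Set} (_≟_ : DecidableEquality V) (move : Colour → V → V)
  (move-involutive : ∀ c v → move c (move c v) ≡ v) (move-≢ : ∀ c v → move c v ≢ v) (v₀ : V) where

  end : V → List Colour → V
  end v [] = v
  end v (c ∷ w) = end (move c v) w

  trace : V → List Colour → List V
  trace v [] = v ∷ []
  trace v (c ∷ w) = v ∷ trace (move c v) w

  end-++ : ∀ v u w → end v (u ++ w) ≡ end (end v u) w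
  end-++ v [] w = refl
  end-++ v (c ∷ u) w = end-++ (move c v) u w

  trace-++ : ∀ v u x w → trace v (u ++ x ∷ w) ≡ trace v u ++ trace (move x (end v u)) w
  trace-++ v [] x w = refl
  trace-++ v (c ∷ u) x w = cong (v ∷_) (trace-++ (move c v) u x w)

  end-∈ : ∀ v w → end v w ∈ trace v w
  end-∈ v [] = here refl
  end-∈ v (c ∷ w) = there (end-∈ (move c v) w)

  length-trace : ∀ v w → length (trace v w) ≡ suc (length w)
  length-trace v [] = refl
  length-trace v (c ∷ w) = cong suc (length-trace (move c v) w)

  end-reverse : ∀ v w → end (end v w) (reverse w) ≡ v
  end-reverse v [] = refl
  end-reverse v (c ∷ w) = trans (cong (end _) (unfold-reverse c w)) (trans (end-++ _ (reverse w) (c ∷ []))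
    (trans (cong (move c) (end-reverse (move c v) w)) (move-involutive c v)))

  trace-reverse : ∀ v w → trace (end v w) (reverse w) ≡ reverse (trace v w)
  trace-reverse v [] = refl
  trace-reverse v (c ∷ w) = trans (cong (trace _) (unfold-reverse c w))
    (trans (trace-++ _ (reverse w) c [])
      (trans (cong₂ (λ xs z → xs ++ z ∷ []) (trace-reverse (move c v) w)
        (trans (cong (move c) (end-reverse (move c v) w)) (move-involutive c v)))
        (sym (unfold-reverse v (trace (move c v) w)))))

  -- Cuts the path at its vertex z, adjacent to its end by an edge of colour y,
  -- and reattaches the remainder backwards along that edge.
  rotate : V → List Colour → Colour → V → List Colour × Colour
  rotate v [] y z = [] , y
  rotate v (x ∷ w) y z with v ≟ z
  ... | yes _ = y ∷ reverse w , x
  ... | no _ = x ∷ proj₁ r , proj₂ r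
    where r = rotate (move x v) w y z

  rotate-at : ∀ v u x w y → Unique (trace v (u ++ x ∷ w)) →
              rotate v (u ++ x ∷ w) y (end v u) ≡ (u ++ y ∷ reverse w , x)
  rotate-at v [] x w y _ with v ≟ v
  ... | yes _ = refl
  ... | no v≢v = contradiction refl v≢v
  rotate-at v (c ∷ u) x w y (v∉ ∷ t!) with v ≟ end (move c v) u
  ... | yes v≡ = contradiction (subst (_∈ trace (move c v) (u ++ x ∷ w)) (sym v≡)
          (subst (end (move c v) u ∈_) (sym (trace-++ (move c v) u x w)) (∈-++⁺ˡ (end-∈ (move c v) u))))
              (All¬⇒¬Any v∉)
  ... | no _ = cong (λ r → c ∷ proj₁ r , proj₂ r) (rotate-at (move c v) u x w y t!)

  split : ∀ v w {z} → z ∈ trace v w → z ≢ end v w → ∃[ u ] ∃[ x ] ∃[ w′ ] (w ≡ u ++ x ∷ w′ × end v u ≡ z)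
  split v [] (here refl) z≢ = contradiction refl z≢
  split v (c ∷ w) (here refl) z≢ = [] , c , w , refl , refl
  split v (c ∷ w) (there z∈) z≢ with split (move c v) w z∈ z≢
  ... | u , x , w′ , refl , e = c ∷ u , x , w′ , refl , e

  State : Set
  State = List Colour × Colour

  -- A Hamiltonian path from v₀ starting with colour zero, and an edge at its
  -- end outside the path.
  record Lolly (s : State) : Set where
    constructor lolly
    field
      {tail}   : List Colour
      starts   : proj₁ s ≡ zero ∷ tail
      distinct : Unique (trace v₀ (proj₁ s))
      full     : ∀ v → v ∈ trace v₀ (proj₁ s)
      free     : lastColour zero (proj₁ s) ≢ proj₂ s

  target : State → V
  target (w , y) = move y (end v₀ w)

  -- A state whose free edge returns to `v₀` is a Hamiltonian cycle and stays fixed. Otherwise path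
  -- and free edge form a lollipop: its loop is opened at the other loop edge at the knot, and this
  -- edge is the new free one.
  α : State → State
  α s@(w , y) with target s ≟ v₀
  ... | yes _ = s
  ... | no _ = rotate v₀ w y (target s)

  β : State → State
  β (w , y) = w , third (lastColour zero w) y

  β-lolly : ∀ {s} → Lolly s → Lolly (β s)
  β-lolly (lolly a b c d) = lolly a b c (third-≢ˡ _ _ d)

  β-involutive : ∀ {s} → Lolly s → β (β s) ≡ s
  β-involutive L = cong (_ ,_) (third-involutive _ _ (Lolly.free L))

  β-fixes-none : ∀ {s} → Lolly s → β s ≢ s
  β-fixes-none L e = third-≢ʳ _ _ (Lolly.free L) (cong proj₂ e)

  module Rotation {u x w y} (L : Lolly (u ++ x ∷ w , y)) (hit : end v₀ u ≡ target (u ++ x ∷ w , y))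
      (≢v₀ : end v₀ u ≢ v₀) where
    open Lolly L
    new : List Colour
    new = u ++ y ∷ reverse w

    private
      z = end v₀ u
      end≡ : end v₀ (u ++ x ∷ w) ≡ end (move x z) w
      end≡ = end-++ v₀ u (x ∷ w)
      move-y : move y z ≡ end (move x z) w
      move-y = trans (cong (move y) hit) (trans (move-involutive y _) end≡)

    trace-new : trace v₀ new ↭ trace v₀ (u ++ x ∷ w)
    trace-new = ↭-trans (↭-reflexive (trans (trace-++ v₀ u y (reverse w)) (cong (trace v₀ u ++_)
        (trans (cong (λ v → trace v (reverse w)) move-y) (trace-reverse (move x z) w)))))
      (↭-trans (++⁺ˡ (trace v₀ u) (↭-reverse (trace (move x z) w))) (↭-reflexive (sym (trace-++ v₀ u x w))))

    end-new : end v₀ new ≡ move x z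
    end-new = trans (end-++ v₀ u (y ∷ reverse w))
        (trans (cong (λ v → end v (reverse w)) move-y) (end-reverse (move x z) w))

    target-new : target (new , x) ≡ z
    target-new = trans (cong (move x) end-new) (move-involutive x z)

    new-distinct : Unique (trace v₀ new)
    new-distinct = Unique-↭ (↭-sym trace-new) distinct

    -- Reversal puts the first colour of `w` last. Were it `x`, the old path would run back along
    -- the edge it had just used.
    new-free : ∀ u w → Unique (trace v₀ (u ++ x ∷ w)) → lastColour zero (u ++ x ∷ w) ≢ y → lastColour zero
        (u ++ y ∷ reverse w) ≢ x
    new-free u [] t! l e = l (trans (lastColour-++ zero u x [])
        (sym (trans (sym (lastColour-++ zero u y [])) e)))
    new-free u (c ∷ w) t! l e = no-return u w (subst (λ c → Unique (trace v₀ (u ++ x ∷ c ∷ w))) c≡x t!)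
      where
      c≡x : c ≡ x
      c≡x = trans (sym (trans (cong (λ w → lastColour zero (u ++ y ∷ w)) (unfold-reverse c w))
        (trans (lastColour-++ zero u y (reverse w ∷ʳ c)) (lastColour-++ y (reverse w) c [])))) e
      no-return : ∀ u w → ¬ Unique (trace v₀ (u ++ x ∷ x ∷ w))
      no-return = go v₀
        where
        go : ∀ v u w → ¬ Unique (trace v (u ++ x ∷ x ∷ w))
        go v [] w (v∉ ∷ _) = All¬⇒¬Any v∉
            (there (subst (_∈ trace (move x (move x v)) w) (move-involutive x v) (start-∈ _ w)))
          where
          start-∈ : ∀ v w → v ∈ trace v w
          start-∈ v [] = here refl
          start-∈ v (_ ∷ _) = here refl
        go v (d ∷ u) w (_ ∷ t!) = go (move d v) u w t!

    new-lolly : Lolly (new , x)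
    new-lolly = record
      { starts = proj₂ (begins u ≢v₀ starts)
      ; distinct = new-distinct
      ; full = λ v → ∈-resp-↭ (↭-sym trace-new) (full v)
      ; free = new-free u w distinct free
      }
      where
      begins : ∀ u → end v₀ u ≢ v₀ → u ++ x ∷ w ≡ zero ∷ tail → ∃[ t ] u ++ y ∷ reverse w ≡ zero ∷ t
      begins [] z≢v₀ _ = contradiction refl z≢v₀
      begins (c ∷ u) _ refl = _ , refl

    rotate≡ : rotate v₀ (u ++ x ∷ w) y (target (u ++ x ∷ w , y)) ≡ (new , x)
    rotate≡ = trans (cong (rotate v₀ (u ++ x ∷ w) y) (sym hit)) (rotate-at v₀ u x w y distinct)

    α-new : α (new , x) ≡ (u ++ x ∷ w , y)
    α-new with target (new , x) ≟ v₀
    ... | yes e = contradiction (trans (sym target-new) e) ≢v₀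
    ... | no _ = trans (cong (rotate v₀ new x) target-new) (trans (rotate-at v₀ u y (reverse w) x new-distinct)
        (cong (λ w → u ++ x ∷ w , y) (reverse-involutive w)))

  α-lolly-involutive : ∀ {s} → Lolly s → Lolly (α s) × α (α s) ≡ s
  α-lolly-involutive {s@(w , y)} L with target s ≟ v₀ in eq
  ... | yes e = L , α-fixed
    where
    α-fixed : α s ≡ s
    α-fixed rewrite eq = refl
  ... | no ≢v₀ with split v₀ w (Lolly.full L (target s)) (move-≢ y (end v₀ w))
  ... | u , x , w′ , refl , hit = subst (λ s′ → Lolly s′ × α s′ ≡ s) (sym R.rotate≡) (R.new-lolly , R.α-new)
    where module R = Rotation {u} {x} {w′} {y} L hit (≢v₀ ∘ trans (sym hit))

  no-loop : ∀ v u x w → Unique (trace v (u ++ x ∷ w)) → end (move x (end v u)) w ≡ move x (end v u) → w ≡ []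
  no-loop v [] x [] _ _ = refl
  no-loop v [] x (c ∷ w) (_ ∷ v∉ ∷ _) e = contradiction (subst (_∈ trace _ w) e (end-∈ _ w)) (All¬⇒¬Any v∉)
  no-loop v (d ∷ u) x w (_ ∷ t!) e = no-loop (move d v) u x w t! e

  -- If a rotation changed nothing, the edge cut would be the last one of the path and have the free
  -- colour, against `free`.
  α-fixed⇒closed : ∀ {s} → Lolly s → α s ≡ s → target s ≡ v₀
  α-fixed⇒closed {s@(w , y)} L e with target s ≟ v₀
  ... | yes e′ = e′
  ... | no ≢v₀ with split v₀ w (Lolly.full L (target s)) (move-≢ y (end v₀ w))
  ... | u , x , w′ , refl , hit = contradiction y≡x y≢x
    where
    module R = Rotation {u} {x} {w′} {y} L hit (≢v₀ ∘ trans (sym hit))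
    e″ : (R.new , x) ≡ (w , y)
    e″ = trans (sym R.rotate≡) e
    y≡x : x ≡ y
    y≡x = cong proj₂ e″
    end≡ : end (move x (end v₀ u)) w′ ≡ move x (end v₀ u)
    end≡ = trans (sym (end-++ v₀ u (x ∷ w′))) (trans (cong (end v₀) (sym (cong proj₁ e″))) R.end-new)
    y≢x : x ≢ y
    y≢x x≡y = Lolly.free L (trans (lastColour-++ zero u x w′)
        (trans (cong (lastColour x) (no-loop v₀ u x w′ (Lolly.distinct L) end≡)) x≡y))

  -- Makes the states finite for the pigeonhole principle. Hamiltonian paths have a common length,
  -- so on them the code is faithful.
  encode : ∀ k → List Colour → Fin (3 ^ k)
  encode zero _ = zero
  encode (suc k) [] = combine {3} zero (encode k [])
  encode (suc k) (c ∷ w) = combine c (encode k w)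

  encode-injective : ∀ k {u w} → length u ≡ k → length w ≡ k → encode k u ≡ encode k w → u ≡ w
  encode-injective zero {[]} {[]} _ _ _ = refl
  encode-injective (suc k) {c ∷ u} {d ∷ w} p q e with Finₚ.combine-injective c (encode k u) d (encode k w) e
  ... | refl , e′ = cong (c ∷_) (encode-injective k (suc-injective p) (suc-injective q) e′)

  module _ (k : ℕ) (all-length : ∀ {w} → Unique (trace v₀ w) → (∀ v → v ∈ trace v₀ w) → length w ≡ k) where

    private
      code : State → Fin (3 ^ suc k)
      code (w , y) = encode (suc k) (y ∷ w)

      lolly-length : ∀ {s} → Lolly s → length (proj₁ s) ≡ k
      lolly-length L = all-length (Lolly.distinct L) (Lolly.full L)

      code-injective : ∀ {s t} → Lolly s → Lolly t → code s ≡ code t → s ≡ t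
      code-injective {u , x} {w , y} L M e = cong₂ _,_ (∷-injectiveʳ same) (∷-injectiveˡ same)
        where
        same : x ∷ u ≡ y ∷ w
        same = encode-injective (suc k) {x ∷ u} {y ∷ w} (cong suc (lolly-length L))
            (cong suc (lolly-length M)) e

      closed⇒α-fixed : ∀ s → target s ≡ v₀ → α s ≡ s
      closed⇒α-fixed s e with target s ≟ v₀
      ... | yes _ = refl
      ... | no z≢v₀ = contradiction e z≢v₀

    anotherCycle : ∀ s₀ → Lolly s₀ → target s₀ ≡ v₀ → ∃[ s ] (Lolly s × target s ≡ v₀ × s ≢ s₀)
    anotherCycle s₀ L₀ closed = proj₁ found , proj₁ (proj₂ found) ,
        α-fixed⇒closed (proj₁ (proj₂ found)) (proj₁ (proj₂ (proj₂ found))) , proj₂ (proj₂ (proj₂ found))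
      where
      found : ∃[ s ] (Lolly s × α s ≡ s × s ≢ s₀)
      found = anotherFixedPoint Lolly α β (λ L → proj₁ (α-lolly-involutive L)) β-lolly
        (λ L → proj₂ (α-lolly-involutive L)) β-involutive β-fixes-none
            (Productₚ.≡-dec (≡-dec Finₚ._≟_) Finₚ._≟_)
        code code-injective s₀ L₀ (closed⇒α-fixed s₀ closed)

-- The coloured cubic multigraph of one column

length-cartesianProduct : ∀ {A B : Set} (xs : List A) (ys : List B) →
                          length (cartesianProduct xs ys) ≡ length xs * length ys
length-cartesianProduct [] ys = refl
length-cartesianProduct (x ∷ xs) ys = trans (length-++ (map (x ,_) ys))
  (cong₂ _+_ (length-map (x ,_) ys) (length-cartesianProduct xs ys))

enumerations-length : ∀ {A : Set} {xs ys : List A} → Unique xs → Unique ys →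
                      (∀ x → x ∈ xs) → (∀ x → x ∈ ys) → length xs ≡ length ys
enumerations-length xs! ys! xs-all ys-all =
  ↭-length (∼bag⇒↭ (unique∧set⇒bag xs! ys! (mk⇔ (λ _ → ys-all _) (λ _ → xs-all _))))

parity-cong : ∀ {a b} → + a ≋ + b [ 2 ] → parity a ≡ parity b
parity-cong {a} {b} p with parity a in ea | parity b in eb
... | 0ℙ | 0ℙ = refl
... | 1ℙ | 1ℙ = refl
... | 1ℙ | 0ℙ = contradiction (trans (sym eb) (≋1⇒odd b (≋-trans (≋-sym p) (odd⇒≋1 a ea)))) λ ()
... | 0ℙ | 1ℙ = contradiction (trans (sym ea) (≋1⇒odd a (≋-trans p (odd⇒≋1 b eb)))) λ ()

parity-suc⁻¹ : ∀ t → parity (suc t) ≡ parity t ⁻¹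
parity-suc⁻¹ 0 = refl
parity-suc⁻¹ 1 = refl
parity-suc⁻¹ (suc (suc t)) = parity-suc⁻¹ t

∈-ascent⁺ : ∀ {V : Set} (f : ℕ → V) s k {t} → s ≤ t → t ≤ s + k → f t ∈ ascent f s k
∈-ascent⁺ f s zero p q = here (cong f (≤-antisym (subst (_ ≤_) (+-identityʳ s) q) p))
∈-ascent⁺ f s (suc k) {t} p q with m≤n⇒m<n∨m≡n p
... | inj₁ s<t = there (∈-ascent⁺ f (suc s) k s<t (subst (t ≤_) (+-suc s k) q))
... | inj₂ refl = here refl

module Rows (n : ℕ) .{{_ : NonZero n}} (ℓ : ℤ) (2∣n : 2 ℕ.∣ n) (ℓ-odd : ℓ ≋ + 1 [ 2 ]) where

  open Residues n

  ρ : ℕ → Fin n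
  ρ t = ν (+ t)

  par : Fin n → Parity
  par v = parity (toℕ v)

  par-ρ : ∀ t → par (ρ t) ≡ parity t
  par-ρ t = parity-cong (≋-weaken 2∣n (⟦ν⟧ (+ t)))

  ρ-toℕ : ∀ v → ρ (toℕ v) ≡ v
  ρ-toℕ v = ν-⟦⟧ v

  -- Vertical edges alternate between the first two colours, and jumps have the third. With `n` even
  -- and `ℓ` odd every edge changes the parity of the row, so the sign reverses at its other end.
  dir : Colour → Parity → ℤ
  dir zero 1ℙ = + 1
  dir zero 0ℙ = - + 1
  dir (suc zero) 1ℙ = - + 1
  dir (suc zero) 0ℙ = + 1
  dir (suc (suc zero)) 1ℙ = ℓ
  dir (suc (suc zero)) 0ℙ = - ℓ

  -1≋1 : - + 1 ≋ + 1 [ 2 ]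
  -1≋1 = multiple (- + 1) refl

  dir-odd : ∀ c p → dir c p ≋ + 1 [ 2 ]
  dir-odd zero 1ℙ = ≋-refl
  dir-odd zero 0ℙ = -1≋1
  dir-odd (suc zero) 1ℙ = -1≋1
  dir-odd (suc zero) 0ℙ = ≋-refl
  dir-odd (suc (suc zero)) 1ℙ = ℓ-odd
  dir-odd (suc (suc zero)) 0ℙ = ≋-trans (≋-neg ℓ-odd) -1≋1

  dir-opposite : ∀ c p → dir c (p ⁻¹) ≡ - dir c p
  dir-opposite zero 1ℙ = refl
  dir-opposite zero 0ℙ = refl
  dir-opposite (suc zero) 1ℙ = refl
  dir-opposite (suc zero) 0ℙ = refl
  dir-opposite (suc (suc zero)) 1ℙ = refl
  dir-opposite (suc (suc zero)) 0ℙ = sym (ℤₚ.neg-involutive ℓ)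

  move : Colour → Fin n → Fin n
  move c v = ν (⟦ v ⟧ ℤ.+ dir c (par v))

  par-move : ∀ c v → par (move c v) ≡ par v ⁻¹
  par-move c v = trans (parity-cong (≋-trans (≋-weaken 2∣n (⟦ν⟧ (⟦ v ⟧ ℤ.+ dir c (par v))))
    (≋-trans (≋-+ (≋-refl {⟦ v ⟧}) (dir-odd c (par v))) (≋-reflexive (cong +_ (+-comm (toℕ v) 1))))))
        (parity-suc⁻¹ (toℕ v))

  move-involutive : ∀ c v → move c (move c v) ≡ v
  move-involutive c v = ⟦⟧-injective (≋-trans (⟦ν⟧ _) (≋-trans (≋-+ (⟦ν⟧ (⟦ v ⟧ ℤ.+ dir c (par v)))
      (≋-reflexive (trans (cong (dir c) (par-move c v)) (dir-opposite c (par v)))))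
          (≋-reflexive (cancel ⟦ v ⟧ (dir c (par v))))))
    where
    cancel : ∀ a b → a ℤ.+ b ℤ.+ - b ≡ a
    cancel = ℤ-solve-∀

  move-≢ : ∀ c v → move c v ≢ v
  move-≢ c v e = p⁻¹≢p (par v) (trans (sym (par-move c v)) (cong par e))
    where
    p⁻¹≢p : ∀ p → p ⁻¹ ≢ p
    p⁻¹≢p 0ℙ ()
    p⁻¹≢p 1ℙ ()

  open Lollipop _≟ᶠ_ move move-involutive move-≢ (ρ 1) public

  upward : Parity → Colour
  upward 1ℙ = zero
  upward 0ℙ = suc zero

  dir-upward : ∀ p → dir (upward p) p ≡ + 1
  dir-upward 0ℙ = refl
  dir-upward 1ℙ = refl

  move-upward : ∀ t → move (upward (parity t)) (ρ t) ≡ ρ (suc t)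
  move-upward t = ν-cong (≋-trans (≋-+ (⟦ν⟧ (+ t)) (≋-reflexive
      (trans (cong (dir (upward (parity t))) (par-ρ t)) (dir-upward (parity t)))))
    (≋-reflexive (cong +_ (+-comm t 1))))

  climbing : ℕ → ℕ → List Colour
  climbing t zero = []
  climbing t (suc k) = upward (parity t) ∷ climbing (suc t) k

  trace-climbing : ∀ t k → trace (ρ t) (climbing t k) ≡ ascent ρ t k
  trace-climbing t zero = refl
  trace-climbing t (suc k) = cong (ρ t ∷_)
      (trans (cong (λ v → trace v (climbing (suc t) k)) (move-upward t)) (trace-climbing (suc t) k))

  end-climbing : ∀ t k → end (ρ t) (climbing t k) ≡ ρ (t + k)
  end-climbing t zero = cong ρ (sym (+-identityʳ t))
  end-climbing t (suc k) = trans (cong (λ v → end v (climbing (suc t) k)) (move-upward t))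
    (trans (end-climbing (suc t) k) (cong ρ (sym (+-suc t k))))

  last-climbing : ∀ c t k → lastColour c (climbing t (suc k)) ≡ upward (parity (t + k))
  last-climbing c t zero = cong (upward ∘ parity) (sym (+-identityʳ t))
  last-climbing c t (suc k) = trans (last-climbing (upward (parity t)) (suc t) k)
      (cong (upward ∘ parity) (sym (+-suc t k)))

  other-upward : ∀ p c → c ≢ suc (suc zero) → c ≢ upward p → c ≡ upward (p ⁻¹)
  other-upward 0ℙ zero _ _ = refl
  other-upward 0ℙ (suc zero) _ k≢ = contradiction refl k≢
  other-upward 1ℙ zero _ k≢ = contradiction refl k≢
  other-upward 1ℙ (suc zero) _ _ = refl
  other-upward _ (suc (suc zero)) k≢ _ = contradiction refl k≢

  -- Consecutive colours differ, with one colour counted before the word and one after it. Taking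
  -- the closing colour for both makes this cyclic.
  data Reduced : Colour → List Colour → Colour → Set where
    []  : ∀ {a y} → a ≢ y → Reduced a [] y
    _∷_ : ∀ {a c w y} → a ≢ c → Reduced c w y → Reduced a (c ∷ w) y

  unique⇒reduced : ∀ v c w y → Unique (trace v (c ∷ w)) → lastColour c w ≢ y → Reduced c w y
  unique⇒reduced v c [] y _ last≢ = [] last≢
  unique⇒reduced v c (d ∷ w) y (v∉ ∷ t!) last≢ = c≢d ∷ unique⇒reduced (move c v) d w y t! last≢
    where
    start-∈ : ∀ v w → v ∈ trace v w
    start-∈ v [] = here refl
    start-∈ v (_ ∷ _) = here refl
    c≢d : c ≢ d
    c≢d refl = All¬⇒¬Any v∉ (there (subst (_∈ trace (move c (move c v)) w) (move-involutive c v) (start-∈ _ w)))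

  two : Colour
  two = suc (suc zero)

  -- Without jumps, each vertex offers a single colour other than the one of arrival, so a walk that
  -- climbs goes on climbing.
  unjumped : ∀ t w y → Reduced (upward (parity t)) w y → two ∉ w → y ≢ two →
             w ≡ climbing (suc t) (length w) × y ≡ upward (parity (suc t + length w))
  unjumped t [] y ([] t≢y) _ y≢2 = refl , trans (other-upward (parity t) y y≢2 (≢-sym t≢y))
    (cong upward (trans (sym (parity-suc⁻¹ t)) (cong parity (cong suc (sym (+-identityʳ t))))))
  unjumped t (c ∷ w) y (t≢c ∷ r) 2∉ y≢2
    with trans (other-upward (parity t) c (λ e → 2∉ (here (sym e))) (≢-sym t≢c))
        (cong upward (sym (parity-suc⁻¹ t)))
  ... | refl with unjumped (suc t) w y r (2∉ ∘ there) y≢2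
  ... | e , e′ = cong (_ ∷_) e , trans e′ (cong (upward ∘ parity) (cong suc (sym (+-suc t (length w)))))

  record JumpingCycle : Set where
    field
      word     : List Colour
      last     : Colour
      reduced  : Reduced last word last
      distinct : Unique (trace (ρ 1) word)
      full     : ∀ v → v ∈ trace (ρ 1) word
      closes   : move last (end (ρ 1) word) ≡ ρ 1
      jumps    : two ∈ last ∷ word

  module _ (k : ℕ) (n≡ : n ≡ 2 + k) (k-even : parity k ≡ 0ℙ) (k≢0 : k ≢ 0) where

    columnLolly : Lolly (climbing 1 (suc k) , suc zero)
    columnLolly = record
      { starts = refl
      ; distinct = subst Unique (sym (trace-climbing 1 (suc k))) (ascent-unique ρ 1 (suc k) λ {s} {t} p q r →
          ν-window q (≤-<-trans (≤-trans r (≤-reflexive (sym n≡))) (+-monoˡ-≤ n p)))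
      ; full = λ v → subst (v ∈_) (sym (trace-climbing 1 (suc k))) (everywhere v)
      ; free = λ e → 0≢1 (trans (sym
          (trans (last-climbing zero 1 k) (cong upward (trans (parity-suc⁻¹ k) (cong _⁻¹ k-even))))) e)
      }
      where
      0≢1 : _≢_ {A = Colour} zero (suc zero)
      0≢1 ()
      everywhere : ∀ v → v ∈ ascent ρ 1 (suc k)
      everywhere v with toℕ v in e
      ... | suc t = subst (_∈ ascent ρ 1 (suc k)) (trans (cong ρ (sym e)) (ρ-toℕ v))
              (∈-ascent⁺ ρ 1 (suc k) (s≤s z≤n)
                  (≤-trans (≤-reflexive (sym e)) (<⇒≤ (≤-trans (toℕ<n v) (≤-reflexive n≡)))))
      ... | zero = subst (_∈ ascent ρ 1 (suc k))
          (trans (cong ρ (sym n≡)) (trans (ν-periodic (+ 0)) (trans (cong ρ (sym e)) (ρ-toℕ v))))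
              (∈-ascent⁺ ρ 1 (suc k) (s≤s z≤n) ≤-refl)

    columnLolly-closes : target (climbing 1 (suc k) , suc zero) ≡ ρ 1
    columnLolly-closes = trans (cong (move (suc zero)) (end-climbing 1 (suc k)))
      (trans (cong (λ p → move (upward p) (ρ (2 + k))) (sym k-even)) (trans (move-upward (2 + k))
        (trans (cong (ρ ∘ suc) (sym n≡)) (ν-periodic (+ 1)))))

    word-length : ∀ {w} → Unique (trace (ρ 1) w) → (∀ v → v ∈ trace (ρ 1) w) → length w ≡ suc k
    word-length {w} t! full = suc-injective (trans (sym (length-trace (ρ 1) w))
      (trans (enumerations-length t! (Uniqueₚ.allFin⁺ n) full ∈-allFin) (trans (length-tabulate (λ i → i)) n≡)))

    jumping : ∀ {s} → Lolly s → s ≢ (climbing 1 (suc k) , suc zero) → two ∈ proj₂ s ∷ proj₁ s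
    jumping {w , y} (lolly {tail} refl distinct full free) s≢ = go (any? (two ≟ᶠ_) (y ∷ w))
      where
      l : length w ≡ suc k
      l = word-length {w} distinct full
      go : Dec (two ∈ y ∷ w) → two ∈ y ∷ w
      go (yes 2∈) = 2∈
      go (no 2∉) = contradiction (cong₂ _,_ (trans (proj₁ climbs) (cong (climbing 1) l))
          (trans (proj₂ climbs) (cong upward (trans (cong (parity ∘ suc) l) k-even)))) s≢
        where
        climbs : w ≡ climbing 1 (length w) × y ≡ upward (parity (1 + length w))
        -- The walk is treated as if it had reached the row 1 from the row 0.
        climbs = unjumped 0 w y ((λ ()) ∷ unique⇒reduced (ρ 1) zero tail y distinct free) (2∉ ∘ there)
            (λ e → 2∉ (here (sym e)))

    fromLolly : ∀ {s} → Lolly s → target s ≡ ρ 1 → s ≢ (climbing 1 (suc k) , suc zero) → JumpingCycle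
    fromLolly {w , y} L@(lolly {tail} refl distinct full free) closes s≢ = record
      { word = w ; last = y
      ; reduced = y≢0 ∷ unique⇒reduced (ρ 1) zero tail y distinct free
      ; distinct = distinct ; full = full ; closes = closes ; jumps = jumping L s≢ }
      where
      -- Closing along the first edge would give a cycle of length 2, which `k≢0` forbids.
      y≢0 : y ≢ zero
      y≢0 refl = k≢0 (suc-injective (trans (sym (word-length {zero ∷ tail} distinct full)) (cong (suc ∘ length)
        (no-loop (ρ 1) [] zero tail distinct
            (trans (sym (move-involutive zero _)) (cong (move zero) closes))))))

    jumpingCycle : JumpingCycle
    jumpingCycle = fromLolly (proj₁ (proj₂ another)) (proj₁ (proj₂ (proj₂ another)))
        (proj₂ (proj₂ (proj₂ another)))
      where
      another : ∃[ s ] (Lolly s × target s ≡ ρ 1 × s ≢ (climbing 1 (suc k) , suc zero))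
      another = anotherCycle (suc k) word-length (climbing 1 (suc k) , suc zero) columnLolly columnLolly-closes

-- Hamiltonian cycles in several columns

module Expansion (q n : ℕ) .{{_ : NonZero n}} (ℓ : ℤ) (2∣n : 2 ℕ.∣ n) (ℓ-odd : ℓ ≋ + 1 [ 2 ]) where

  top m : ℕ
  top = double (suc q)
  m = suc top

  open Rows n ℓ 2∣n ℓ-odd
  open Torus m n ℓ 2∣n
  open DecMembership (_≟ᶠ_ {n}) using (_∈?_)

  data Kind : Set where
    plain leaving entering : Kind

  kindOf : ∀ {A B : Set} → Parity → Dec A → Dec B → Kind
  kindOf 0ℙ _ _ = plain
  kindOf 1ℙ _ (yes _) = leaving
  kindOf 1ℙ (yes _) (no _) = entering
  kindOf 1ℙ (no _) (no _) = plain

  -- Colour two is the crossing edge, which leaves column 0 at odd rows; the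
  -- detour through the columns 1, …, m - 1 is attached to its odd end.
  kind : Colour → Fin n → Colour → Kind
  kind a v b = kindOf (par v) (a ≟ᶠ two) (b ≟ᶠ two)

  kind-even : ∀ a v b → par v ≡ 0ℙ → kind a v b ≡ plain
  kind-even a v b e rewrite e = refl

  kind-leaving : ∀ a v → par v ≡ 1ℙ → kind a v two ≡ leaving
  kind-leaving a v e rewrite e = refl

  kind-entering : ∀ v b → par v ≡ 1ℙ → b ≢ two → kind two v b ≡ entering
  kind-entering v b e b≢ rewrite e with b ≟ᶠ two
  ... | yes p = contradiction p b≢
  ... | no _ = refl

  kind-odd : ∀ a v b → kind a v b ≢ plain → par v ≡ 1ℙ
  kind-odd a v b k≢ with par v
  ... | 1ℙ = refl
  ... | 0ℙ = contradiction refl k≢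

  kind-≢leaving : ∀ a v b → b ≢ two → kind a v b ≢ leaving
  kind-≢leaving a v b b≢ e with par v | a ≟ᶠ two | b ≟ᶠ two
  ... | 1ℙ | _ | yes p = b≢ p
  kind-≢leaving a v b b≢ () | 1ℙ | yes _ | no _
  kind-≢leaving a v b b≢ () | 1ℙ | no _ | no _
  kind-≢leaving a v b b≢ () | 0ℙ | _ | _

  kind-≢entering : ∀ a v b → a ≢ two → kind a v b ≢ entering
  kind-≢entering a v b a≢ e with par v | a ≟ᶠ two | b ≟ᶠ two
  ... | 1ℙ | yes p | no _ = a≢ p
  kind-≢entering a v b a≢ () | 1ℙ | _ | yes _
  kind-≢entering a v b a≢ () | 1ℙ | no _ | no _
  kind-≢entering a v b a≢ () | 0ℙ | _ | _

  mark : Kind → Fin n → List (Fin n)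
  mark plain v = []
  mark leaving v = v ∷ []
  mark entering v = v ∷ []

  mark-∈ : ∀ k {v r} → r ∈ mark k v → r ≡ v × k ≢ plain
  mark-∈ leaving (here e) = e , λ ()
  mark-∈ entering (here e) = e , λ ()

  marks : Colour → Fin n → List Colour → Colour → List (Fin n)
  marks a v [] y = mark (kind a v y) v
  marks a v (c ∷ w) y = mark (kind a v c) v ++ marks c (move c v) w y

  marks-odd : ∀ a v w y {r} → r ∈ marks a v w y → par r ≡ 1ℙ
  marks-odd a v [] y r∈ with mark-∈ (kind a v y) r∈
  ... | refl , k≢ = kind-odd a v y k≢
  marks-odd a v (c ∷ w) y r∈ with ∈-++⁻ (mark (kind a v c) v) r∈
  ... | inj₂ r∈′ = marks-odd c (move c v) w y r∈′
  ... | inj₁ r∈′ with mark-∈ (kind a v c) r∈′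
  ... | refl , k≢ = kind-odd a v c k≢

  marked-after-jump : ∀ v w y → par v ≡ 1ℙ → v ∈ marks two v w y
  marked-after-jump v w y odd = first w
    where
    here-marked : ∀ b → v ∈ mark (kind two v b) v
    here-marked b rewrite odd with b ≟ᶠ two
    ... | yes _ = here refl
    ... | no _ = here refl
    first : ∀ w → v ∈ marks two v w y
    first [] = here-marked y
    first (c ∷ w) = ∈-++⁺ˡ (here-marked c)

  odd-or-even : ∀ p → p ≡ 1ℙ ⊎ p ≡ 0ℙ
  odd-or-even 0ℙ = inj₂ refl
  odd-or-even 1ℙ = inj₁ refl

  jump-marked : ∀ a v w y → two ∈ w → ∃[ r ] r ∈ marks a v w y
  jump-marked a v (c ∷ w) y (here refl) with odd-or-even (par v)
  ... | inj₁ odd = v , ∈-++⁺ˡ (subst (λ k → v ∈ mark k v) (sym (kind-leaving a v odd)) (here refl))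
  ... | inj₂ even = move two v , ∈-++⁺ʳ (mark (kind a v two) v)
          (marked-after-jump (move two v) w y (trans (par-move two v) (cong _⁻¹ even)))
  jump-marked a v (c ∷ w) y (there 2∈) with jump-marked c (move c v) w y 2∈
  ... | r , r∈ = r , ∈-++⁺ʳ (mark (kind a v c) v) r∈

  ρ-cancel : ∀ a b {d} → ρ (a + d) ≡ ρ (b + d) → ρ a ≡ ρ b
  ρ-cancel a b {d} e = ν-cong (subst₂ (_≋_[ n ]) (cancel (+ a) (+ d)) (cancel (+ b) (+ d))
    (≋-+ (ν-injective {z = + (a + d)} {z′ = + (b + d)} e) (≋-refl { - + d})))
    where
    cancel : ∀ a d → a ℤ.+ d ℤ.+ - d ≡ a
    cancel = ℤ-solve-∀

  ρ-+ : ∀ {a b} d → ρ a ≡ ρ b → ρ (a + d) ≡ ρ (b + d)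
  ρ-+ {a} {b} d e = ν-cong (≋-+ (ν-injective {z = + a} {z′ = + b} e) (≋-refl {+ d}))

  -- M stands for the odd rows at which the cycle crosses to column 1.
  module Runs (M : List (Fin n)) (M-odd : ∀ {r} → r ∈ M → par r ≡ 1ℙ) (origin : Fin n)
      (origin∈M : origin ∈ M) where

    height : ℕ → ℕ → ℕ
    height zero t = 0
    height (suc f) t with ρ (suc t) ∈? M
    ... | yes _ = 0
    ... | no _ = suc (height f (suc t))

    height-≤ : ∀ f t → height f t ≤ f
    height-≤ zero t = z≤n
    height-≤ (suc f) t with ρ (suc t) ∈? M
    ... | yes _ = z≤n
    ... | no _ = s≤s (height-≤ f (suc t))

    height-clear : ∀ f t i → 0 < i → i ≤ height f t → ρ (t + i) ∉ M
    height-clear zero t (suc i) _ ()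
    height-clear (suc f) t i 0<i i≤ with ρ (suc t) ∈? M
    height-clear (suc f) t (suc i) 0<i () | yes _
    height-clear (suc f) t (suc zero) 0<i (s≤s i≤) | no ∉M = subst (λ x → ρ x ∉ M) (+-comm 1 t) ∉M
    height-clear (suc f) t (suc (suc i)) 0<i (s≤s i≤) | no ∉M =
      subst (λ x → ρ x ∉ M) (sym (+-suc t (suc i))) (height-clear f (suc t) (suc i) (s≤s z≤n) i≤)

    height-hits : ∀ f t j → j ≤ f → ρ (suc t + j) ∈ M → ρ (suc (t + height f t)) ∈ M
    height-hits zero t zero z≤n p = p
    height-hits (suc f) t j j≤ p with ρ (suc t) ∈? M
    ... | yes ∈M = subst (λ x → ρ (suc x) ∈ M) (sym (+-identityʳ t)) ∈M
    height-hits (suc f) t zero j≤ p | no ∉M = contradiction (subst (λ x → ρ (suc x) ∈ M) (+-identityʳ t) p) ∉M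
    height-hits (suc f) t (suc j) (s≤s j≤) p | no ∉M = subst (λ x → ρ (suc x) ∈ M)
        (sym (+-suc t (height f (suc t))))
      (height-hits f (suc t) j j≤ (subst (λ x → ρ x ∈ M) (cong suc (+-suc t j)) p))

    h : Fin n → ℕ
    h v = height (pred n) (toℕ v)

    h<n : ∀ v → h v < n
    h<n v = ≤-<-trans (height-≤ (pred n) (toℕ v)) (≤-reflexive (suc-pred n))

    -- The fuel `pred n` suffices, for the row `n` steps above `v` is the marked row `v` itself.
    next-marked : ∀ {v} → v ∈ M → ρ (suc (toℕ v + h v)) ∈ M
    next-marked {v} v∈M = height-hits (pred n) (toℕ v) (pred n) ≤-refl (subst (_∈ M) (sym around) v∈M)
      where
      around : ρ (suc (toℕ v) + pred n) ≡ v
      around = trans (cong ρ (trans (sym (+-suc (toℕ v) (pred n))) (cong (λ x → toℕ v + x) (suc-pred n))))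
        (trans (ν-periodic (+ toℕ v)) (ρ-toℕ v))

    -- The rows of v and above, up to the next marked row.
    run : Fin n → List (Fin n)
    run v = ascent ρ (toℕ v) (h v)

    run-unique : ∀ v → Unique (run v)
    run-unique v = ascent-unique ρ (toℕ v) (h v) λ {s} {t} p q r →
      ν-window q (≤-<-trans r (<-≤-trans (+-monoʳ-< (toℕ v) (h<n v)) (+-monoˡ-≤ n p)))

    -- Cancelling `d` on both sides puts the marked row `v` into the run of `v′`, and above its
    -- start that run has no marked rows.
    own-≤ : ∀ {v v′ d d′} → v ∈ M → d ≤ d′ → d′ ≤ h v′ → ρ (toℕ v + d) ≡ ρ (toℕ v′ + d′) → v ≡ v′
    own-≤ {v} {v′} {d} v∈M d≤d′ d′≤ e with m≤n⇒∃[o]m+o≡n d≤d′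
    ... | zero , refl = trans (sym (ρ-toℕ v))
        (trans (ρ-cancel (toℕ v) (toℕ v′) (trans e (cong (λ x → ρ (toℕ v′ + x)) (+-identityʳ d)))) (ρ-toℕ v′))
    ... | suc o , refl = contradiction (subst (_∈ M) (trans (sym (ρ-toℕ v)) shifted) v∈M)
          (height-clear (pred n) (toℕ v′) (suc o) (s≤s z≤n) (≤-trans (m≤n+m (suc o) d) d′≤))
      where
      shifted : ρ (toℕ v) ≡ ρ (toℕ v′ + suc o)
      shifted = ρ-cancel (toℕ v) (toℕ v′ + suc o)
          (trans e (cong ρ (trans (cong (λ x → toℕ v′ + x) (+-comm d (suc o)))
              (sym (+-assoc (toℕ v′) (suc o) d)))))

    run-disjoint : ∀ {v v′ r} → v ∈ M → v′ ∈ M → r ∈ run v → r ∈ run v′ → v ≡ v′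
    run-disjoint {v} {v′} v∈M v′∈M r∈ r∈′ with ∈-ascent⁻ ρ (toℕ v) (h v) r∈ | ∈-ascent⁻ ρ (toℕ v′) (h v′) r∈′
    ... | t , p , q , refl | t′ , p′ , q′ , e with m≤n⇒∃[o]m+o≡n p | m≤n⇒∃[o]m+o≡n p′
    ... | d , refl | d′ , refl with ≤-total d d′
    ... | inj₁ d≤d′ = own-≤ v∈M d≤d′ (+-cancelˡ-≤ (toℕ v′) d′ (h v′) q′) e
    ... | inj₂ d′≤d = sym (own-≤ v′∈M d′≤d (+-cancelˡ-≤ (toℕ v) d (h v) q) (sym e))

    -- Climbing from a marked row, one either stays in the current run or starts the next. This is
    -- where at least one jump is needed.
    cover : ∀ k → ∃[ v ] (v ∈ M × (∃[ i ] (i ≤ h v × ρ (toℕ origin + k) ≡ ρ (toℕ v + i))))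
    cover zero = origin , origin∈M , 0 , z≤n , refl
    cover (suc k) with cover k
    ... | v , v∈M , i , i≤h , e with m≤n⇒m<n∨m≡n i≤h | next
      where
      next : ρ (toℕ origin + suc k) ≡ ρ (suc (toℕ v + i))
      next = trans (cong ρ (trans (+-suc (toℕ origin) k) (+-comm 1 (toℕ origin + k))))
          (trans (ρ-+ 1 e) (cong ρ (+-comm (toℕ v + i) 1)))
    ... | inj₁ i<h | e′ = v , v∈M , suc i , i<h , trans e′ (cong ρ (sym (+-suc (toℕ v) i)))
    ... | inj₂ refl | e′ = ρ (suc (toℕ v + h v)) , next-marked v∈M , 0 , z≤n ,
          trans e′ (trans (sym (ρ-toℕ _)) (cong ρ (sym (+-identityʳ _))))

    covering : ∀ r → ∃[ v ] (v ∈ M × r ∈ run v)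
    covering r with cover (toℕ r + (n ∸ toℕ origin))
    ... | v , v∈M , i , i≤h , e = v , v∈M , subst (_∈ run v) (trans (sym e) around)
        (∈-ascent⁺ ρ (toℕ v) (h v) (m≤m+n (toℕ v) i) (+-monoʳ-≤ (toℕ v) i≤h))
      where
      around : ρ (toℕ origin + (toℕ r + (n ∸ toℕ origin))) ≡ r
      around = trans (cong ρ (trans (+-comm (toℕ origin) _)
          (trans (+-assoc (toℕ r) (n ∸ toℕ origin) (toℕ origin))
          (cong (λ x → toℕ r + x) (m∸n+n≡m (<⇒≤ (toℕ<n origin)))))))
        (trans (ν-periodic (+ toℕ r)) (ρ-toℕ r))

    -- Up one column and down the next, so that every pair of columns brings the path back to the
    -- row `v`.
    slab : ℕ → Fin n → List (Vertex m n)
    slab c v = map (col c ,_) (run v) ++ map (col (suc c) ,_) (reverse (run v))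

    slabs : ℕ → ℕ → Fin n → List (Vertex m n)
    slabs c zero v = slab c v
    slabs c (suc k) v = slab c v ++ slabs (2 + c) k v

    run-walk : ∀ i v → Walk (λ r s → (i , r) ~ (i , s)) v (ρ (toℕ v + h v)) (run v)
    run-walk i v = subst (λ u → Walk (λ r s → (i , r) ~ (i , s)) u (ρ (toℕ v + h v)) (run v)) (ρ-toℕ v)
      (ascent-walk ρ row-edge (toℕ v) (h v))

    odd-row : ∀ {v} → v ∈ M → + toℕ v ≋ + 1 [ 2 ]
    odd-row v∈M = odd⇒≋1 _ (M-odd v∈M)

    flat-right : ∀ {c v} → v ∈ M → suc c < m → parity c ≡ 0ℙ → (col c , v) ~ (col (suc c) , v)
    flat-right {c} {v} v∈M c< even = subst (λ r → (col c , r) ~ (col (suc c) , r)) (ρ-toℕ v)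
      (flat-edge (+ toℕ v) c< (≋-+ (even⇒≋0 c even) (odd-row v∈M)))

    -- The row above the run is marked, hence odd; so the run ends at an even row, where odd columns
    -- have their flat edges to the right.
    flat-top : ∀ {c v} → v ∈ M → suc c < m → parity c ≡ 1ℙ →
               (col c , ρ (toℕ v + h v)) ~ (col (suc c) , ρ (toℕ v + h v))
    flat-top {c} {v} v∈M c< odd = flat-edge (+ t) c< (≋-+ (odd⇒≋1 c odd) (even⇒≋0 t even))
      where
      t = toℕ v + h v
      even : parity t ≡ 0ℙ
      even with parity t in e
      ... | 0ℙ = refl
      ... | 1ℙ = contradiction (trans (sym (trans (parity-suc⁻¹ t) (cong _⁻¹ e)))
            (trans (sym (par-ρ (suc t))) (M-odd (next-marked v∈M)))) λ ()

    slab-walk : ∀ {c v} → v ∈ M → suc c < m → parity c ≡ 1ℙ → Walk _~_ (col c , v) (col (suc c) , v) (slab c v)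
    slab-walk {c} {v} v∈M c< odd = joinWalk _~_ (mapWalk (col c ,_) (run-walk (col c) v)) (flat-top v∈M c< odd)
      (mapWalk (col (suc c) ,_) (reverseWalk _ ~-sym (run-walk (col (suc c)) v)))

    slabs-walk : ∀ {c v} k → v ∈ M → suc (c + double k) < m → parity c ≡ 1ℙ →
                 Walk _~_ (col c , v) (col (suc (c + double k)) , v) (slabs c k v)
    slabs-walk {c} {v} zero v∈M c< odd = subst (λ x → Walk _~_ (col c , v) (col (suc x) , v) (slab c v))
        (sym (+-identityʳ c))
      (slab-walk v∈M (subst (λ x → suc x < m) (+-identityʳ c) c<) odd)
    slabs-walk {c} {v} (suc k) v∈M c< odd = joinWalk _~_ (slab-walk v∈M (≤-trans (n≤1+n _) c₂<) odd)
      (flat-right v∈M c₂< (trans (parity-suc⁻¹ c) (cong _⁻¹ odd)))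
      (subst (λ x → Walk _~_ (col (2 + c) , v) (col (suc x) , v) (slabs (2 + c) k v)) (sym shift)
        (slabs-walk k v∈M (subst (λ x → suc x < m) shift c<) odd))
      where
      shift : c + double (suc k) ≡ 2 + c + double k
      shift = trans (+-suc c (suc (double k))) (cong suc (+-suc c (double k)))
      c₂< : 2 + c < m
      c₂< = ≤-trans (s≤s (s≤s (≤-trans (m≤m+n (suc c) (double k)) (n≤1+n _))))
          (subst (λ x → suc x < m) shift c<)

    ∈-slab⁻ : ∀ c v {x} → x ∈ slab c v → ∃[ c′ ] (c ≤ c′ × c′ ≤ suc c × proj₁ x ≡ col c′ × proj₂ x ∈ run v)
    ∈-slab⁻ c v x∈ with ∈-++⁻ (map (col c ,_) (run v)) x∈
    ... | inj₁ p with ∈-map⁻ (col c ,_) p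
    ... | r , r∈ , refl = c , ≤-refl , n≤1+n c , refl , r∈
    ∈-slab⁻ c v x∈ | inj₂ p with ∈-map⁻ (col (suc c) ,_) p
    ... | r , r∈ , refl = suc c , n≤1+n c , ≤-refl , refl , ∈-resp-↭ (↭-reverse (run v)) r∈

    ∈-slabs⁻ : ∀ c k v {x} → x ∈ slabs c k v → ∃[ c′ ]
        (c ≤ c′ × c′ ≤ suc (c + double k) × proj₁ x ≡ col c′ × proj₂ x ∈ run v)
    ∈-slabs⁻ c zero v x∈ with ∈-slab⁻ c v x∈
    ... | c′ , p , q , r = c′ , p , ≤-trans q (s≤s (m≤m+n c 0)) , r
    ∈-slabs⁻ c (suc k) v x∈ with ∈-++⁻ (slab c v) x∈
    ... | inj₁ x∈′ with ∈-slab⁻ c v x∈′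
    ... | c′ , p , q , r = c′ , p , ≤-trans q (s≤s (m≤m+n c (double (suc k)))) , r
    ∈-slabs⁻ c (suc k) v x∈ | inj₂ x∈′ with ∈-slabs⁻ (2 + c) k v x∈′
    ... | c′ , p , q , r = c′ , ≤-trans (≤-trans (n≤1+n c) (n≤1+n _)) p ,
          ≤-trans q (≤-reflexive (cong suc
              (sym (trans (+-suc c (suc (double k))) (cong suc (+-suc c (double k))))))) , r

    ∈-slabs⁺ : ∀ c k v {c′ r} → r ∈ run v → c ≤ c′ → c′ ≤ suc (c + double k) → (col c′ , r) ∈ slabs c k v
    ∈-slabs⁺ c k v {c′} {r} r∈ c≤ c′≤ with m≤n⇒m<n∨m≡n c≤
    ... | inj₂ refl = first k (∈-++⁺ˡ (∈-map⁺ (col c ,_) r∈))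
      where
      first : ∀ k {x} → x ∈ slab c v → x ∈ slabs c k v
      first zero p = p
      first (suc k) p = ∈-++⁺ˡ p
    ... | inj₁ c<c′ with m≤n⇒m<n∨m≡n c<c′
    ... | inj₂ refl = first k (∈-++⁺ʳ (map (col c ,_) (run v))
        (∈-map⁺ (col (suc c) ,_) (∈-resp-↭ (↭-sym (↭-reverse (run v))) r∈)))
      where
      first : ∀ k {x} → x ∈ slab c v → x ∈ slabs c k v
      first zero p = p
      first (suc k) p = ∈-++⁺ˡ p
    ∈-slabs⁺ c zero v r∈ c≤ c′≤ | inj₁ c<c′ | inj₁ 2+c≤ =
      contradiction (≤-trans 2+c≤ (≤-trans c′≤ (s≤s (≤-reflexive (+-identityʳ c))))) (<⇒≱ ≤-refl)
    ∈-slabs⁺ c (suc k) v r∈ c≤ c′≤ | inj₁ c<c′ | inj₁ 2+c≤ = ∈-++⁺ʳ (slab c v) (∈-slabs⁺ (2 + c) k v r∈ 2+c≤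
      (≤-trans c′≤ (≤-reflexive (cong suc (trans (+-suc c (suc (double k))) (cong suc (+-suc c (double k))))))))

    slab-unique : ∀ c v → suc c < m → Unique (slab c v)
    slab-unique c v c< = Uniqueₚ.++⁺ (Uniqueₚ.map⁺ (cong proj₂) (run-unique v))
      (Uniqueₚ.map⁺ (cong proj₂) (reverse-unique (run-unique v))) apart
      where
      apart : ∀ {x} → ¬ (x ∈ map (col c ,_) (run v) × x ∈ map (col (suc c) ,_) (reverse (run v)))
      apart (p , q) with ∈-map⁻ (col c ,_) p | ∈-map⁻ (col (suc c) ,_) q
      ... | _ , _ , refl | _ , _ , e = <⇒≢ ≤-refl (toℕ-col-injective (<⇒≤ c<) c< (cong proj₁ e))

    slabs-unique : ∀ c k v → suc (c + double k) < m → Unique (slabs c k v)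
    slabs-unique c zero v c< = slab-unique c v (subst (λ x → suc x < m) (+-identityʳ c) c<)
    slabs-unique c (suc k) v c< = Uniqueₚ.++⁺ (slab-unique c v (≤-trans (s≤s (s≤s (m≤m+n c _))) c<))
        (slabs-unique (2 + c) k v c<′) apart
      where
      c<′ : suc (2 + c + double k) < m
      c<′ = subst (λ x → suc x < m) (trans (+-suc c (suc (double k))) (cong suc (+-suc c (double k)))) c<
      apart : ∀ {x} → ¬ (x ∈ slab c v × x ∈ slabs (2 + c) k v)
      apart (p , q) with ∈-slab⁻ c v p | ∈-slabs⁻ (2 + c) k v q
      ... | a , _ , a≤ , e , _ | b , b≥ , b≤ , e′ , _ = <⇒≢ (≤-<-trans a≤ b≥)
            (toℕ-col-injective (≤-<-trans a≤
                (≤-<-trans (n≤1+n _) (≤-<-trans (s≤s (s≤s (m≤m+n c (double k)))) (<-trans ≤-refl c<′))))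
              (≤-<-trans b≤ c<′) (trans (sym e) e′))

    block : Fin n → List (Vertex m n)
    block = slabs 1 q

    block-walk : ∀ {v} → v ∈ M → Walk _~_ (col 1 , v) (col top , v) (block v)
    block-walk v∈M = slabs-walk q v∈M ≤-refl refl

    -- A jump traversed from its odd end passes the detour forwards, and one traversed towards its
    -- odd end passes it backwards.
    piece : Kind → Fin n → List (Vertex m n)
    piece plain v = (col 0 , v) ∷ []
    piece leaving v = (col 0 , v) ∷ block v
    piece entering v = reverse (block v) ∷ʳ (col 0 , v)

    entry exit : Kind → Fin n → Vertex m n
    entry entering v = col top , v
    entry _ v = col 0 , v
    exit leaving v = col top , v
    exit _ v = col 0 , v

    piece-walk : ∀ k {v} → (k ≢ plain → v ∈ M) → Walk _~_ (entry k v) (exit k v) (piece k v)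
    piece-walk plain _ = [-]
    piece-walk leaving p = flat-right (p λ ()) (s≤s (s≤s z≤n)) refl ∷ block-walk (p λ ())
    piece-walk entering p = snocWalk _~_ (reverseWalk _~_ ~-sym (block-walk (p λ ())))
      (~-sym (flat-right (p λ ()) (s≤s (s≤s z≤n)) refl))

    -- The share of the torus belonging to one vertex of the multigraph. Shares are disjoint, so
    -- distinctness of the expanded cycle reduces to that of `trace`.
    Part : Fin n → Vertex m n → Set
    Part v x = x ≡ (col 0 , v) ⊎ (v ∈ M × x ∈ block v)

    col0∉block : ∀ {v x} → proj₁ x ≡ col 0 → x ∉ block v
    col0∉block e x∈ with ∈-slabs⁻ 1 q _ x∈
    ... | c , c≥1 , c≤ , e′ , _ = <⇒≢ c≥1 (toℕ-col-injective (s≤s z≤n) (s≤s c≤) (trans (sym e) e′))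

    part-injective : ∀ {u v x} → Part u x → Part v x → u ≡ v
    part-injective (inj₁ refl) (inj₁ e) = cong proj₂ e
    part-injective (inj₁ refl) (inj₂ (_ , x∈)) = contradiction x∈ (col0∉block refl)
    part-injective (inj₂ (_ , x∈)) (inj₁ refl) = contradiction x∈ (col0∉block refl)
    part-injective {u} {v} (inj₂ (u∈ , x∈)) (inj₂ (v∈ , x∈′)) with ∈-slabs⁻ 1 q u x∈ | ∈-slabs⁻ 1 q v x∈′
    ... | _ , _ , _ , _ , r∈ | _ , _ , _ , _ , r∈′ = run-disjoint u∈ v∈ r∈ r∈′

    piece-part : ∀ k {v x} → (k ≢ plain → v ∈ M) → x ∈ piece k v → Part v x
    piece-part plain _ (here e) = inj₁ e
    piece-part leaving _ (here e) = inj₁ e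
    piece-part leaving p (there x∈) = inj₂ (p (λ ()) , x∈)
    piece-part entering {v} p x∈ with ∈-∷ʳ⁻ (reverse (block v)) x∈
    ... | inj₁ x∈′ = inj₂ (p (λ ()) , ∈-resp-↭ (↭-reverse (block v)) x∈′)
    ... | inj₂ e = inj₁ e

    block-unique : ∀ v → Unique (block v)
    block-unique v = slabs-unique 1 q v ≤-refl

    piece-unique : ∀ k v → Unique (piece k v)
    piece-unique plain v = (λ ()) ∷! []
    piece-unique leaving v = (col0∉block refl) ∷! block-unique v
    piece-unique entering v = ∷ʳ-unique (∉-reverse (col0∉block refl)) (reverse-unique (block-unique v))

    piece-vertex : ∀ k v → (col 0 , v) ∈ piece k v
    piece-vertex plain v = here refl
    piece-vertex leaving v = here refl
    piece-vertex entering v = ∈-++⁺ʳ (reverse (block v)) (here refl)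

    piece-block : ∀ k {v x} → k ≢ plain → x ∈ block v → x ∈ piece k v
    piece-block plain k≢ _ = contradiction refl k≢
    piece-block leaving _ x∈ = there x∈
    piece-block entering {v} _ x∈ = ∈-++⁺ˡ (∈-resp-↭ (↭-sym (↭-reverse (block v))) x∈)

    vertical-move : ∀ {i} c v → c ≢ two → (i , v) ~ (i , move c v)
    vertical-move {i} c v c≢ = go (dir c (par v)) (unit c (par v) c≢)
      where
      unit : ∀ c p → c ≢ two → dir c p ≡ + 1 ⊎ dir c p ≡ - + 1
      unit zero 1ℙ _ = inj₁ refl
      unit zero 0ℙ _ = inj₂ refl
      unit (suc zero) 1ℙ _ = inj₂ refl
      unit (suc zero) 0ℙ _ = inj₁ refl
      unit (suc (suc zero)) _ c≢ = contradiction refl c≢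
      go : ∀ s → s ≡ + 1 ⊎ s ≡ - + 1 → (i , v) ~ (i , ν (⟦ v ⟧ ℤ.+ s))
      go _ (inj₁ refl) = subst (λ u → (i , u) ~ (i , ν (⟦ v ⟧ ℤ.+ + 1))) (ν-⟦⟧ v) (vertical-edge ⟦ v ⟧)
      go _ (inj₂ refl) = ~-sym (subst (λ u → (i , ν (⟦ v ⟧ ℤ.+ - + 1)) ~ (i , u))
        (trans (cong ν (cancel ⟦ v ⟧)) (ν-⟦⟧ v)) (vertical-edge (⟦ v ⟧ ℤ.+ - + 1)))
        where
        cancel : ∀ z → z ℤ.+ - + 1 ℤ.+ + 1 ≡ z
        cancel = ℤ-solve-∀

    jump-move : ∀ v → par v ≡ 1ℙ → (col top , v) ~ (col 0 , move two v)
    jump-move v odd = subst₂ (λ u w → (col top , u) ~ (col 0 , w)) (ν-⟦⟧ v)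
      (cong (λ p → ν (⟦ v ⟧ ℤ.+ dir two p)) (sym odd))
      (jump-edge ⟦ v ⟧ refl (≋-trans (odd⇒≋1 (toℕ v) odd) (≋-sym (odd⇒≋1 m (parity-suc-double (suc q))))))

    exit-≡ : ∀ {k v} → k ≢ leaving → exit k v ≡ (col 0 , v)
    exit-≡ {plain} _ = refl
    exit-≡ {entering} _ = refl
    exit-≡ {leaving} k≢ = contradiction refl k≢

    entry-≡ : ∀ {k v} → k ≢ entering → entry k v ≡ (col 0 , v)
    entry-≡ {plain} _ = refl
    entry-≡ {leaving} _ = refl
    entry-≡ {entering} k≢ = contradiction refl k≢

    -- Since `c ≢ d`, no vertex lies between two jumps, so at most one of them claims its detour.
    link : ∀ a v c d → c ≢ d → exit (kind a v c) v ~ entry (kind c (move c v) d) (move c v)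
    link a v c d c≢d = go c≢d (c ≟ᶠ two)
      where
      go : ∀ {c} → c ≢ d → Dec (c ≡ two) → exit (kind a v c) v ~ entry (kind c (move c v) d) (move c v)
      go {c} c≢d (no c≢2) = subst₂ _~_ (sym (exit-≡ (kind-≢leaving a v c c≢2)))
          (sym (entry-≡ (kind-≢entering c (move c v) d c≢2)))
        (vertical-move c v c≢2)
      go c≢d (yes refl) with odd-or-even (par v)
      ... | inj₁ odd = subst₂ (λ k k′ → exit k v ~ entry k′ (move two v)) (sym (kind-leaving a v odd))
        (sym (kind-even two (move two v) d (trans (par-move two v) (cong _⁻¹ odd)))) (jump-move v odd)
      ... | inj₂ even = subst₂ (λ k k′ → exit k v ~ entry k′ (move two v)) (sym (kind-even a v two even))
        (sym (kind-entering (move two v) d odd (≢-sym c≢d)))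
        (~-sym (subst (λ u → (col top , move two v) ~ (col 0 , u)) (move-involutive two v)
            (jump-move (move two v) odd)))
        where
        odd : par (move two v) ≡ 1ℙ
        odd = trans (par-move two v) (cong _⁻¹ even)

    expand : Colour → Fin n → List Colour → Colour → List (Vertex m n)
    expand a v [] y = piece (kind a v y) v
    expand a v (c ∷ w) y = piece (kind a v c) v ++ expand c (move c v) w y

    firstColour : List Colour → Colour → Colour
    firstColour [] y = y
    firstColour (c ∷ _) _ = c

    reduced-first : ∀ {a w y} → Reduced a w y → a ≢ firstColour w y
    reduced-first ([] a≢) = a≢
    reduced-first (a≢ ∷ _) = a≢

    marked : ∀ a v b → (∀ {r} → r ∈ mark (kind a v b) v → r ∈ M) → kind a v b ≢ plain → v ∈ M
    marked a v b ⊆M k≢ = ⊆M (in-mark (kind a v b) k≢)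
      where
      in-mark : ∀ k → k ≢ plain → v ∈ mark k v
      in-mark plain k≢ = contradiction refl k≢
      in-mark leaving _ = here refl
      in-mark entering _ = here refl

    expand-walk : ∀ a v w y → Reduced a w y → (∀ {r} → r ∈ marks a v w y → r ∈ M) →
      Walk _~_ (entry (kind a v (firstColour w y)) v) (exit (kind (lastColour a w) (end v w) y) (end v w))
          (expand a v w y)
    expand-walk a v [] y _ ⊆M = piece-walk (kind a v y) (marked a v y ⊆M)
    expand-walk a v (c ∷ w) y (a≢c ∷ r) ⊆M = joinWalk _~_ (piece-walk (kind a v c) (marked a v c (⊆M ∘ ∈-++⁺ˡ)))
      (link a v c (firstColour w y) (reduced-first r))
      (expand-walk c (move c v) w y r (⊆M ∘ ∈-++⁺ʳ (mark (kind a v c) v)))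

    expand-part : ∀ a v w y → (∀ {r} → r ∈ marks a v w y → r ∈ M) → ∀ {x} → x ∈ expand a v w y →
                  ∃[ u ] (u ∈ trace v w × Part u x)
    expand-part a v [] y ⊆M x∈ = v , here refl , piece-part (kind a v y) (marked a v y ⊆M) x∈
    expand-part a v (c ∷ w) y ⊆M {x} x∈ = [ inFirst , inRest ]′ (∈-++⁻ (piece (kind a v c) v) x∈)
      where
      inFirst : x ∈ piece (kind a v c) v → ∃[ u ] (u ∈ trace v (c ∷ w) × Part u x)
      inFirst x∈ = v , here refl , piece-part (kind a v c) (marked a v c (⊆M ∘ ∈-++⁺ˡ)) x∈
      inRest : x ∈ expand c (move c v) w y → ∃[ u ] (u ∈ trace v (c ∷ w) × Part u x)
      inRest x∈ = Product.map₂ (Product.map₁ there)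
        (expand-part c (move c v) w y (⊆M ∘ ∈-++⁺ʳ (mark (kind a v c) v)) x∈)

    expand-unique : ∀ a v w y → Unique (trace v w) → (∀ {r} → r ∈ marks a v w y → r ∈ M) → Unique
        (expand a v w y)
    expand-unique a v [] y _ ⊆M = piece-unique (kind a v y) v
    expand-unique a v (c ∷ w) y (v∉ ∷ t!) ⊆M = Uniqueₚ.++⁺ (piece-unique (kind a v c) v)
        (expand-unique c (move c v) w y t! (⊆M ∘ ∈-++⁺ʳ (mark (kind a v c) v))) apart
      where
      apart : ∀ {x} → ¬ (x ∈ piece (kind a v c) v × x ∈ expand c (move c v) w y)
      apart (x∈ , x∈′) = All¬⇒¬Any v∉ (subst (_∈ trace (move c v) w)
          (part-injective (proj₂ (proj₂ later)) (piece-part (kind a v c) (marked a v c (⊆M ∘ ∈-++⁺ˡ)) x∈))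
              (proj₁ (proj₂ later)))
        where later = expand-part c (move c v) w y (⊆M ∘ ∈-++⁺ʳ (mark (kind a v c) v)) x∈′

    expand-vertex : ∀ a v w y {u} → u ∈ trace v w → (col 0 , u) ∈ expand a v w y
    expand-vertex a v [] y (here refl) = piece-vertex (kind a v y) v
    expand-vertex a v (c ∷ w) y (here refl) = ∈-++⁺ˡ (piece-vertex (kind a v c) v)
    expand-vertex a v (c ∷ w) y (there u∈) = ∈-++⁺ʳ (piece (kind a v c) v) (expand-vertex c (move c v) w y u∈)

    expand-block : ∀ a v w y {u x} → u ∈ marks a v w y → x ∈ block u → x ∈ expand a v w y
    expand-block a v [] y u∈ x∈ with mark-∈ (kind a v y) u∈
    ... | refl , k≢ = piece-block (kind a v y) k≢ x∈
    expand-block a v (c ∷ w) y u∈ x∈ with ∈-++⁻ (mark (kind a v c) v) u∈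
    ... | inj₂ u∈′ = ∈-++⁺ʳ (piece (kind a v c) v) (expand-block c (move c v) w y u∈′ x∈)
    ... | inj₁ u∈′ with mark-∈ (kind a v c) u∈′
    ... | refl , k≢ = ∈-++⁺ˡ (piece-block (kind a v c) k≢ x∈)

  module _ (1-odd : par (ρ 1) ≡ 1ℙ) (J : JumpingCycle) where
    open JumpingCycle J renaming (last to closing)

    private
      M : List (Fin n)
      -- The closing colour also precedes the start, so that a closing jump ending at the row 1 is
      -- marked there.
      M = marks closing (ρ 1) word closing

      some-mark : two ∈ closing ∷ word → ∃[ r ] r ∈ M
      some-mark (there 2∈) = jump-marked closing (ρ 1) word closing 2∈
      some-mark (here e) = ρ 1 , subst (λ c → ρ 1 ∈ marks c (ρ 1) word closing) e
          (marked-after-jump (ρ 1) word closing 1-odd)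

      open Runs M (marks-odd closing (ρ 1) word closing) (proj₁ (some-mark jumps)) (proj₂ (some-mark jumps))

      reduced-last : ∀ {a w y} → Reduced a w y → lastColour a w ≢ y
      reduced-last ([] a≢) = a≢
      reduced-last (_ ∷ r) = reduced-last r

      vertices : List (Vertex m n)
      vertices = expand closing (ρ 1) word closing

      everywhere : ∀ x → x ∈ vertices
      everywhere (i , r) = subst (λ i → (i , r) ∈ vertices) (toℕ-injective (toℕ-col (toℕ<n i)))
          (go (toℕ i) (toℕ<n i))
        where
        go : ∀ c → c < m → (col c , r) ∈ vertices
        go zero _ = expand-vertex closing (ρ 1) word closing (full r)
        go (suc c) (s≤s c≤) with covering r
        ... | v , v∈ , r∈ = expand-block closing (ρ 1) word closing v∈ (∈-slabs⁺ 1 q v r∈ (s≤s z≤n) c≤)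

    -- The length is not summed over the detours: the vertices are distinct and exhaust the torus.
    hamiltonian : ClosedWalk _~_ (m * n)
    hamiltonian = closedWalk
      (expand-walk closing (ρ 1) word closing reduced (λ r∈ → r∈))
      (subst (λ u → exit (kind (lastColour closing word) (end (ρ 1) word) closing) (end (ρ 1) word) ~
          entry (kind closing u (firstColour word closing)) u) closes
        (link (lastColour closing word) (end (ρ 1) word) closing (firstColour word closing)
            (reduced-first reduced)))
      vertices!
      (trans (enumerations-length vertices! (Uniqueₚ.cartesianProduct⁺ (Uniqueₚ.allFin⁺ m) (Uniqueₚ.allFin⁺ n))
          everywhere (λ (i , r) → ∈-cartesianProduct⁺ (∈-allFin i) (∈-allFin r)))
        (trans (length-cartesianProduct (allFin m) (allFin n))
            (cong₂ _*_ (length-tabulate {n = m} (λ i → i)) (length-tabulate {n = n} (λ i → i)))))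
      where
      vertices! : Unique vertices
      vertices! = expand-unique closing (ρ 1) word closing distinct (λ r∈ → r∈)

-- Assembling the cases by the number of columns

module Combined (g₁ : ℕ) (ℓ : ℤ) where

  n : ℕ
  n = double (2 + g₁)

  private
    ℓ-odd : ∀ {m} → parity m ≡ 1ℙ → ℓ ≡ + m [mod 2 ] → ℓ ≋ + 1 [ 2 ]
    ℓ-odd {m} m-odd ℓ≡m = ≋-trans (≡[mod]⇒≋ {ℓ} {+ m} ℓ≡m) (odd⇒≋1 m m-odd)

  singleColumn : SimpleCubic (HTG 1 n ℓ) → ℓ ≡ + 1 [mod 2 ] → ∀ κ → 4 * κ + 2 ≤ n → ClosedWalk (HTG 1 n ℓ)
      (4 * κ + 2)
  singleColumn cubic ℓ≡1 κ L≤n = OneColumn.oneColumn n ℓ (2∣double (2 + g₁)) cubic (s≤s (s≤s z≤n))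
      (ℓ-odd {1} refl ℓ≡1) κ
      (2 + g₁ ∸ L/2) (trans (cong (_+ double (2 + g₁ ∸ L/2)) L≡)
          (trans (sym (double-+ L/2 _)) (cong double (m+[n∸m]≡n L/2≤))))
    where
    L/2 = κ + κ + 1
    double-+ : ∀ a b → double (a + b) ≡ double a + double b
    double-+ zero b = refl
    double-+ (suc a) b = cong (λ z → 2 + z) (double-+ a b)
    L≡ : 4 * κ + 2 ≡ double L/2
    L≡ = trans (lem κ) (sym (double≡+ L/2))
      where
      lem : ∀ κ → 4 * κ + 2 ≡ (κ + κ + 1) + (κ + κ + 1)
      lem = solve-∀
    L/2≤ : L/2 ≤ 2 + g₁
    L/2≤ = *-cancelˡ-≤ 2 (subst₂ _≤_ (lem κ)
        (trans (double≡+ (2 + g₁)) (cong (λ z → 2 + g₁ + z) (sym (+-identityʳ (2 + g₁))))) L≤n)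
      where
      lem : ∀ κ → 4 * κ + 2 ≡ 2 * (κ + κ + 1)
      lem = solve-∀

  oddlyMany : ∀ q → let m = suc (double (suc q)) in ℓ ≡ + m [mod 2 ] → ∀ κ → 2 + 4 * κ ≤ m * n → ClosedWalk
      (HTG m n ℓ) (2 + 4 * κ)
  oddlyMany q ℓ≡m κ L≤ = [ (λ L≡ → subst (ClosedWalk (HTG _ n ℓ)) (sym L≡) full) , (λ c → c) ]′
      (oddlyManyColumns q g₁ ℓ κ L≤)
    where
    ℓ≋1 : ℓ ≋ + 1 [ 2 ]
    ℓ≋1 = ℓ-odd {suc (double (suc q))} (parity-suc-double (suc q)) ℓ≡m
    open Rows n ℓ (2∣double (2 + g₁)) ℓ≋1
    full : ClosedWalk (HTG (suc (double (suc q))) n ℓ) (suc (double (suc q)) * n)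
    full = Expansion.hamiltonian q n ℓ (2∣double (2 + g₁)) ℓ≋1 (par-ρ 1)
      (jumpingCycle (double (suc g₁)) refl (parity-double (suc g₁)) λ ())

  anyColumns : ∀ m → 1 ≤ m → ℓ ≡ + m [mod 2 ] → SimpleCubic (HTG m n ℓ) →
        ∀ κ → 4 * κ + 2 ≤ m * n → ClosedWalk (HTG m n ℓ) (4 * κ + 2)
  anyColumns m 1≤m ℓ≡m cubic κ L≤ with halve m
  ... | zero , inj₁ refl = contradiction 1≤m λ ()
  ... | suc q , inj₁ refl = subst (ClosedWalk (HTG _ n ℓ)) (+-comm 2 (4 * κ))
        (evenlyManyColumns q g₁ ℓ κ (subst (_≤ double (suc q) * n) (+-comm (4 * κ) 2) L≤))
  ... | zero , inj₂ refl = singleColumn cubic ℓ≡m κ (subst (4 * κ + 2 ≤_) (+-identityʳ n) L≤)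
  ... | suc q , inj₂ refl = subst (ClosedWalk (HTG _ n ℓ)) (+-comm 2 (4 * κ))
        (oddlyMany q ℓ≡m κ (subst (_≤ suc (double (suc q)) * n) (+-comm (4 * κ) 2) L≤))

even≥4 : ∀ {n} → 4 ≤ n → 2 ∣ n → ∃[ g ] n ≡ double (2 + g)
even≥4 4≤n (ℕ.divides zero refl) = contradiction 4≤n λ ()
even≥4 4≤n (ℕ.divides (suc zero) refl) = contradiction 4≤n λ { (s≤s (s≤s ())) }
even≥4 4≤n (ℕ.divides (suc (suc g)) refl) = g , trans (lem (2 + g)) (sym (double≡+ (2 + g)))
  where
  lem : ∀ h → h * 2 ≡ h + h
  lem = solve-∀

≡2[mod4] : ∀ L → + L ≡ + 2 [mod 4 ] → ∃[ κ ] 4 * κ + 2 ≡ L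
≡2[mod4] L L≡2 = L / 4 , trans (cong (λ z → 4 * (L / 4) + z) (sym r≡2))
    (trans (lem (L % 4) (L / 4)) (sym (m≡m%n+[m/n]*n L 4)))
  where
  lem : ∀ r k → 4 * k + r ≡ r + k * 4
  lem = solve-∀
  r≋L : + (L % 4) ≋ + L [ 4 ]
  r≋L = ≋-sym (multiple (+ (L / 4)) (trans (cong +_ (m≡m%n+[m/n]*n L 4))
    (cong (λ z → + (L % 4) ℤ.+ z) (ℤₚ.pos-* (L / 4) 4))))
  r≡2 : L % 4 ≡ 2
  r≡2 = residue-unique (m%n<n L 4) (s≤s (s≤s (s≤s z≤n))) (≋-trans r≋L (≡[mod]⇒≋ {+ L} {+ 2} L≡2))

theorem5p2 : (m n : ℕ) (ℓ : ℤ) → 1 ≤ m → 4 ≤ n → 2 ∣ n → ℓ ≡ + m [mod 2 ] →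
    SimpleCubic (HTG m n ℓ) →
    (L : ℕ) → + L ≡ + 2 [mod 4 ] → 6 ≤ L → L ≤ m * n →
    HasCycle (HTG m n ℓ) L
theorem5p2 m n ℓ 1≤m 4≤n 2∣n ℓ≡m cubic L L≡2 6≤L L≤ with even≥4 4≤n 2∣n | ≡2[mod4] L L≡2
... | g₁ , refl | κ , refl = closedWalk⇒cycle (Combined.anyColumns g₁ ℓ m 1≤m ℓ≡m cubic κ L≤)
    (≤-trans (s≤s (s≤s (s≤s z≤n))) 6≤L)
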